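{- The problem $d$-DISTANCE $k$-DOMINATING SET is W[2]-hard with parameter $k$ in each of the following cases: (i) for any fixed $d\ge 2$, restricted to unit 2-track interval graphs; (ii) for $d=2$, restricted to co-3-interval graphs (complements of 3-interval graphs); (iii) for any fixed $d\ge 3$, restricted to co-4-interval graphs (complements of 4-interval graphs).
   Context: $d$-DISTANCE $k$-DOMINATING SET (for a fixed integer $d\ge1$): given a graph $H$ and an integer $k$, decide whether $H$ has a set $D$ of $k$ vertices such that every vertex of $H$ is at distance at most $d$ in $H$ from some vertex of $D$ (equivalently, $D$ is a dominating set of the $d$th power of $H$). The intersection graph of a family of sets has one vertex per member, two different members being adjacent iff they intersect; the family is a representation of the graph. A $t$-interval is the union of $t$ disjoint intervals in the real line; a $t$-interval graph is the intersection graph of a family of $t$-intervals; a co-$t$-interval graph is the complement of a $t$-interval graph. A 2-track interval is the union of two intervals on two disjoint parallel lines (tracks), one on each track; a unit 2-track interval graph is the intersection graph of a family of 2-track intervals in which all intervals have unit length. A multiple-interval representation (of $H$, or of its complement in the co-interval cases) is given as part of the input. A parameterized problem is W[2]-hard if every problem in W[2] has an FPT reduction to it; equivalently, if $k$-DOMINATING SET in general graphs (parameter $k$) has an FPT reduction to it. An FPT reduction maps an instance $(x,k)$ to an equivalent instance $(x',k')$ in time $g(k)\cdot|x|^{O(1)}$ with $k'\le h(k)$, for computable functions $g,h$. -}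

module Defs where

open import Data.Fin using (Fin)
open import Data.Fin.Properties using (_≟_)
open import Data.Fin.Subset as Subset using (Subset)
open import Data.Bool using (Bool; true; false)
open import Data.Integer as ℤ using (ℤ)
open import Data.List using (foldr; tabulate)
open import Data.Nat using (ℕ; zero; suc; _+_; _*_; _^_; _≤_)
open import Data.Nat.Binary using (ℕᵇ; zero; 2[1+_]; 1+[2_]; fromℕ)
open import Data.Product using (∃-syntax; _×_; _,_)
open import Data.Rational.Unnormalised as ℚ using (ℚᵘ; 1ℚᵘ; ↥_; ↧ₙ_)
open import Data.Sign as Sign using (Sign)
open import Data.Sum using (_⊎_)
open import Data.Vec using (Vec; []; _∷_; lookup)
open import Function using (_∘_; _⇔_)
open import Level using (0ℓ)
open import Relation.Binary using (Rel; Decidable; Symmetric; Irreflexive)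
open import Relation.Binary.PropositionalEquality using (_≡_; _≢_; sym)
open import Relation.Nullary using (¬_; does; ¬?; _×-dec_)
open import Relation.Unary using (Pred; _∈_; _≬_; ⋃)

------------------------------------------------------------------------
-- Model of computation: a first-order WHILE language on binary trees (in
-- the style of N. D. Jones, "Computability and Complexity").  A tree is
-- read as the bracket string that denotes it, so `size` is input length
-- up to a constant factor.

data Tree : Set where
  nil : Tree
  _∙_ : Tree → Tree → Tree

infixr 5 _∙_

size : Tree → ℕ
size nil     = 1
size (s ∙ t) = 1 + size s + size t

-- Programs with n free variables (de Bruijn indices).  In `case e f g`,
-- g binds the left and right subtrees as variables 0 and 1.  `while e f`
-- updates variable 0 to the value of f as long as e is not nil, and
-- returns the final value of variable 0.

data Program : ℕ → Set where
  var   : ∀ {n} → Fin n → Program n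
  nil   : ∀ {n} → Program n
  cons  : ∀ {n} → Program n → Program n → Program n
  case  : ∀ {n} → Program n → Program n → Program (2 + n) → Program n
  bind  : ∀ {n} → Program n → Program (1 + n) → Program n
  while : ∀ {n} → Program (1 + n) → Program (1 + n) → Program (1 + n)

-- ρ ⊢ e ⇓ v [ c ] : in environment ρ, e terminates with value v in time c.
-- Reading a variable costs the size of the tree copied, and so does
-- returning from a loop.  Hence the time bounds both the number of steps
-- and the size of every value constructed, and polynomial time here is
-- polynomial time on Turing machines.

infix 3 _⊢_⇓_[_]

data _⊢_⇓_[_] : ∀ {n} → Vec Tree n → Program n → Tree → ℕ → Set where

  ⇓var : ∀ {n} {ρ : Vec Tree n} (i : Fin n) →
         ρ ⊢ var i ⇓ lookup ρ i [ size (lookup ρ i) ]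

  ⇓nil : ∀ {n} {ρ : Vec Tree n} →
         ρ ⊢ nil ⇓ nil [ 1 ]

  ⇓cons : ∀ {n} {ρ : Vec Tree n} {e f u v a b} →
          ρ ⊢ e ⇓ u [ a ] →
          ρ ⊢ f ⇓ v [ b ] →
          ρ ⊢ cons e f ⇓ u ∙ v [ 1 + a + b ]

  ⇓case-nil : ∀ {n} {ρ : Vec Tree n} {e f g v a b} →
              ρ ⊢ e ⇓ nil [ a ] →
              ρ ⊢ f ⇓ v [ b ] →
              ρ ⊢ case e f g ⇓ v [ 1 + a + b ]

  ⇓case-∙ : ∀ {n} {ρ : Vec Tree n} {e f g s t v a b} →
            ρ ⊢ e ⇓ s ∙ t [ a ] →
            s ∷ t ∷ ρ ⊢ g ⇓ v [ b ] →
            ρ ⊢ case e f g ⇓ v [ 1 + a + b ]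

  ⇓bind : ∀ {n} {ρ : Vec Tree n} {e f u v a b} →
          ρ ⊢ e ⇓ u [ a ] →
          u ∷ ρ ⊢ f ⇓ v [ b ] →
          ρ ⊢ bind e f ⇓ v [ 1 + a + b ]

  ⇓while-stop : ∀ {n} {ρ : Vec Tree n} {e f u a} →
                u ∷ ρ ⊢ e ⇓ nil [ a ] →
                u ∷ ρ ⊢ while e f ⇓ u [ 1 + a + size u ]

  ⇓while-step : ∀ {n} {ρ : Vec Tree n} {e f s t u v w a b c} →
                u ∷ ρ ⊢ e ⇓ s ∙ t [ a ] →
                u ∷ ρ ⊢ f ⇓ v [ b ] →
                v ∷ ρ ⊢ while e f ⇓ w [ c ] →
                u ∷ ρ ⊢ while e f ⇓ w [ 1 + a + b + c ]

------------------------------------------------------------------------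
-- Encodings.  Numbers are written in binary.

encodeBool : Bool → Tree
encodeBool false = nil
encodeBool true  = nil ∙ nil

encodeℕᵇ : ℕᵇ → Tree
encodeℕᵇ zero     = nil
encodeℕᵇ 2[1+ x ] = encodeBool false ∙ encodeℕᵇ x
encodeℕᵇ 1+[2 x ] = encodeBool true ∙ encodeℕᵇ x

encodeℕ : ℕ → Tree
encodeℕ n = encodeℕᵇ (fromℕ n)

encodeSign : Sign → Tree
encodeSign Sign.+ = encodeBool false
encodeSign Sign.- = encodeBool true

encodeℤ : ℤ → Tree
encodeℤ i = encodeSign (ℤ.sign i) ∙ encodeℕ ℤ.∣ i ∣

encodeℚ : ℚᵘ → Tree
encodeℚ p = encodeℤ (↥ p) ∙ encodeℕ (↧ₙ p)

encodeFamily : ∀ {A : Set} {n} → (A → Tree) → (Fin n → A) → Tree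
encodeFamily enc f = foldr (λ x t → enc x ∙ t) nil (tabulate f)

------------------------------------------------------------------------
-- Parameterized problems and FPT reductions

record ParameterizedProblem : Set₂ where
  field
    Instance  : Set₁
    encode    : Instance → Tree
    parameter : Instance → ℕ
    Yes       : Instance → Set

Computable : (ℕ → ℕ) → Set
Computable f =
  ∃[ e ] (∀ n → ∃[ c ] (encodeℕ n ∷ [] ⊢ e ⇓ encodeℕ (f n) [ c ]))

-- The constant hidden in |x|^O(1) as a factor is absorbed by g.

record FPTReduction (P Q : ParameterizedProblem) : Set₁ where
  private
    module P = ParameterizedProblem P
    module Q = ParameterizedProblem Q
  field
    reduce       : P.Instance → Q.Instance
    correct      : ∀ x → P.Yes x ⇔ Q.Yes (reduce x)
    h            : ℕ → ℕ
    h-computable : Computable h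
    parameter-≤  : ∀ x → Q.parameter (reduce x) ≤ h (P.parameter x)
    g            : ℕ → ℕ
    g-computable : Computable g
    degree       : ℕ
    program      : Program 1
    runs         : ∀ x → ∃[ c ]
      (P.encode x ∷ [] ⊢ program ⇓ Q.encode (reduce x) [ c ]) ×
      c ≤ g (P.parameter x) * size (P.encode x) ^ degree

------------------------------------------------------------------------
-- Graphs and domination

record Graph (n : ℕ) : Set₁ where
  field
    Adj    : Rel (Fin n) 0ℓ
    adj?   : Decidable Adj
    symm   : Symmetric Adj
    irrefl : Irreflexive _≡_ Adj

open Graph public using (Adj; adj?)

-- Adjacency matrix
encodeGraph : ∀ {n} → Graph n → Tree
encodeGraph G =
  encodeFamily (encodeFamily encodeBool) (λ u v → does (adj? G u v))

complement : ∀ {n} → Graph n → Graph n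
complement G = record
  { Adj    = λ u v → u ≢ v × ¬ Adj G u v
  ; adj?   = λ u v → ¬? (u ≟ v) ×-dec ¬? (adj? G u v)
  ; symm   = λ (u≢v , ¬uv) → u≢v ∘ sym , ¬uv ∘ Graph.symm G
  ; irrefl = λ u≡v (u≢v , _) → u≢v u≡v
  }

data Walk {n} (G : Graph n) : ℕ → Fin n → Fin n → Set where
  []  : ∀ {u} → Walk G 0 u u
  _∷_ : ∀ {ℓ u v w} → Adj G u v → Walk G ℓ v w → Walk G (suc ℓ) u w

DistanceAtMost : ∀ {n} → Graph n → ℕ → Fin n → Fin n → Set
DistanceAtMost G d u v = ∃[ ℓ ] ℓ ≤ d × Walk G ℓ u v

Dominating : ∀ {n} → Graph n → Subset n → Set
Dominating G D = ∀ v → ∃[ u ] u Subset.∈ D × (u ≡ v ⊎ Adj G u v)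

DistanceDominating : ∀ {n} → ℕ → Graph n → Subset n → Set
DistanceDominating d G D = ∀ v → ∃[ u ] u Subset.∈ D × DistanceAtMost G d u v

------------------------------------------------------------------------
-- Intersection graphs of multiple intervals

-- G is the intersection graph of S, a family of sets indexed by the
-- vertices.
IsIntersectionGraph : ∀ {A : Set} {n} → (Fin n → Pred A 0ℓ) → Graph n → Set
IsIntersectionGraph S G = ∀ u v → Adj G u v ⇔ (u ≢ v × (S u ≬ S v))

-- Closed intervals with rational endpoints: representations are inputs and
-- must be finite objects, and every finite family of (unit) intervals of
-- the real line has the same intersection pattern as a rational one.
record Interval : Set where
  field
    left       : ℚᵘ
    right      : ℚᵘ
    left≤right : left ℚ.≤ right

open Interval public

⟦_⟧ : Interval → Pred ℚᵘ 0ℓ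
⟦ I ⟧ x = left I ℚ.≤ x × x ℚ.≤ right I

encodeInterval : Interval → Tree
encodeInterval I = encodeℚ (left I) ∙ encodeℚ (right I)

UnitLength : Interval → Set
UnitLength I = right I ℚ.- left I ℚ.≃ 1ℚᵘ

record MultiInterval (t : ℕ) : Set where
  field
    piece    : Fin t → Interval
    disjoint : ∀ i j → i ≢ j → ¬ (⟦ piece i ⟧ ≬ ⟦ piece j ⟧)

  points : Pred ℚᵘ 0ℓ
  points = ⋃ (Fin t) (λ i → ⟦ piece i ⟧)

-- A point (τ , x) is the point x of the line τ.
record UnitTwoTrackInterval : Set where
  field
    track : Fin 2 → Interval
    unit  : ∀ τ → UnitLength (track τ)

  points : Pred (Fin 2 × ℚᵘ) 0ℓ
  points (τ , x) = x ∈ ⟦ track τ ⟧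

-- A class of graphs, each given with a representation of a certain kind.
record RepresentedClass : Set₁ where
  field
    Representation : ℕ → Set
    encodeRep      : ∀ {n} → Representation n → Tree
    Represents     : ∀ {n} → Representation n → Graph n → Set

multiIntervalGraphs : ℕ → RepresentedClass
multiIntervalGraphs t = record
  { Representation = λ n → Fin n → MultiInterval t
  ; encodeRep      =
      encodeFamily (λ I → encodeFamily encodeInterval (MultiInterval.piece I))
  ; Represents     = λ R → IsIntersectionGraph (MultiInterval.points ∘ R)
  }

unitTwoTrackIntervalGraphs : RepresentedClass
unitTwoTrackIntervalGraphs = record
  { Representation = λ n → Fin n → UnitTwoTrackInterval
  ; encodeRep      =
      encodeFamily
        (λ I → encodeFamily encodeInterval (UnitTwoTrackInterval.track I))
  ; Represents     = λ R → IsIntersectionGraph (UnitTwoTrackInterval.points ∘ R)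
  }

co : RepresentedClass → RepresentedClass
co C = record
  { Representation = Representation
  ; encodeRep      = encodeRep
  ; Represents     = λ R G → Represents R (complement G)
  }
  where open RepresentedClass C

------------------------------------------------------------------------
-- The problems

record GraphInstance : Set₁ where
  field
    n     : ℕ
    graph : Graph n
    k     : ℕ

k-DominatingSet : ParameterizedProblem
k-DominatingSet = record
  { Instance  = GraphInstance
  ; encode    = λ x → let open GraphInstance x in encodeGraph graph ∙ encodeℕ k
  ; parameter = GraphInstance.k
  ; Yes       = λ x → let open GraphInstance x in
                  ∃[ D ] Subset.∣ D ∣ ≡ k × Dominating graph D
  }

record RepresentedInstance (C : RepresentedClass) : Set₁ where
  open RepresentedClass C
  field
    n              : ℕ
    graph          : Graph n
    k              : ℕ
    representation : Representation n
    represents     : Represents representation graph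

DistanceDominatingSet : ℕ → RepresentedClass → ParameterizedProblem
DistanceDominatingSet d C = record
  { Instance  = RepresentedInstance C
  ; encode    = λ x → let open RepresentedInstance x in
                  encodeGraph graph ∙ encodeℕ k ∙
                  RepresentedClass.encodeRep C representation
  ; parameter = RepresentedInstance.k
  ; Yes       = λ x → let open RepresentedInstance x in
                  ∃[ D ] Subset.∣ D ∣ ≡ k × DistanceDominating d graph D
  }

-- W[2] is the class of problems with an FPT reduction to k-DominatingSet,
-- so hardness is the existence of a reduction from that problem.
W[2]-Hard : ParameterizedProblem → Set₁
W[2]-Hard P = FPTReduction k-DominatingSet P

{-# OPTIONS --safe #-}

-- The reduction keeps k.  For d = 2 + D every vertex i of G yields a vertex
-- U i of a clique and a path P 0 i, …, P D i.  The vertices U i and P 0 j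
-- have a common neighbour E i j if i is in the closed neighbourhood N[j] of
-- j; otherwise E i j is attached to U i only (up to harmless edges).  Hence
-- the end P D j of a path is within distance d only of vertices that stand
-- for members of N[j], while a set of U i for a dominating set of G reaches
-- everything.
--
-- As a unit 2-track interval graph this is the line graph of a bipartite
-- graph: each vertex has one of several disjoint unit intervals on each
-- track.  In the complement of a 3-interval graph, adjacency is disjointness:
-- E i j covers a part of the line except for one point of U i and one of
-- P 0 j, and P m j covers marks of the other vertices on one side of the
-- line, which side depending on the parity of m, except for the mark of
-- P (m − 1) j.  Fourth pieces are added far away.
--
-- The running time is bounded by composing programs from maps and right
-- folds whose intermediate values have polynomially bounded size.

module Submission where

open import Defs
open import Data.Bool using (Bool; true; false; T; not; _∧_; _∨_; _xor_; if_then_else_)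
open import Data.Bool.ListAction using (any)
open import Data.Bool.Properties using (T?; T-≡; T-∧; T-∨)
open import Data.Empty using (⊥-elim)
open import Data.Fin as Fin using (Fin; zero; suc; toℕ; fromℕ; fromℕ<; _↑ʳ_; #_)
open import Data.Fin.Properties as Fin using (toℕ-fromℕ; toℕ-fromℕ<; fromℕ<-toℕ; toℕ-injective; toℕ<n)
open import Data.Fin.Subset as Subset using (Subset; inside; outside; ⁅_⁆; _∪_; ∣_∣)
open import Data.Fin.Subset.Properties using (∣⊥∣≡0; ∣⁅x⁆∣≡1; x∈⁅x⁆; p⊆p∪q; q⊆p∪q; ∣p∣≤n)
open import Data.Integer as ℤ using () renaming (+_ to int)
import Data.Integer.Properties as ℤ
open import Data.List as List
  using (List; []; _∷_; _++_; length; replicate; upTo; applyUpTo; tabulate; concat; allFin; cartesianProductWith)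
open import Data.List.Membership.Propositional using (_∈_)
open import Data.List.Membership.Propositional.Properties
  using (∈-lookup; ∈-map⁺; ∈-map⁻; ∈-++⁺ˡ; ∈-++⁺ʳ; ∈-++⁻; ∈-allFin; ∈-cartesianProductWith⁺; ∈-cartesianProductWith⁻)
open import Data.List.Properties
  using (reverse-involutive; ∷-injectiveʳ; length-++; length-map; length-replicate; length-tabulate; length-upTo;
         map-++; map-∘; map-cong; map-tabulate; map-upTo; tabulate-lookup; ++-is-foldr; map-is-foldr)
import Data.List.Relation.Unary.All as All
open import Data.List.Relation.Unary.AllPairs using (_∷_)
open import Data.List.Relation.Unary.Any using (index)
open import Data.List.Relation.Unary.Any.Properties using (lookup-index)
open import Data.List.Relation.Unary.Unique.Propositional using (Unique)
import Data.List.Relation.Unary.Unique.Propositional.Properties as Unique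
open import Data.Nat
  using (ℕ; zero; suc; pred; _+_; _*_; _∸_; _^_; _⊓_; _⊔_; _≤_; _<_; _≤ᵇ_; _≡ᵇ_; z≤n; s≤s; ⌊_/2⌋; ⌈_/2⌉)
open import Data.Nat.Binary as ℕᵇ using (ℕᵇ; 2[1+_]; 1+[2_])
import Data.Nat.Binary.Properties as ℕᵇ
open import Data.Nat.Properties hiding (even≢odd)
open import Data.Nat.Tactic.RingSolver using (solve-∀)
open import Data.Product using (∃-syntax; _×_; _,_; proj₁; proj₂; uncurry)
open import Data.Rational.Unnormalised as ℚ using (ℚᵘ; mkℚᵘ; *≡*; *≤*)
import Data.Rational.Unnormalised.Properties as ℚ
open import Data.Sum using (_⊎_; inj₁; inj₂)
open import Data.Unit using (⊤; tt)
open import Data.Vec using (Vec; []; _∷_; lookup; toList; here; there)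
open import Function using (_∘_; id; const; _⇔_; mk⇔; Equivalence)
open import Relation.Binary using (tri<; tri≈; tri>)
open import Relation.Binary.PropositionalEquality
open import Relation.Nullary using (¬_; Dec; does; yes; no; contradiction)
open import Relation.Nullary.Decidable using (dec-true; dec-false; decidable-stable)
open import Relation.Unary using (_≬_)

-- Polynomial bounds

-- The two representations do not give the same graph: on two tracks `E i j` and `E i j′` are
-- adjacent for different `j` and `j′`, whereas in the complement of multiple intervals no two `E`
-- are. The equivalence is therefore proved once, for all graphs between two bounds. The prescribed
-- edges give short walks from the `U i`; along every permitted pair a potential changes by at most
-- one, which keeps the end of a path far from all vertices that must not dominate it. Solutions
-- have exactly `k` vertices, while the passage between `G` and the gadget may identify vertices.
-- Sets are then filled up to size `k`, which requires that `k` is at most the number of vertices of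
-- `G`. As `k` is given in binary, the program has to test this without expanding `k` in unary. The
-- endpoints in the representations are exponentially large numbers, chosen for their binary
-- encodings: these are strings that a program can write down directly, so no binary arithmetic has
-- to be programmed.

data Poly : Set where
  con : ℕ → Poly
  X   : Poly
  _⊕_ _⊗_ _⊚_ : Poly → Poly → Poly

infixl 6 _⊕_
infixl 7 _⊗_
infixl 8 _⊚_

⟦_⟧ₚ : Poly → ℕ → ℕ
⟦ con c ⟧ₚ s = c
⟦ X ⟧ₚ s     = s
⟦ p ⊕ q ⟧ₚ s = ⟦ p ⟧ₚ s + ⟦ q ⟧ₚ s
⟦ p ⊗ q ⟧ₚ s = ⟦ p ⟧ₚ s * ⟦ q ⟧ₚ s
⟦ p ⊚ q ⟧ₚ s = ⟦ p ⟧ₚ (⟦ q ⟧ₚ s)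

-- Without subtraction all bounds are monotone, so a bound in the size of an intermediate value
-- turns into one in the size of the input.
⟦⟧ₚ-mono : ∀ p {s t} → s ≤ t → ⟦ p ⟧ₚ s ≤ ⟦ p ⟧ₚ t
⟦⟧ₚ-mono (con c) s≤t = ≤-refl
⟦⟧ₚ-mono X       s≤t = s≤t
⟦⟧ₚ-mono (p ⊕ q) s≤t = +-mono-≤ (⟦⟧ₚ-mono p s≤t) (⟦⟧ₚ-mono q s≤t)
⟦⟧ₚ-mono (p ⊗ q) s≤t = *-mono-≤ (⟦⟧ₚ-mono p s≤t) (⟦⟧ₚ-mono q s≤t)
⟦⟧ₚ-mono (p ⊚ q) s≤t = ⟦⟧ₚ-mono p (⟦⟧ₚ-mono q s≤t)

^-monoʳ-suc : ∀ s {d e} → d ≤ e → suc s ^ d ≤ suc s ^ e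
^-monoʳ-suc s = ^-monoʳ-≤ (suc s)

1≤suc^ : ∀ s e → 1 ≤ suc s ^ e
1≤suc^ s e = ^-monoʳ-suc s {0} {e} z≤n

*-^-distrib : ∀ m n e → (m * n) ^ e ≡ m ^ e * n ^ e
*-^-distrib m n zero    = refl
*-^-distrib m n (suc e) = trans (cong (m * n *_) (*-^-distrib m n e))
  ([m*n]*[o*p]≡[m*o]*[n*p] m n (m ^ e) (n ^ e))

-- The base `suc s` is at least 1, so two exponents can be raised to a common one. Under composition
-- `suc D` absorbs the successor in `suc (⟦ q ⟧ₚ s)`.
monomial-bound : ∀ p → ∃[ C ] ∃[ e ] (∀ s → ⟦ p ⟧ₚ s ≤ C * suc s ^ e)
monomial-bound (con c) = c , 0 , λ s → ≤-reflexive (sym (*-identityʳ c))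
monomial-bound X = 1 , 1 , λ s →
  ≤-trans (n≤1+n s) (≤-reflexive (sym (trans (*-identityˡ _) (*-identityʳ (suc s)))))
monomial-bound (p ⊕ q) =
  let C , d , p≤ = monomial-bound p
      D , e , q≤ = monomial-bound q
  in C + D , d + e , λ s → begin
    ⟦ p ⟧ₚ s + ⟦ q ⟧ₚ s                    ≤⟨ +-mono-≤ (p≤ s) (q≤ s) ⟩
    C * suc s ^ d + D * suc s ^ e
      ≤⟨ +-mono-≤ (*-monoʳ-≤ C (^-monoʳ-suc s (m≤m+n d e)))
                  (*-monoʳ-≤ D (^-monoʳ-suc s (m≤n+m e d))) ⟩
    C * suc s ^ (d + e) + D * suc s ^ (d + e)
      ≡⟨ *-distribʳ-+ (suc s ^ (d + e)) C D ⟨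
    (C + D) * suc s ^ (d + e)              ∎
  where open ≤-Reasoning
monomial-bound (p ⊗ q) =
  let C , d , p≤ = monomial-bound p
      D , e , q≤ = monomial-bound q
  in C * D , d + e , λ s → begin
    ⟦ p ⟧ₚ s * ⟦ q ⟧ₚ s                    ≤⟨ *-mono-≤ (p≤ s) (q≤ s) ⟩
    (C * suc s ^ d) * (D * suc s ^ e)      ≡⟨ [m*n]*[o*p]≡[m*o]*[n*p] C (suc s ^ d) D _ ⟩
    (C * D) * (suc s ^ d * suc s ^ e)      ≡⟨ cong (C * D *_) (^-distribˡ-+-* (suc s) d e) ⟨
    (C * D) * suc s ^ (d + e)              ∎
  where open ≤-Reasoning
monomial-bound (p ⊚ q) =
  let C , d , p≤ = monomial-bound p
      D , e , q≤ = monomial-bound q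
  in C * suc D ^ d , e * d , λ s → begin
    ⟦ p ⟧ₚ (⟦ q ⟧ₚ s)                      ≤⟨ p≤ _ ⟩
    C * suc (⟦ q ⟧ₚ s) ^ d
      ≤⟨ *-monoʳ-≤ C (^-monoˡ-≤ d (+-mono-≤ (1≤suc^ s e) (q≤ s))) ⟩
    C * (suc D * suc s ^ e) ^ d            ≡⟨ cong (C *_) (*-^-distrib (suc D) (suc s ^ e) d) ⟩
    C * (suc D ^ d * (suc s ^ e) ^ d)
      ≡⟨ cong (λ x → C * (suc D ^ d * x)) (^-*-assoc (suc s) e d) ⟩
    C * (suc D ^ d * suc s ^ (e * d))      ≡⟨ *-assoc C _ _ ⟨
    C * suc D ^ d * suc s ^ (e * d)        ∎
  where open ≤-Reasoning

-- Returns to the base `s` that `FPTReduction` asks for: `suc s` is at most `2 * s` for a positive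
-- size, at the cost of a factor `2 ^ e`.
polynomial-bound : ∀ p → ∃[ C ] ∃[ e ] (∀ s → 1 ≤ s → ⟦ p ⟧ₚ s ≤ C * s ^ e)
polynomial-bound p =
  let C , e , p≤ = monomial-bound p
  in C * 2 ^ e , e , λ s 1≤s → begin
    ⟦ p ⟧ₚ s           ≤⟨ p≤ s ⟩
    C * suc s ^ e      ≤⟨ *-monoʳ-≤ C (^-monoˡ-≤ e (+-monoˡ-≤ s 1≤s)) ⟩
    C * (s + s) ^ e    ≡⟨ cong (λ x → C * (s + x) ^ e) (+-identityʳ s) ⟨
    C * (2 * s) ^ e    ≡⟨ cong (C *_) (*-^-distrib 2 s e) ⟩
    C * (2 ^ e * s ^ e) ≡⟨ *-assoc C _ _ ⟨
    C * 2 ^ e * s ^ e  ∎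
  where open ≤-Reasoning

-- Running programs within a time bound

Runs : ∀ {n} → Vec Tree n → Program n → Tree → ℕ → Set
Runs ρ e v b = ∃[ c ] (ρ ⊢ e ⇓ v [ c ]) × c ≤ b

1≤size : ∀ t → 1 ≤ size t
1≤size nil     = ≤-refl
1≤size (s ∙ t) = s≤s z≤n

-- Copying is charged by size, so a time bound is at the same time a bound on the size of the
-- result, and compositions need no separate bounds on sizes.
size≤time : ∀ {n} {ρ : Vec Tree n} {e v c} → ρ ⊢ e ⇓ v [ c ] → size v ≤ c
size≤time (⇓var i)        = ≤-refl
size≤time ⇓nil            = ≤-refl
size≤time (⇓cons d e)     = s≤s (+-mono-≤ (size≤time d) (size≤time e))
size≤time (⇓case-nil d e) = m≤n⇒m≤1+n (m≤n⇒m≤o+n _ (size≤time e))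
size≤time (⇓case-∙ d e)   = m≤n⇒m≤1+n (m≤n⇒m≤o+n _ (size≤time e))
size≤time (⇓bind d e)     = m≤n⇒m≤1+n (m≤n⇒m≤o+n _ (size≤time e))
size≤time (⇓while-stop d) = m≤n⇒m≤1+n (m≤n+m _ _)
size≤time (⇓while-step d e f) = m≤n⇒m≤1+n (m≤n⇒m≤o+n _ (size≤time f))

module _ {n} {ρ : Vec Tree n} where

  size≤bound : ∀ {e v b} → Runs ρ e v b → size v ≤ b
  size≤bound (c , d , c≤b) = ≤-trans (size≤time d) c≤b

  relax : ∀ {e v b b′} → b ≤ b′ → Runs ρ e v b → Runs ρ e v b′
  relax b≤b′ (c , d , c≤b) = c , d , ≤-trans c≤b b≤b′

  returns : ∀ {e v w b} → v ≡ w → Runs ρ e v b → Runs ρ e w b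
  returns refl r = r

  run-var : ∀ {i t} → lookup ρ i ≡ t → Runs ρ (var i) t (size t)
  run-var refl = _ , ⇓var _ , ≤-refl

  run-nil : Runs ρ nil nil 1
  run-nil = _ , ⇓nil , ≤-refl

  run-cons : ∀ {e f u v a b} → Runs ρ e u a → Runs ρ f v b →
             Runs ρ (cons e f) (u ∙ v) (1 + a + b)
  run-cons (_ , d , p) (_ , e , q) = _ , ⇓cons d e , s≤s (+-mono-≤ p q)

  run-case-nil : ∀ {e f g v a b} → Runs ρ e nil a → Runs ρ f v b →
                 Runs ρ (case e f g) v (1 + a + b)
  run-case-nil (_ , d , p) (_ , e , q) = _ , ⇓case-nil d e , s≤s (+-mono-≤ p q)

  run-case-∙ : ∀ {e f g s t v a b} → Runs ρ e (s ∙ t) a → Runs (s ∷ t ∷ ρ) g v b →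
               Runs ρ (case e f g) v (1 + a + b)
  run-case-∙ (_ , d , p) (_ , e , q) = _ , ⇓case-∙ d e , s≤s (+-mono-≤ p q)

  run-bind : ∀ {e f u v a b} → Runs ρ e u a → Runs (u ∷ ρ) f v b →
             Runs ρ (bind e f) v (1 + a + b)
  run-bind (_ , d , p) (_ , e , q) = _ , ⇓bind d e , s≤s (+-mono-≤ p q)

  run-while-stop : ∀ {e f u a} → Runs (u ∷ ρ) e nil a →
                   Runs (u ∷ ρ) (while e f) u (1 + a + size u)
  run-while-stop (_ , d , p) = _ , ⇓while-stop d , s≤s (+-monoˡ-≤ _ p)

  run-while-step : ∀ {e f s t u v w a b c} → Runs (u ∷ ρ) e (s ∙ t) a →
                   Runs (u ∷ ρ) f v b → Runs (v ∷ ρ) (while e f) w c →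
                   Runs (u ∷ ρ) (while e f) w (1 + a + b + c)
  run-while-step (_ , d , p) (_ , e , q) (_ , f , r) =
    _ , ⇓while-step d e f , s≤s (+-mono-≤ (+-mono-≤ p q) r)

quoteTree : ∀ {n} → Tree → Program n
quoteTree nil     = nil
quoteTree (s ∙ t) = cons (quoteTree s) (quoteTree t)

run-quote : ∀ {n} {ρ : Vec Tree n} t → Runs ρ (quoteTree t) t (size t)
run-quote nil     = run-nil
run-quote (s ∙ t) = run-cons (run-quote s) (run-quote t)

-- Polynomial-time functions between encoded types

infixr 4 _⊠_

data Ty : Set where
  tree unit bool nat bin : Ty
  list : Ty → Ty
  _⊠_  : Ty → Ty → Ty

El : Ty → Set
El tree     = Tree
El unit     = ⊤
El bool     = Bool
El nat      = ℕ
El bin      = ℕᵇ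
El (list A) = List (El A)
El (A ⊠ B)  = El A × El B

unary : ℕ → Tree
unary zero    = nil
unary (suc n) = nil ∙ unary n

enc : (A : Ty) → El A → Tree
enc tree     t       = t
enc unit     _       = nil
enc bool     b       = encodeBool b
enc nat      n       = unary n
enc bin      x       = encodeℕᵇ x
enc (list A) xs      = List.foldr (λ x t → enc A x ∙ t) nil xs
enc (A ⊠ B)  (a , b) = enc A a ∙ enc B b

-- The argument may be any variable i of any environment, so that programs
-- can be composed without renaming their variables.

record PolyTime (A B : Ty) (f : El A → El B) : Set where
  field
    code  : ∀ {m} → Fin m → Program m
    bound : Poly
    run   : ∀ {m} {ρ : Vec Tree m} {i} a → lookup ρ i ≡ enc A a →
            Runs ρ (code i) (enc B (f a)) (⟦ bound ⟧ₚ (size (enc A a)))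

open PolyTime

size-output : ∀ {A B f} (F : PolyTime A B f) a →
              size (enc B (f a)) ≤ ⟦ bound F ⟧ₚ (size (enc A a))
size-output {A} F a = size≤bound (run F {ρ = enc A a ∷ []} {zero} a refl)

module _ {A B : Ty} where

  respP : ∀ {f g} → PolyTime A B f → (∀ a → f a ≡ g a) → PolyTime A B g
  respP F f≗g = record
    { code  = code F
    ; bound = bound F
    ; run   = λ a eq → returns (cong (enc B) (f≗g a)) (run F a eq)
    }

  -- Many conversions cost only a copy because the encodings coincide: a unary number is a list of
  -- units, a Boolean a list of at most one unit, a binary number the list of its digits.
  cast : ∀ f → (∀ a → enc A a ≡ enc B (f a)) → PolyTime A B f
  cast f same = record
    { code  = var
    ; bound = X
    ; run   = λ a eq → returns (same a) (run-var eq)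
    }

  constP : ∀ b → PolyTime A B (const b)
  constP b = record
    { code  = λ _ → quoteTree (enc B b)
    ; bound = con (size (enc B b))
    ; run   = λ _ _ → run-quote (enc B b)
    }

idP : ∀ {A} → PolyTime A A id
idP = cast id (λ _ → refl)

infixr 9 _∘P_

_∘P_ : ∀ {A B C g f} → PolyTime B C g → PolyTime A B f → PolyTime A C (λ a → g (f a))
G ∘P F = record
  { code  = λ i → bind (code F i) (code G zero)
  ; bound = con 1 ⊕ bound F ⊕ bound G ⊚ bound F
  ; run   = λ a eq → run-bind (run F a eq)
      (relax (⟦⟧ₚ-mono (bound G) (size-output F a)) (run G _ refl))
  }

pair : ∀ {A B C f g} → PolyTime A B f → PolyTime A C g →
       PolyTime A (B ⊠ C) (λ a → f a , g a)
pair F G = record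
  { code  = λ i → cons (code F i) (code G i)
  ; bound = con 1 ⊕ bound F ⊕ bound G
  ; run   = λ a eq → run-cons (run F a eq) (run G a eq)
  }

fstP : ∀ {A B} → PolyTime (A ⊠ B) A proj₁
fstP = record
  { code  = λ i → case (var i) nil (var zero)
  ; bound = con 1 ⊕ X ⊕ X
  ; run   = λ (a , b) eq → run-case-∙ (run-var eq)
      (relax (m≤n⇒m≤1+n (m≤m+n _ _)) (run-var refl))
  }

sndP : ∀ {A B} → PolyTime (A ⊠ B) B proj₂
sndP = record
  { code  = λ i → case (var i) nil (var (suc zero))
  ; bound = con 1 ⊕ X ⊕ X
  ; run   = λ (a , b) eq → run-case-∙ (run-var eq)
      (relax (m≤n⇒m≤1+n (m≤n+m _ _)) (run-var refl))
  }

-- Case analysis and folds over lists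

caseList : {A B : Set} → B → (A → List A → B) → List A → B
caseList z s []       = z
caseList z s (x ∷ xs) = s x xs

caseP : ∀ {A B C l z s} → PolyTime A (list B) l → PolyTime A C z →
        PolyTime (B ⊠ list B ⊠ A) C s →
        PolyTime A C (λ a → caseList (z a) (λ b bs → s (b , bs , a)) (l a))
caseP {A} {B} {C} {l} {z} {s} L Z S = record
  { code  = prog
  ; bound = con 1 ⊕ bound L ⊕ (bound Z ⊕ (con 1 ⊕ arg ⊕ bound S ⊚ arg))
  ; run   = λ a eq → correct a eq (l a) (run L a eq)
  }
  where
    prog : ∀ {m} → Fin m → Program m
    prog i = case (code L i) (code Z i)
      (bind (cons (var zero) (cons (var (# 1)) (var (suc (suc i))))) (code S zero))

    arg : Poly
    arg = con 1 ⊕ bound L ⊕ (con 1 ⊕ bound L ⊕ X)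

    correct : ∀ {m} {ρ : Vec Tree m} {i} a → lookup ρ i ≡ enc A a → ∀ xs →
      Runs ρ (code L i) (enc (list B) xs) (⟦ bound L ⟧ₚ (size (enc A a))) →
      Runs ρ (prog i) (enc C (caseList (z a) (λ b bs → s (b , bs , a)) xs))
        (1 + ⟦ bound L ⟧ₚ (size (enc A a)) +
          ⟦ bound Z ⊕ (con 1 ⊕ arg ⊕ bound S ⊚ arg) ⟧ₚ (size (enc A a)))
    correct a eq []       r =
      relax (+-monoʳ-≤ (1 + ⟦ bound L ⟧ₚ (size (enc A a))) (m≤m+n _ _))
        (run-case-nil r (run Z a eq))
    correct a eq (x ∷ xs) r =
      relax (+-monoʳ-≤ (1 + ⟦ bound L ⟧ₚ (size (enc A a))) (m≤n+m _ _))
        (run-case-∙ r (run-bind args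
          (relax (⟦⟧ₚ-mono (bound S) (size≤bound args)) (run S (x , xs , a) refl))))
      where
        x+xs≤ : size (enc B x) + size (enc (list B) xs) ≤ ⟦ bound L ⟧ₚ (size (enc A a))
        x+xs≤ = ≤-trans (n≤1+n _) (size≤bound r)

        args : Runs _ _ (enc (B ⊠ list B ⊠ A) (x , xs , a)) (⟦ arg ⟧ₚ (size (enc A a)))
        args = run-cons (relax (m+n≤o⇒m≤o _ x+xs≤) (run-var refl))
                 (run-cons (relax (m+n≤o⇒n≤o (size (enc B x)) x+xs≤) (run-var refl)) (run-var eq))

-- Traversal of the list in the first component of variable 0.  The body
-- sees the head, the tail, the list, the accumulator and the pair of the
-- last two as variables 0 to 4.

traverse : ∀ {m} → Program (5 + m) → Program (1 + m)
traverse body = while (case (var zero) nil (var zero))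
  (case (var zero) nil (case (var zero) nil (cons (var (# 1)) body)))

module _ {B : Ty} {m} {ρ : Vec Tree m} (body : Program (5 + m))
         (state : List (El B) → Tree) (S M c : ℕ)
         (state≤ : ∀ xs → size (enc (list B) xs) ≤ S → size (state xs) ≤ M)
         (run-body : ∀ x xs {r r′ st} → size (enc (list B) (x ∷ xs)) ≤ S →
            Runs (enc B x ∷ r′ ∷ r ∷ state xs ∷ st ∷ ρ) body (state (x ∷ xs)) c)
         where

  iteration : ℕ
  iteration = 1 + (1 + (1 + S + M) + S) +
    (1 + (1 + S + M) + (1 + S + (1 + S + c)))

  -- `xs` holds the entries already passed, in reverse order. Moving an entry from `ys` to `xs`
  -- preserves the sum of the two sizes, so `S` and `M` bound all states of the loop; the size of
  -- `ys` bounds the number of iterations.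
  run-traverse : ∀ ys xs → size (enc (list B) ys) + size (enc (list B) xs) ≤ 1 + S →
    Runs ((enc (list B) ys ∙ state xs) ∷ ρ) (traverse body) (nil ∙ state (ys List.ʳ++ xs))
      ((iteration + iteration) * size (enc (list B) ys))
  run-traverse [] xs le =
    relax (≤-trans stop≤ (≤-reflexive (sym (*-identityʳ (iteration + iteration)))))
      (run-while-stop (run-case-∙ (relax st≤ (run-var refl)) (relax 1≤S (run-var refl))))
    where
      1≤S : 1 ≤ S
      1≤S = ≤-trans (1≤size (enc (list B) xs)) (≤-pred le)
      st≤ : 2 + size (state xs) ≤ 1 + S + M
      st≤ = s≤s (+-mono-≤ 1≤S (state≤ xs (≤-pred le)))
      stop≤ : 1 + (1 + (1 + S + M) + S) + (2 + size (state xs)) ≤ iteration + iteration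
      stop≤ = ≤-trans
        (+-monoʳ-≤ (1 + (1 + (1 + S + M) + S)) (≤-trans st≤ (m≤n⇒m≤1+n (m≤m+n (1 + S + M) _))))
        (m≤m+n iteration iteration)
  run-traverse (y ∷ ys) xs le = relax total
    (run-while-step
      (run-case-∙ (relax pair≤ (run-var refl)) (relax y∷ys≤ (run-var refl)))
      (run-case-∙ (relax pair≤ (run-var refl))
        (run-case-∙ (relax y∷ys≤ (run-var refl))
          (run-cons (relax ys≤ (run-var refl)) (run-body y xs y∷xs≤))))
      (run-traverse ys (y ∷ xs) le′))
    where
      open ≤-Reasoning
      ∣y∣ ∣ys∣ ∣xs∣ : ℕ
      ∣y∣  = size (enc B y)
      ∣ys∣ = size (enc (list B) ys)
      ∣xs∣ = size (enc (list B) xs)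
      le′ : ∣ys∣ + (1 + ∣y∣ + ∣xs∣) ≤ 1 + S
      le′ = begin
        ∣ys∣ + (1 + ∣y∣ + ∣xs∣) ≡⟨ rearrange ∣ys∣ ∣y∣ ∣xs∣ ⟩
        (1 + ∣y∣ + ∣ys∣) + ∣xs∣ ≤⟨ le ⟩
        1 + S ∎
        where
          rearrange : ∀ a b c → a + (1 + b + c) ≡ (1 + b + a) + c
          rearrange = solve-∀
      y∷xs≤ : 1 + ∣y∣ + ∣xs∣ ≤ S
      y∷xs≤ = ≤-pred (≤-trans (+-monoˡ-≤ (1 + ∣y∣ + ∣xs∣) (1≤size (enc (list B) ys))) le′)
      y∷ys≤ : 1 + ∣y∣ + ∣ys∣ ≤ S
      y∷ys≤ = ≤-pred (≤-trans (≤-trans (≤-reflexive (+-comm 1 _))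
        (+-monoʳ-≤ (1 + ∣y∣ + ∣ys∣) (1≤size (enc (list B) xs)))) le)
      ys≤ : ∣ys∣ ≤ S
      ys≤ = ≤-trans (m≤n+m ∣ys∣ (1 + ∣y∣)) y∷ys≤
      pair≤ : 1 + (1 + ∣y∣ + ∣ys∣) + size (state xs) ≤ 1 + S + M
      pair≤ = +-mono-≤ (s≤s y∷ys≤) (state≤ xs (≤-trans (m≤n+m ∣xs∣ (1 + ∣y∣)) y∷xs≤))
      total : iteration + (iteration + iteration) * ∣ys∣ ≤
              (iteration + iteration) * (1 + ∣y∣ + ∣ys∣)
      total = begin
        iteration + (iteration + iteration) * ∣ys∣
          ≤⟨ +-monoˡ-≤ _ (m≤m+n iteration iteration) ⟩
        (iteration + iteration) + (iteration + iteration) * ∣ys∣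
          ≡⟨ *-suc (iteration + iteration) ∣ys∣ ⟨
        (iteration + iteration) * (1 + ∣ys∣)
          ≤⟨ *-monoʳ-≤ (iteration + iteration) (s≤s (m≤n+m ∣ys∣ ∣y∣)) ⟩
        (iteration + iteration) * (1 + ∣y∣ + ∣ys∣) ∎

size-ʳ++ : ∀ {B} (ys xs : List (El B)) →
  size (enc (list B) (ys List.ʳ++ xs)) + 1 ≡ size (enc (list B) ys) + size (enc (list B) xs)
size-ʳ++ []       xs = +-comm _ 1
size-ʳ++ {B} (y ∷ ys) xs = trans (size-ʳ++ {B} ys (y ∷ xs))
  (rearrange (size (enc (list B) ys)) (size (enc B y)) (size (enc (list B) xs)))
  where
    rearrange : ∀ a b c → a + (1 + b + c) ≡ (1 + b + a) + c
    rearrange = solve-∀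

size-reverse : ∀ {B} (xs : List (El B)) →
  size (enc (list B) (List.reverse xs)) ≡ size (enc (list B) xs)
size-reverse {B} xs = +-cancelʳ-≡ 1 _ _ (size-ʳ++ {B} xs [])

-- The list is reversed first, so that the loop performs a right fold.

foldrP : ∀ {A B C l z s} → PolyTime A (list B) l → PolyTime A C z →
  PolyTime (B ⊠ C ⊠ A) C s → (q : Poly) →
  (∀ a xs → size (enc C (List.foldr (λ b c → s (b , c , a)) (z a) xs)) ≤
            ⟦ q ⟧ₚ (size (enc A a) + size (enc (list B) xs))) →
  PolyTime A C (λ a → List.foldr (λ b c → s (b , c , a)) (z a) (l a))
foldrP {A} {B} {C} {l} {z} {s} L Z S q q-bounds = record
  { code  = prog
  ; bound = con 1 ⊕ (con 1 ⊕ (con 1 ⊕ bound L ⊕ con 1) ⊕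
                (iter S₁ S₁ (con 1 ⊕ S₁ ⊕ S₁) ⊗ S₁)) ⊕
            (con 1 ⊕ (con 1 ⊕ (con 1 ⊕ (con 1 ⊕ (con 2 ⊕ S₁) ⊕ S₁) ⊕ bound Z) ⊕
                (iter S₁ M body-bound ⊗ S₁)) ⊕
            (con 1 ⊕ (con 2 ⊕ M) ⊕ M))
  ; run   = λ a eq → correct a eq
  }
  where
    module _ {m : ℕ} (i : Fin m) where
      prog₁ : Program m
      -- Accumulating by `cons` reverses the list: variable 0 is the head, variable 3 the
      -- accumulator.
      prog₁ = bind (cons (code L i) nil) (traverse (cons (var zero) (var (# 3))))
      step : Program (6 + m)
      step = bind (cons (var zero) (cons (var (# 3)) (var (6 Fin.↑ʳ i)))) (code S zero)
      prog₂ : Program (1 + m)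
      prog₂ = bind (cons (case (var zero) nil (var (# 1))) (code Z (suc i))) (traverse step)
      prog : Program m
      prog = bind prog₁ (bind prog₂ (case (var zero) nil (var (# 1))))

    S₁ M body-bound arg : Poly
    S₁ = bound L
    M  = q ⊚ (X ⊕ S₁)
    arg = con 1 ⊕ S₁ ⊕ (con 1 ⊕ M ⊕ X)
    body-bound = con 1 ⊕ arg ⊕ bound S ⊚ arg

    iter : Poly → Poly → Poly → Poly
    iter S M c = iter₁ ⊕ iter₁
      where
        iter₁ : Poly
        iter₁ = con 1 ⊕ (con 1 ⊕ (con 1 ⊕ S ⊕ M) ⊕ S) ⊕
          (con 1 ⊕ (con 1 ⊕ S ⊕ M) ⊕ (con 1 ⊕ S ⊕ (con 1 ⊕ S ⊕ c)))

    module _ {m} {ρ : Vec Tree m} {i} (a : El A) (eq : lookup ρ i ≡ enc A a) where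
      F : List (El B) → El C
      F = List.foldr (λ b c → s (b , c , a)) (z a)

      x : ℕ
      x = size (enc A a)

      L≤ : size (enc (list B) (l a)) ≤ ⟦ S₁ ⟧ₚ x
      L≤ = size-output L a

      reversed : List (El B)
      reversed = List.reverse (l a)

      R≤ : size (enc (list B) reversed) ≤ ⟦ S₁ ⟧ₚ x
      R≤ = ≤-trans (≤-reflexive (size-reverse {B} (l a))) L≤

      tail≤ : ∀ b (bs : List (El B)) → size (enc (list B) (b ∷ bs)) ≤ ⟦ S₁ ⟧ₚ x →
              size (enc (list B) bs) ≤ ⟦ S₁ ⟧ₚ x
      tail≤ b bs le = ≤-trans (m≤n+m _ (1 + size (enc B b))) le

      head≤ : ∀ b (bs : List (El B)) → size (enc (list B) (b ∷ bs)) ≤ ⟦ S₁ ⟧ₚ x →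
              size (enc B b) ≤ ⟦ S₁ ⟧ₚ x
      head≤ b bs le = ≤-trans (m≤n⇒m≤1+n (m≤m+n _ _)) le

      run₁ : Runs ρ (prog₁ i) (nil ∙ enc (list B) reversed) _
      run₁ = run-bind (run-cons (run L a eq) run-nil)
        (relax (*-monoʳ-≤ (⟦ iter S₁ S₁ (con 1 ⊕ S₁ ⊕ S₁) ⟧ₚ x) L≤)
          (run-traverse {B} (cons (var zero) (var (# 3))) (enc (list B)) (⟦ S₁ ⟧ₚ x) (⟦ S₁ ⟧ₚ x)
            (1 + ⟦ S₁ ⟧ₚ x + ⟦ S₁ ⟧ₚ x) (λ _ → id)
            (λ b bs le → run-cons (relax (head≤ b bs le) (run-var refl))
                                  (relax (tail≤ b bs le) (run-var refl)))
            (l a) [] (≤-trans (+-monoˡ-≤ 1 L≤) (≤-reflexive (+-comm _ 1)))))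

      F≤ : ∀ bs → size (enc (list B) bs) ≤ ⟦ S₁ ⟧ₚ x → size (enc C (F bs)) ≤ ⟦ M ⟧ₚ x
      F≤ bs le = ≤-trans (q-bounds a bs) (⟦⟧ₚ-mono q (+-monoʳ-≤ x le))

      run-step : ∀ {ρ′ : Vec Tree (6 + m)} → lookup ρ′ (6 Fin.↑ʳ i) ≡ enc A a → ∀ b bs →
        lookup ρ′ zero ≡ enc B b → lookup ρ′ (# 3) ≡ enc C (F bs) →
        size (enc (list B) (b ∷ bs)) ≤ ⟦ S₁ ⟧ₚ x →
        Runs ρ′ (step i) (enc C (F (b ∷ bs))) (⟦ body-bound ⟧ₚ x)
      run-step eq b bs b≡ bs≡ le = run-bind args
        (relax (⟦⟧ₚ-mono (bound S) (size≤bound args)) (run S (b , F bs , a) refl))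
        where
          args : Runs _ _ (enc (B ⊠ C ⊠ A) (b , F bs , a)) (⟦ arg ⟧ₚ x)
          args = run-cons (relax (head≤ b bs le) (run-var b≡))
            (run-cons (relax (F≤ bs (tail≤ b bs le)) (run-var bs≡)) (run-var eq))

      run-loop : Runs ((enc (list B) reversed ∙ enc C (F [])) ∷ (nil ∙ enc (list B) reversed) ∷ ρ)
        (traverse (step i)) (nil ∙ enc C (F (l a)))
        (⟦ iter S₁ M body-bound ⟧ₚ x * size (enc (list B) reversed))
      run-loop = returns (cong (λ bs → nil ∙ enc C (F bs)) (reverse-involutive (l a)))
        (run-traverse {B} {ρ = (nil ∙ enc (list B) reversed) ∷ ρ} (step i)
          (λ bs → enc C (F bs)) (⟦ S₁ ⟧ₚ x) (⟦ M ⟧ₚ x) (⟦ body-bound ⟧ₚ x) F≤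
          (λ b bs le → run-step eq b bs refl refl le)
          reversed [] (≤-trans (+-monoˡ-≤ 1 R≤) (≤-reflexive (+-comm _ 1))))

      run₂ : Runs ((nil ∙ enc (list B) reversed) ∷ ρ) (prog₂ i) (nil ∙ enc C (F (l a))) _
      run₂ = run-bind
        (run-cons
          (run-case-∙ (relax (s≤s (s≤s R≤)) (run-var refl)) (relax R≤ (run-var refl)))
          (run Z a eq))
        (relax (*-monoʳ-≤ (⟦ iter S₁ M body-bound ⟧ₚ x) R≤) run-loop)

      correct : Runs ρ (prog i) (enc C (F (l a))) _
      correct = run-bind run₁ (run-bind run₂
        (run-case-∙ (relax (s≤s (s≤s (F≤ (l a) L≤))) (run-var refl))
                    (relax (F≤ (l a) L≤) (run-var refl))))

module _ {A B C : Ty} where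

  snd₂P : PolyTime (A ⊠ B ⊠ C) B (λ (_ , b , _) → b)
  snd₂P = fstP ∘P sndP

  rest₂P : PolyTime (A ⊠ B ⊠ C) C (λ (_ , _ , c) → c)
  rest₂P = sndP ∘P sndP

-- A fold of polynomial-time steps need not be polynomial, since the accumulator might double each
-- time. If a step adds only an amount that does not depend on the accumulator, the total growth is
-- at most the number of steps times this amount.
foldr⁺P : ∀ {A B C l z s} → PolyTime A (list B) l → PolyTime A C z →
  PolyTime (B ⊠ C ⊠ A) C s → (r : Poly) →
  (∀ b c a → size (enc C (s (b , c , a))) ≤
             size (enc C c) + ⟦ r ⟧ₚ (size (enc A a) + size (enc B b))) →
  PolyTime A C (λ a → List.foldr (λ b c → s (b , c , a)) (z a) (l a))
foldr⁺P {A} {B} {C} {l} {z} {s} L Z S r growth =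
  foldrP L Z S (bound Z ⊕ X ⊗ r) λ a xs → ≤-trans (go a xs _ ≤-refl)
    (+-mono-≤ (⟦⟧ₚ-mono (bound Z) (m≤m+n (size (enc A a)) _)) (*-monoˡ-≤ _ (m≤n+m _ (size (enc A a)))))
  where
    open ≤-Reasoning
    go : ∀ a xs t → size (enc (list B) xs) ≤ t →
      size (enc C (List.foldr (λ b c → s (b , c , a)) (z a) xs)) ≤
      ⟦ bound Z ⟧ₚ (size (enc A a)) + size (enc (list B) xs) * ⟦ r ⟧ₚ (size (enc A a) + t)
    go a []       t le = ≤-trans (size-output Z a) (m≤m+n _ _)
    go a (x ∷ xs) t le = begin
      size (enc C (s (x , F , a)))                  ≤⟨ growth x F a ⟩
      size (enc C F) + ⟦ r ⟧ₚ (∣a∣ + ∣x∣)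
        ≤⟨ +-mono-≤ (go a xs t (≤-trans (m≤n+m ∣xs∣ (1 + ∣x∣)) le))
             (⟦⟧ₚ-mono r (+-monoʳ-≤ ∣a∣ (≤-trans (m≤n⇒m≤1+n (m≤m+n ∣x∣ ∣xs∣)) le))) ⟩
      (⟦ bound Z ⟧ₚ ∣a∣ + ∣xs∣ * R) + R             ≡⟨ +-assoc (⟦ bound Z ⟧ₚ ∣a∣) _ R ⟩
      ⟦ bound Z ⟧ₚ ∣a∣ + (∣xs∣ * R + R)             ≡⟨ cong (⟦ bound Z ⟧ₚ ∣a∣ +_) (+-comm _ R) ⟩
      ⟦ bound Z ⟧ₚ ∣a∣ + suc ∣xs∣ * R
        ≤⟨ +-monoʳ-≤ (⟦ bound Z ⟧ₚ ∣a∣) (*-monoˡ-≤ R (s≤s (m≤n+m ∣xs∣ ∣x∣))) ⟩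
      ⟦ bound Z ⟧ₚ ∣a∣ + (1 + ∣x∣ + ∣xs∣) * R       ∎
      where
        F : El C
        F = List.foldr (λ b c → s (b , c , a)) (z a) xs
        ∣a∣ ∣x∣ ∣xs∣ R : ℕ
        ∣a∣  = size (enc A a)
        ∣x∣  = size (enc B x)
        ∣xs∣ = size (enc (list B) xs)
        R    = ⟦ r ⟧ₚ (∣a∣ + t)

-- List functions and Booleans

consP : ∀ {A B f g} → PolyTime A B f → PolyTime A (list B) g →
        PolyTime A (list B) (λ a → f a ∷ g a)
consP F G = cast (uncurry _∷_) (λ _ → refl) ∘P pair F G

mapP : ∀ {A B C f l} → PolyTime (B ⊠ A) C f → PolyTime A (list B) l →
       PolyTime A (list C) (λ a → List.map (λ b → f (b , a)) (l a))
mapP {A} {B} {C} {f} {l} F L = respP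
  (foldr⁺P L (constP []) (consP (F ∘P pair fstP rest₂P) snd₂P)
    (con 1 ⊕ bound F ⊚ (con 1 ⊕ X))
    λ b c a → ≤-trans (≤-reflexive (+-comm (1 + size (enc C (f (b , a)))) _))
      (+-monoʳ-≤ (size (enc (list C) c)) (s≤s (≤-trans (size-output F (b , a))
        (⟦⟧ₚ-mono (bound F) (s≤s (≤-reflexive (+-comm (size (enc B b)) _))))))))
  λ a → sym (map-is-foldr (l a))

appendP : ∀ {A B f g} → PolyTime A (list B) f → PolyTime A (list B) g →
          PolyTime A (list B) (λ a → f a ++ g a)
appendP {A} {B} {f} {g} F G = respP
  (foldr⁺P F G (consP fstP snd₂P) (con 1 ⊕ X)
    λ b c a → ≤-trans (≤-reflexive (+-comm (1 + size (enc B b)) _))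
      (+-monoʳ-≤ (size (enc (list B) c)) (s≤s (m≤n+m _ (size (enc A a))))))
  λ a → sym (++-is-foldr (f a) (g a))

size-++ : ∀ {B} xs ys →
  size (enc (list B) (xs ++ ys)) ≤ size (enc (list B) xs) + size (enc (list B) ys)
size-++ []           ys = n≤1+n _
size-++ {B} (x ∷ xs) ys = s≤s (≤-trans (+-monoʳ-≤ (size (enc B x)) (size-++ {B} xs ys))
  (≤-reflexive (sym (+-assoc (size (enc B x)) _ _))))

concatP : ∀ {A B f} → PolyTime A (list (list B)) f → PolyTime A (list B) (λ a → List.concat (f a))
concatP {A} {B} F = foldr⁺P F (constP []) (appendP fstP snd₂P) X
  λ b c a → ≤-trans (size-++ {B} b c) (≤-trans (≤-reflexive (+-comm (size (enc (list B) b)) _))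
    (+-monoʳ-≤ (size (enc (list B) c)) (m≤n+m _ (size (enc A a)))))

tailOf : ∀ {A : Set} → List A → List A
tailOf = caseList [] (λ _ xs → xs)

tailP : ∀ {A B f} → PolyTime A (list B) f → PolyTime A (list B) (λ a → tailOf (f a))
tailP F = caseP F (constP []) snd₂P

ifP : ∀ {A B c f g} → PolyTime A bool c → PolyTime A B f → PolyTime A B g →
      PolyTime A B (λ a → if c a then f a else g a)
ifP {A} {B} {c} {f} {g} C F G = respP
  (caseP (cast flag flag-enc ∘P C) G (F ∘P rest₂P)) λ a → flag-case (c a)
  where
    flag : Bool → List ⊤
    flag false = []
    flag true  = tt ∷ []
    flag-enc : ∀ b → enc bool b ≡ enc (list unit) (flag b)
    flag-enc false = refl
    flag-enc true  = refl
    flag-case : ∀ b {x y : El B} → caseList y (λ _ _ → x) (flag b) ≡ (if b then x else y)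
    flag-case false = refl
    flag-case true  = refl

module _ {A : Ty} where

  notP : ∀ {f} → PolyTime A bool f → PolyTime A bool (λ a → not (f a))
  notP {f} F = respP (ifP F (constP false) (constP true)) λ a → lemma (f a)
    where
      lemma : ∀ b → (if b then false else true) ≡ not b
      lemma false = refl
      lemma true  = refl

  andP : ∀ {f g} → PolyTime A bool f → PolyTime A bool g → PolyTime A bool (λ a → f a ∧ g a)
  andP {f} F G = respP (ifP F G (constP false)) λ a → lemma (f a)
    where
      lemma : ∀ b {c} → (if b then c else false) ≡ b ∧ c
      lemma false = refl
      lemma true  = refl

  orP : ∀ {f g} → PolyTime A bool f → PolyTime A bool g → PolyTime A bool (λ a → f a ∨ g a)
  orP {f} F G = respP (ifP F (constP true) G) λ a → lemma (f a)
    where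
      lemma : ∀ b {c} → (if b then true else c) ≡ b ∨ c
      lemma false = refl
      lemma true  = refl

  xorP : ∀ {f g} → PolyTime A bool f → PolyTime A bool g → PolyTime A bool (λ a → f a xor g a)
  xorP {f} F G = respP (ifP F (notP G) G) λ a → lemma (f a)
    where
      lemma : ∀ b {c} → (if b then not c else c) ≡ b xor c
      lemma false = refl
      lemma true  = refl

anyP : ∀ {A B f l} → PolyTime (B ⊠ A) bool f → PolyTime A (list B) l →
       PolyTime A bool (λ a → any (λ b → f (b , a)) (l a))
anyP {A} {B} {f} {l} F L = respP
  (foldr⁺P L (constP false) (orP (F ∘P pair fstP rest₂P) snd₂P) (con 2)
    λ b c a → size-bool (f (b , a) ∨ c) c)
  λ a → foldr-any a (l a)
  where
    size-bool : ∀ b c → size (encodeBool b) ≤ size (encodeBool c) + 2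
    size-bool false c     = ≤-trans (1≤size (encodeBool c)) (m≤m+n _ 2)
    size-bool true  false = ≤-refl
    size-bool true  true  = m≤m+n 3 2
    foldr-any : ∀ a xs → List.foldr (λ b c → f (b , a) ∨ c) false xs ≡
                         any (λ b → f (b , a)) xs
    foldr-any a []       = refl
    foldr-any a (x ∷ xs) = cong (f (x , a) ∨_) (foldr-any a xs)

-- Arithmetic on unary numbers

size-unary : ∀ n → size (unary n) ≡ 1 + (n + n)
size-unary zero    = refl
size-unary (suc n) = cong (2 +_) (trans (size-unary n) (sym (+-suc n n)))

size-unary-mono : ∀ {m n} → m ≤ n → size (unary m) ≤ size (unary n)
size-unary-mono {m} {n} m≤n rewrite size-unary m | size-unary n = s≤s (+-mono-≤ m≤n m≤n)

unary-replicate : ∀ n → enc nat n ≡ enc (list unit) (replicate n tt)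
unary-replicate zero    = refl
unary-replicate (suc n) = cong (nil ∙_) (unary-replicate n)

unary-length : ∀ xs → enc (list unit) xs ≡ enc nat (length xs)
unary-length []       = refl
unary-length (x ∷ xs) = cong (nil ∙_) (unary-length xs)

isZero : ℕ → Bool
isZero zero    = true
isZero (suc _) = false

isZero-∸ : ∀ m n → isZero (m ∸ n) ≡ (m ≤ᵇ n)
isZero-∸ zero          zero    = refl
isZero-∸ zero          (suc n) = refl
isZero-∸ (suc m)       zero    = refl
isZero-∸ (suc zero)    (suc n) = isZero-∸ zero n
isZero-∸ (suc (suc m)) (suc n) = isZero-∸ (suc m) n

isZero-∸-∸ : ∀ m n → isZero (m ∸ n) ∧ isZero (n ∸ m) ≡ (m ≡ᵇ n)
isZero-∸-∸ zero    zero    = refl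
isZero-∸-∸ zero    (suc n) = refl
isZero-∸-∸ (suc m) zero    = refl
isZero-∸-∸ (suc m) (suc n) = isZero-∸-∸ m n

lengthP : ∀ {A B l} → PolyTime A (list B) l → PolyTime A nat (λ a → length (l a))
lengthP {l = l} L = respP (cast length unary-length ∘P mapP (constP tt) L)
  (λ a → length-map _ (l a))

unitsP : ∀ {A f} → PolyTime A nat f → PolyTime A (list unit) (λ a → replicate (f a) tt)
unitsP F = cast (λ n → replicate n tt) unary-replicate ∘P F

sucP : ∀ {A f} → PolyTime A nat f → PolyTime A nat (λ a → suc (f a))
sucP F = cast (λ (_ , n) → suc n) (λ _ → refl) ∘P pair (constP {B = unit} tt) F

predP : ∀ {A f} → PolyTime A nat f → PolyTime A nat (λ a → pred (f a))
predP {f = f} F = respP (cast length unary-length ∘P tailP (unitsP F)) λ a → lemma (f a)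
  where
    lemma : ∀ n → length (tailOf (replicate n tt)) ≡ pred n
    lemma zero    = refl
    lemma (suc n) = length-replicate n

isZeroP : ∀ {A f} → PolyTime A nat f → PolyTime A bool (λ a → isZero (f a))
isZeroP {f = f} F = respP (caseP (unitsP F) (constP true) (constP false)) λ a → lemma (f a)
  where
    lemma : ∀ n → caseList true (λ _ _ → false) (replicate n tt) ≡ isZero n
    lemma zero    = refl
    lemma (suc n) = refl

addP : ∀ {A f g} → PolyTime A nat f → PolyTime A nat g → PolyTime A nat (λ a → f a + g a)
addP {f = f} {g = g} F G = respP
  (foldr⁺P (unitsP F) G (sucP snd₂P) (con 2)
    λ _ c _ → ≤-reflexive (+-comm 2 (size (unary c))))
  λ a → lemma (f a)
  where
    lemma : ∀ m {n} → List.foldr (λ _ → suc) n (replicate m tt) ≡ m + n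
    lemma zero    = refl
    lemma (suc m) = cong suc (lemma m)

monusP : ∀ {A f g} → PolyTime A nat f → PolyTime A nat g → PolyTime A nat (λ a → f a ∸ g a)
monusP {f = f} {g = g} F G = respP
  (foldr⁺P (unitsP G) F (predP snd₂P) (con 0)
    λ _ c _ → ≤-trans (size-unary-mono {pred c} {c} pred[n]≤n) (m≤m+n _ 0))
  λ a → lemma (f a) (g a)
  where
    lemma : ∀ m n → List.foldr (λ _ → pred) m (replicate n tt) ≡ m ∸ n
    lemma m zero    = refl
    lemma m (suc n) = trans (cong pred (lemma m n)) (pred[m∸n]≡m∸[1+n] m n)

mulP : ∀ {A f g} → PolyTime A nat f → PolyTime A nat g → PolyTime A nat (λ a → f a * g a)
mulP {f = f} {g = g} F G = respP
  (foldr⁺P (unitsP F) (constP 0) (addP (G ∘P rest₂P) snd₂P) (bound G)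
    λ _ c a → ≤-trans (size-sum (g a) c)
      (+-monoʳ-≤ (size (unary c)) (≤-trans (size-output G a) (⟦⟧ₚ-mono (bound G) (m≤m+n _ 1)))))
  λ a → lemma (f a) (g a)
  where
    rearrange : ∀ m n → 1 + ((m + n) + (m + n)) ≡ (1 + (n + n)) + (m + m)
    rearrange = solve-∀
    size-sum : ∀ m n → size (unary (m + n)) ≤ size (unary n) + size (unary m)
    size-sum m n rewrite size-unary (m + n) | size-unary m | size-unary n =
      ≤-trans (≤-reflexive (rearrange m n)) (+-monoʳ-≤ (1 + (n + n)) (n≤1+n (m + m)))
    lemma : ∀ m n → List.foldr (λ _ s → n + s) 0 (replicate m tt) ≡ m * n
    lemma zero    n = refl
    lemma (suc m) n = cong (n +_) (lemma m n)

≤ᵇP : ∀ {A f g} → PolyTime A nat f → PolyTime A nat g → PolyTime A bool (λ a → f a ≤ᵇ g a)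
≤ᵇP {f = f} {g = g} F G = respP (isZeroP (monusP F G)) λ a → isZero-∸ (f a) (g a)

≡ᵇP : ∀ {A f g} → PolyTime A nat f → PolyTime A nat g → PolyTime A bool (λ a → f a ≡ᵇ g a)
≡ᵇP {f = f} {g = g} F G = respP (andP (isZeroP (monusP F G)) (isZeroP (monusP G F)))
  λ a → isZero-∸-∸ (f a) (g a)

-- Each step increments all earlier entries, so its growth depends on the accumulator and `foldr⁺P`
-- does not apply. The accumulator has as many entries as steps were made, which gives a quadratic
-- bound directly.
upToP : ∀ {A f} → PolyTime A nat f → PolyTime A (list nat) (λ a → upTo (f a))
upToP {A} {f} F = respP
  (foldrP (unitsP F) (constP []) (consP (constP 0) (mapP (sucP fstP) snd₂P))
    (con 1 ⊕ X ⊗ (con 2 ⊕ (X ⊕ X)))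
    λ a xs → ≤-trans (size-upto xs _ ≤-refl)
      (s≤s (*-mono-≤ (≤-trans (length≤ xs) (m≤n+m _ (size (enc A a))))
        (s≤s (s≤s (+-mono-≤ (≤-trans (length≤ xs) (m≤n+m _ (size (enc A a))))
                            (≤-trans (length≤ xs) (m≤n+m _ (size (enc A a))))))))))
  λ a → trans (upto≡ (replicate (f a) tt)) (cong upTo (length-replicate (f a)))
  where
    upto : List ⊤ → List ℕ
    upto = List.foldr (λ _ s → 0 ∷ List.map suc s) []
    upto≡ : ∀ xs → upto xs ≡ upTo (length xs)
    upto≡ []       = refl
    upto≡ (x ∷ xs) = cong (0 ∷_) (trans (cong (List.map suc) (upto≡ xs)) (map-upTo suc _))
    length≤ : ∀ (xs : List ⊤) → length xs ≤ size (enc (list unit) xs)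
    length≤ []       = z≤n
    length≤ (x ∷ xs) = s≤s (m≤n⇒m≤1+n (length≤ xs))
    size-map-suc : ∀ s → size (enc (list nat) (List.map suc s)) ≡
                         size (enc (list nat) s) + (length s + length s)
    size-map-suc []      = refl
    size-map-suc (n ∷ s) = trans (cong (λ x → 3 + (size (unary n) + x)) (size-map-suc s))
      (rearrange (size (unary n)) (size (enc (list nat) s)) (length s))
      where
        rearrange : ∀ a b c → 3 + (a + (b + (c + c))) ≡ (1 + a + b) + ((1 + c) + (1 + c))
        rearrange = solve-∀
    size-upto : ∀ xs t → length xs ≤ t →
      size (enc (list nat) (upto xs)) ≤ 1 + length xs * (2 + (t + t))
    size-upto []       t le = ≤-refl
    size-upto (x ∷ xs) t le = begin
      2 + size (enc (list nat) (List.map suc (upto xs)))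
        ≡⟨ cong (2 +_) (size-map-suc (upto xs)) ⟩
      2 + (size (enc (list nat) (upto xs)) + (length (upto xs) + length (upto xs)))
        ≤⟨ +-monoʳ-≤ 2 (+-mono-≤ (size-upto xs t xs≤t) (+-mono-≤ len len)) ⟩
      2 + ((1 + length xs * (2 + (t + t))) + (t + t))
        ≡⟨ rearrange (length xs * (2 + (t + t))) (t + t) ⟩
      1 + (1 + length xs) * (2 + (t + t)) ∎
      where
        open ≤-Reasoning
        xs≤t : length xs ≤ t
        xs≤t = ≤-trans (n≤1+n _) le
        len : length (upto xs) ≤ t
        len = ≤-trans (≤-reflexive (trans (cong length (upto≡ xs)) (length-upTo (length xs)))) xs≤t
        rearrange : ∀ a b → 2 + ((1 + a) + b) ≡ 1 + ((2 + b) + a)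
        rearrange = solve-∀

-- Access by index, and numbers in binary

nth : ∀ {A : Set} → A → List A → ℕ → A
nth d []       _       = d
nth d (x ∷ xs) zero    = x
nth d (x ∷ xs) (suc n) = nth d xs n

nthP : ∀ {A B l f} d → PolyTime A (list B) l → PolyTime A nat f →
       PolyTime A B (λ a → nth d (l a) (f a))
nthP {A} {B} {l} {f} d L F = respP
  (caseP (foldr⁺P (unitsP F) L (tailP snd₂P) (con 0)
            λ _ c _ → ≤-trans (size-tail c) (m≤m+n _ 0))
         (constP d) fstP)
  λ a → drop-nth (f a) (l a)
  where
    size-tail : ∀ xs → size (enc (list B) (tailOf xs)) ≤ size (enc (list B) xs)
    size-tail []       = ≤-refl
    size-tail (x ∷ xs) = m≤n+m _ (1 + size (enc B x))
    drop : ℕ → List (El B) → List (El B)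
    drop n xs = List.foldr (λ _ → tailOf) xs (replicate n tt)
    drop-suc : ∀ n xs → drop (suc n) xs ≡ drop n (tailOf xs)
    drop-suc zero    xs = refl
    drop-suc (suc n) xs = cong tailOf (drop-suc n xs)
    drop-[] : ∀ n → drop n [] ≡ []
    drop-[] zero    = refl
    drop-[] (suc n) = cong tailOf (drop-[] n)
    headOr : List (El B) → El B
    headOr = caseList d (λ x _ → x)
    drop-nth : ∀ n xs → headOr (drop n xs) ≡ nth d xs n
    drop-nth n       []       = cong headOr (drop-[] n)
    drop-nth zero    (x ∷ xs) = refl
    drop-nth (suc n) (x ∷ xs) = trans (cong headOr (drop-suc n (x ∷ xs))) (drop-nth n xs)

nth-tabulate : ∀ {A : Set} {n} d (f : Fin n → A) i → nth d (List.tabulate f) (toℕ i) ≡ f i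
nth-tabulate d f zero    = refl
nth-tabulate d f (suc i) = nth-tabulate d (f ∘ suc) i

-- `ℕᵇ` is bijective base 2: the digits are 1 (`true`) and 2 (`false`), lowest first. Every string
-- of digits denotes a number, and different strings denote different numbers, so a number can be
-- chosen by its encoding.
bits : ℕᵇ → List Bool
bits ℕᵇ.zero  = []
bits 2[1+ x ] = false ∷ bits x
bits 1+[2 x ] = true ∷ bits x

fromBits : List Bool → ℕᵇ
fromBits []           = ℕᵇ.zero
fromBits (false ∷ bs) = 2[1+ fromBits bs ]
fromBits (true ∷ bs)  = 1+[2 fromBits bs ]

bitsP : PolyTime bin (list bool) bits
bitsP = cast bits lemma
  where
    lemma : ∀ x → enc bin x ≡ enc (list bool) (bits x)
    lemma ℕᵇ.zero  = refl
    lemma 2[1+ x ] = cong (encodeBool false ∙_) (lemma x)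
    lemma 1+[2 x ] = cong (encodeBool true ∙_) (lemma x)

enc-fromBits : ∀ bs → enc (list bool) bs ≡ enc bin (fromBits bs)
enc-fromBits []           = refl
enc-fromBits (false ∷ bs) = cong (encodeBool false ∙_) (enc-fromBits bs)
enc-fromBits (true ∷ bs)  = cong (encodeBool true ∙_) (enc-fromBits bs)

-- Conversion from binary to unary takes polynomial time only if it is capped.

cap : ℕ → ℕ → ℕ
cap m n = m ∸ (m ∸ n)

cap≡⊓ : ∀ m n → cap m n ≡ m ⊓ n
cap≡⊓ zero    n       = 0∸n≡0 (0 ∸ n)
cap≡⊓ (suc m) zero    = n∸n≡0 m
cap≡⊓ (suc m) (suc n) = trans (+-∸-assoc 1 (m∸n≤m m n)) (cong suc (cap≡⊓ m n))

-- Horner's rule for the digits 1 and 2, with the accumulator cut off at `m` after every digit.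
capped : ℕ → List Bool → ℕ
capped m = List.foldr (λ b s → cap m ((s + s) + (if b then 1 else 2))) 0

⊓-+ : ∀ m a b → m ⊓ ((m ⊓ a) + b) ≡ m ⊓ (a + b)
⊓-+ zero    a       b = refl
⊓-+ (suc m) zero    b = refl
⊓-+ (suc m) (suc a) b = cong suc (⊓-+ m a b)

-- A summand may be cut off at `m` without changing a sum that is cut off at `m`. Hence truncation
-- after every digit has the same result as truncation at the end.
cap-double : ∀ {m s a} b → s ≡ m ⊓ a → cap m ((s + s) + b) ≡ m ⊓ ((a + a) + b)
cap-double {m} {_} {a} b refl = begin
  cap m (((m ⊓ a) + (m ⊓ a)) + b) ≡⟨ cap≡⊓ m _ ⟩
  m ⊓ (((m ⊓ a) + (m ⊓ a)) + b)   ≡⟨ cong (m ⊓_) (+-assoc (m ⊓ a) _ b) ⟩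
  m ⊓ ((m ⊓ a) + ((m ⊓ a) + b))   ≡⟨ ⊓-+ m a _ ⟩
  m ⊓ (a + ((m ⊓ a) + b))         ≡⟨ cong (m ⊓_) (shuffle a (m ⊓ a) b) ⟩
  m ⊓ ((m ⊓ a) + (a + b))         ≡⟨ ⊓-+ m a _ ⟩
  m ⊓ (a + (a + b))               ≡⟨ cong (m ⊓_) (+-assoc a a b) ⟨
  m ⊓ ((a + a) + b)               ∎
  where
    open ≡-Reasoning
    shuffle : ∀ a b c → a + (b + c) ≡ b + (a + c)
    shuffle = solve-∀

capped≡⊓ : ∀ m x → capped m (bits x) ≡ m ⊓ ℕᵇ.toℕ x
capped≡⊓ m ℕᵇ.zero  = sym (⊓-zeroʳ m)
capped≡⊓ m 2[1+ x ] = trans (cap-double 2 (capped≡⊓ m x)) (cong (m ⊓_) (twice-suc (ℕᵇ.toℕ x)))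
  where
    twice-suc : ∀ a → (a + a) + 2 ≡ 2 * suc a
    twice-suc = solve-∀
capped≡⊓ m 1+[2 x ] = trans (cap-double 1 (capped≡⊓ m x)) (cong (m ⊓_) (suc-twice (ℕᵇ.toℕ x)))
  where
    suc-twice : ∀ a → (a + a) + 1 ≡ suc (2 * a)
    suc-twice = solve-∀

cappedP : PolyTime (nat ⊠ bin) nat (λ (m , x) → capped m (bits x))
cappedP = foldr⁺P (bitsP ∘P sndP) (constP 0)
  (monusP m (monusP m (addP (addP snd₂P snd₂P) (ifP fstP (constP 1) (constP 2)))))
  X
  λ b c (m , x) → ≤-trans (size-unary-mono (m∸n≤m m (m ∸ ((c + c) + (if b then 1 else 2)))))
    (m≤n⇒m≤o+n (size (unary c)) (m≤n⇒m≤n+o _ (m≤n⇒m≤1+n (m≤m+n _ _))))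
  where
    m : PolyTime (bool ⊠ nat ⊠ nat ⊠ bin) nat (λ (_ , _ , m , _) → m)
    m = fstP ∘P rest₂P

-- Domination in gadgets

∣p∪q∣≤∣p∣+∣q∣ : ∀ {n} (p q : Subset n) → ∣ p ∪ q ∣ ≤ ∣ p ∣ + ∣ q ∣
∣p∪q∣≤∣p∣+∣q∣ []            []            = z≤n
∣p∪q∣≤∣p∣+∣q∣ (inside ∷ p)  (inside ∷ q)  =
  s≤s (≤-trans (∣p∪q∣≤∣p∣+∣q∣ p q) (+-monoʳ-≤ ∣ p ∣ (n≤1+n _)))
∣p∪q∣≤∣p∣+∣q∣ (inside ∷ p)  (outside ∷ q) = s≤s (∣p∪q∣≤∣p∣+∣q∣ p q)
∣p∪q∣≤∣p∣+∣q∣ (outside ∷ p) (inside ∷ q)  =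
  ≤-trans (s≤s (∣p∪q∣≤∣p∣+∣q∣ p q)) (≤-reflexive (sym (+-suc _ _)))
∣p∪q∣≤∣p∣+∣q∣ (outside ∷ p) (outside ∷ q) = ∣p∪q∣≤∣p∣+∣q∣ p q

image : ∀ {a b} (f : Fin a → Fin b) (p : Subset a) →
        ∃[ q ] ∣ q ∣ ≤ ∣ p ∣ × (∀ i → i Subset.∈ p → f i Subset.∈ q)
image {b = b} f []    = Subset.⊥ , ≤-reflexive (∣⊥∣≡0 b) , λ _ ()
image f (outside ∷ p) =
  let q , q≤p , f∈q = image (f ∘ suc) p
  in q , q≤p , λ { (suc i) (there i∈p) → f∈q i i∈p }
image f (inside ∷ p)  =
  let q , q≤p , f∈q = image (f ∘ suc) p
  in ⁅ f zero ⁆ ∪ q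
   , ≤-trans (∣p∪q∣≤∣p∣+∣q∣ ⁅ f zero ⁆ q) (+-mono-≤ (≤-reflexive (∣⁅x⁆∣≡1 (f zero))) q≤p)
   , λ { zero    here        → p⊆p∪q q (x∈⁅x⁆ (f zero))
       ; (suc i) (there i∈p) → q⊆p∪q ⁅ f zero ⁆ q (f∈q i i∈p) }

enlarge : ∀ {n} (p : Subset n) {k} → ∣ p ∣ ≤ k → k ≤ n → ∃[ q ] ∣ q ∣ ≡ k × p Subset.⊆ q
enlarge []            _       z≤n       = [] , refl , id
enlarge (inside ∷ p)  (s≤s p≤k) (s≤s k≤n) =
  let q , q≡k , p⊆q = enlarge p p≤k k≤n
  in inside ∷ q , cong suc q≡k , λ { here → here ; (there i∈p) → there (p⊆q i∈p) }
enlarge {suc n} (outside ∷ p) {k} p≤k k≤1+n with m≤n⇒m<n∨m≡n k≤1+n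
... | inj₁ (s≤s k≤n) =
  let q , q≡k , p⊆q = enlarge p p≤k k≤n
  in outside ∷ q , q≡k , λ { (there i∈p) → there (p⊆q i∈p) }
... | inj₂ refl      =
  let q , q≡n , p⊆q = enlarge p (∣p∣≤n p) ≤-refl
  in inside ∷ q , cong suc q≡n , λ { (there i∈p) → there (p⊆q i∈p) }

-- The image may have fewer than `k` elements; as domination passes to supersets, it is filled up.
-- Here `k ≤ b` is needed.
image-of-size : ∀ {a b} (f : Fin a → Fin b) (p : Subset a) {k} → ∣ p ∣ ≤ k → k ≤ b →
                ∃[ q ] ∣ q ∣ ≡ k × (∀ i → i Subset.∈ p → f i Subset.∈ q)
image-of-size f p p≤k k≤b =
  let q , q≤p , f∈q = image f p
      r , r≡k , q⊆r = enlarge q (≤-trans q≤p p≤k) k≤b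
  in r , r≡k , λ i i∈p → q⊆r (f∈q i i∈p)

closedAdj : ∀ {n} → Graph n → Fin n → Fin n → Bool
closedAdj G i j = does (i Fin.≟ j) ∨ does (adj? G i j)

T-does : ∀ {A : Set} {a? : Dec A} → T (does a?) ⇔ A
T-does {a? = yes a} = mk⇔ (const a) _
T-does {a? = no ¬a} = mk⇔ (λ ()) ¬a

T-closedAdj : ∀ {n} (G : Graph n) {i j} → T (closedAdj G i j) ⇔ (i ≡ j ⊎ Adj G i j)
T-closedAdj G {i} {j} = mk⇔ to from
  where
    to : T (closedAdj G i j) → i ≡ j ⊎ Adj G i j
    to t with Equivalence.to (T-∨ {does (i Fin.≟ j)}) t
    ... | inj₁ p = inj₁ (Equivalence.to (T-does {a? = i Fin.≟ j}) p)
    ... | inj₂ p = inj₂ (Equivalence.to (T-does {a? = adj? G i j}) p)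
    from : i ≡ j ⊎ Adj G i j → T (closedAdj G i j)
    from (inj₁ p) = Equivalence.from (T-∨ {does (i Fin.≟ j)})
      (inj₁ (Equivalence.from (T-does {a? = i Fin.≟ j}) p))
    from (inj₂ p) = Equivalence.from (T-∨ {does (i Fin.≟ j)})
      (inj₂ (Equivalence.from (T-does {a? = adj? G i j}) p))

lookup-injective : ∀ {A : Set} {xs : List A} → Unique xs → ∀ i j →
                   List.lookup xs i ≡ List.lookup xs j → i ≡ j
lookup-injective (x∉xs ∷ u) zero    zero    eq = refl
lookup-injective (x∉xs ∷ u) zero    (suc j) eq = ⊥-elim (All.lookup x∉xs (∈-lookup j) eq)
lookup-injective (x∉xs ∷ u) (suc i) zero    eq = ⊥-elim (All.lookup x∉xs (∈-lookup i) (sym eq))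
lookup-injective (x∉xs ∷ u) (suc i) (suc j) eq = cong suc (lookup-injective u i j eq)

-- For d = 2 + D: U i stands for the choice of i, and P m j for the m-th
-- vertex of a path whose end can only be reached through some E i j with i
-- in the closed neighbourhood of j.

data Vertex (D n : ℕ) : Set where
  U : Fin n → Vertex D n
  E : Fin n → Fin n → Vertex D n
  P : Fin (suc D) → Fin n → Vertex D n

module _ {D n : ℕ} where

  -- The order fixes the rows of the adjacency matrix and the order of the representation; the
  -- program lists its descriptions in the same order.
  vertices : List (Vertex D n)
  vertices = List.map U (allFin n) ++
    (cartesianProductWith E (allFin n) (allFin n) ++
     cartesianProductWith P (allFin (suc D)) (allFin n))

  ∈-vertices : ∀ x → x ∈ vertices
  ∈-vertices (U i)   = ∈-++⁺ˡ (∈-map⁺ U (∈-allFin i))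
  ∈-vertices (E i j) = ∈-++⁺ʳ (List.map U (allFin n))
    (∈-++⁺ˡ (∈-cartesianProductWith⁺ E (∈-allFin i) (∈-allFin j)))
  ∈-vertices (P m j) = ∈-++⁺ʳ (List.map U (allFin n))
    (∈-++⁺ʳ (cartesianProductWith E (allFin n) (allFin n))
      (∈-cartesianProductWith⁺ P (∈-allFin m) (∈-allFin j)))

  vertices-unique : Unique vertices
  vertices-unique = Unique.++⁺
    (Unique.map⁺ (λ { refl → refl }) (Unique.allFin⁺ n))
    (Unique.++⁺
      (Unique.cartesianProductWith⁺ E (λ { refl → refl , refl }) (Unique.allFin⁺ n) (Unique.allFin⁺ n))
      (Unique.cartesianProductWith⁺ P (λ { refl → refl , refl }) (Unique.allFin⁺ (suc D)) (Unique.allFin⁺ n))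
      λ (x∈E , x∈P) → E≢P (∈-cartesianProductWith⁻ E (allFin n) (allFin n) x∈E)
                           (∈-cartesianProductWith⁻ P (allFin (suc D)) (allFin n) x∈P))
    λ (x∈U , x∈EP) → U≢EP (∈-map⁻ U x∈U) (∈-++⁻ (cartesianProductWith E (allFin n) (allFin n)) x∈EP)
    where
      E≢P : ∀ {x : Vertex D n} → (∃[ i ] ∃[ j ] i ∈ allFin n × j ∈ allFin n × x ≡ E i j) →
            ¬ (∃[ m ] ∃[ j ] m ∈ allFin (suc D) × j ∈ allFin n × x ≡ P m j)
      E≢P (_ , _ , _ , _ , refl) (_ , _ , _ , _ , ())
      U≢EP : ∀ {x : Vertex D n} → (∃[ i ] i ∈ allFin n × x ≡ U i) →
             ¬ (x ∈ cartesianProductWith E (allFin n) (allFin n) ⊎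
                x ∈ cartesianProductWith P (allFin (suc D)) (allFin n))
      U≢EP (_ , _ , refl) (inj₁ x∈E) with ∈-cartesianProductWith⁻ E (allFin n) (allFin n) x∈E
      ... | _ , _ , _ , _ , ()
      U≢EP (_ , _ , refl) (inj₂ x∈P) with ∈-cartesianProductWith⁻ P (allFin (suc D)) (allFin n) x∈P
      ... | _ , _ , _ , _ , ()

  vertex : Fin (length vertices) → Vertex D n
  vertex = List.lookup vertices

  number : Vertex D n → Fin (length vertices)
  number x = index (∈-vertices x)

  vertex-number : ∀ x → vertex (number x) ≡ x
  vertex-number x = sym (lookup-index (∈-vertices x))

  n≤vertices : n ≤ length vertices
  n≤vertices = begin
    n                                     ≡⟨ length-tabulate {n = n} id ⟨
    length (allFin n)                     ≡⟨ length-map (U {D}) (allFin n) ⟨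
    length (List.map (U {D}) (allFin n))  ≤⟨ m≤m+n _ _ ⟩
    length (List.map (U {D}) (allFin n)) + _ ≡⟨ length-++ (List.map (U {D}) (allFin n)) ⟨
    length vertices ∎
    where open ≤-Reasoning

  -- An upper bound on the edges of a gadget: the potential below changes by
  -- at most one along these pairs.

  data Close (cl : Fin n → Fin n → Bool) : Vertex D n → Vertex D n → Set where
    UU  : ∀ {i i′} → Close cl (U i) (U i′)
    UE  : ∀ {i j} → Close cl (U i) (E i j)
    EU  : ∀ {i j} → Close cl (E i j) (U i)
    row : ∀ {i j j′} → Close cl (E i j) (E i j′)
    col : ∀ {i i′ j} → cl i j ≡ cl i′ j → Close cl (E i j) (E i′ j)
    EP  : ∀ {i j} → cl i j ≡ true → Close cl (E i j) (P zero j)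
    PE  : ∀ {i j} → cl i j ≡ true → Close cl (P zero j) (E i j)
    PP  : ∀ {m m′ j} → toℕ m ≤ suc (toℕ m′) → toℕ m′ ≤ suc (toℕ m) → Close cl (P m j) (P m′ j)

  Close-sym : ∀ {cl x y} → Close cl x y → Close cl y x
  Close-sym UU       = UU
  Close-sym UE       = EU
  Close-sym EU       = UE
  Close-sym row      = row
  Close-sym (col p)  = col (sym p)
  Close-sym (EP p)   = PE p
  Close-sym (PE p)   = EP p
  Close-sym (PP p q) = PP q p

-- The last four fields are the edges used by the walks from the `U i`; `close` limits what else a
-- representation may bring along. In between, the adjacency is left open.
record Gadget (D : ℕ) {n} (cl : Fin n → Fin n → Bool) : Set where
  field
    adj    : Vertex D n → Vertex D n → Bool
    symm   : ∀ x y → T (adj x y) → T (adj y x)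
    irrefl : ∀ x → ¬ T (adj x x)
    close  : ∀ x y → T (adj x y) → Close cl x y
    adj-UU : ∀ {i i′} → i ≢ i′ → T (adj (U i) (U i′))
    adj-UE : ∀ i j → T (adj (U i) (E i j))
    adj-EP : ∀ {i j} → T (cl i j) → T (adj (E i j) (P zero j))
    adj-PP : ∀ {m m′ j} → toℕ m′ ≡ suc (toℕ m) → T (adj (P m j) (P m′ j))

  graph : Graph (length (vertices {D} {n}))
  graph = record
    { Adj    = λ u v → T (adj (vertex u) (vertex v))
    ; adj?   = λ u v → T? (adj (vertex u) (vertex v))
    ; symm   = λ {u} {v} → symm (vertex u) (vertex v)
    ; irrefl = λ { {u} refl → irrefl (vertex u) }
    }

-- Domination in `G` and distance domination in a gadget

module Reduction {D n} (G : Graph n) (H : Gadget D (closedAdj G)) where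

  open Gadget H using (adj; graph; close)

  cl : Fin n → Fin n → Bool
  cl = closedAdj G

  edge : ∀ {x y} → T (adj x y) → Adj graph (number x) (number y)
  edge {x} {y} t rewrite vertex-number x | vertex-number y = t

  snoc : ∀ {N} {K : Graph N} {ℓ u v w} → Walk K ℓ u v → Adj K v w → Walk K (suc ℓ) u w
  snoc []      e = e ∷ []
  snoc (f ∷ p) e = f ∷ snoc p e

  walk-to-path : ∀ {i j} → T (cl i j) → ∀ m (m<D : m < suc D) →
    Walk graph (2 + m) (number (U i)) (number (P (fromℕ< m<D) j))
  walk-to-path {i} {j} t zero    m<D = edge (Gadget.adj-UE H i j) ∷ edge (Gadget.adj-EP H t) ∷ []
  walk-to-path {i} {j} t (suc m) m<D = snoc (walk-to-path t m (<-trans (n<1+n m) m<D))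
    (edge (Gadget.adj-PP H (trans (toℕ-fromℕ< m<D) (cong suc (sym (toℕ-fromℕ< (<-trans (n<1+n m) m<D)))))))

  reach-U : ∀ i i′ → ∃[ ℓ ] ℓ ≤ 1 × Walk graph ℓ (number (U i)) (number (U i′))
  reach-U i i′ with i Fin.≟ i′
  ... | yes refl = 0 , z≤n , []
  ... | no i≢i′  = 1 , ≤-refl , edge (Gadget.adj-UU H i≢i′) ∷ []

  -- Only for the last kind of vertex does it matter which i is chosen.

  target : Vertex D n → Fin n
  target (U i)   = i
  target (E i j) = i
  target (P m j) = j

  reach : ∀ i x → T (cl i (target x)) → DistanceAtMost graph (2 + D) (number (U i)) (number x)
  reach i (U i′)   t = let ℓ , ℓ≤1 , p = reach-U i i′ in ℓ , ≤-trans ℓ≤1 (s≤s z≤n) , p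
  reach i (E i′ j) t =
    let ℓ , ℓ≤1 , p = reach-U i i′
    in suc ℓ , ≤-trans (s≤s ℓ≤1) (s≤s (s≤s z≤n)) , snoc p (edge (Gadget.adj-UE H i′ j))
  reach i (P m j)  t = 2 + toℕ m , s≤s (toℕ<n m) ,
    subst (λ m′ → Walk graph (2 + toℕ m) (number (U i)) (number (P m′ j)))
      (fromℕ<-toℕ m (toℕ<n m)) (walk-to-path t (toℕ m) (toℕ<n m))

  -- A lower bound on the distance to the end of the j-th path: it changes
  -- by at most one along every edge.

  potential : Fin n → Vertex D n → ℕ
  potential j (U i)    = if cl i j then 2 + D else 3 + D
  potential j (E i j′) =
    if cl i j then (if does (j Fin.≟ j′) then 1 + D else 2 + D) else 3 + D
  potential j (P m j′) = if does (j Fin.≟ j′) then D ∸ toℕ m else 3 + D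

  -- The critical pairs are those at the foot of the `j`-th path. `E i j` has potential `1 + D` or
  -- `3 + D` according to `cl i j`, so `col` has to ask for equal values of `cl`, and only the
  -- `E i j` of potential `1 + D` may touch `P zero j`, whose potential is `D`.
  potential-close : ∀ j {x y} → Close cl x y → potential j x ≤ suc (potential j y)
  potential-close j (UU {i} {i′}) with cl i j | cl i′ j
  ... | false | false = n≤1+n _
  ... | false | true  = ≤-refl
  ... | true  | false = m≤n+m _ 2
  ... | true  | true  = n≤1+n _
  potential-close j (UE {i} {j′}) with cl i j | does (j Fin.≟ j′)
  ... | false | _     = n≤1+n _
  ... | true  | false = n≤1+n _
  ... | true  | true  = ≤-refl
  potential-close j (EU {i} {j′}) with cl i j | does (j Fin.≟ j′)
  ... | false | _     = n≤1+n _
  ... | true  | false = n≤1+n _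
  ... | true  | true  = m≤n+m _ 2
  potential-close j (row {i} {j′} {j″}) with cl i j | does (j Fin.≟ j′) | does (j Fin.≟ j″)
  ... | false | _     | _     = n≤1+n _
  ... | true  | false | false = n≤1+n _
  ... | true  | false | true  = ≤-refl
  ... | true  | true  | false = m≤n+m _ 2
  ... | true  | true  | true  = n≤1+n _
  potential-close j (col {i} {i′} {j′} eq) with j Fin.≟ j′
  ... | yes refl rewrite eq = n≤1+n _
  ... | no _ with cl i j | cl i′ j
  ... | false | false = n≤1+n _
  ... | false | true  = ≤-refl
  ... | true  | false = m≤n+m _ 2
  ... | true  | true  = n≤1+n _
  potential-close j (EP {i} {j′} eq) with j Fin.≟ j′
  ... | yes refl rewrite eq = ≤-refl
  ... | no _ with cl i j
  ... | false = n≤1+n _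
  ... | true  = m≤n+m _ 2
  potential-close j (PE {i} {j′} eq) with j Fin.≟ j′
  ... | yes refl rewrite eq = m≤n+m _ 2
  ... | no _ with cl i j
  ... | false = n≤1+n _
  ... | true  = ≤-refl
  potential-close j (PP {m} {m′} {j′} _ m′≤1+m) with does (j Fin.≟ j′)
  ... | false = n≤1+n _
  ... | true  = ≤-trans (∸-suc D (toℕ m)) (s≤s (∸-monoʳ-≤ D m′≤1+m))
    where
      ∸-suc : ∀ a b → a ∸ b ≤ suc (a ∸ suc b)
      ∸-suc a b rewrite sym (pred[m∸n]≡m∸[1+n] a b) = suc-pred-≤ (a ∸ b)
        where
          suc-pred-≤ : ∀ k → k ≤ suc (pred k)
          suc-pred-≤ zero    = z≤n
          suc-pred-≤ (suc k) = ≤-refl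

  potential-walk : ∀ j {ℓ u v} → Walk graph ℓ u v →
                   potential j (vertex u) ≤ ℓ + potential j (vertex v)
  potential-walk j []      = ≤-refl
  potential-walk j (e ∷ p) =
    ≤-trans (potential-close j (close _ _ e)) (s≤s (potential-walk j p))

  -- Vertices that stand for no member of the closed neighbourhood of `j` have potential `3 + D`,
  -- one more than a walk of length `2 + D` to a vertex of potential 0 can start from.
  small-potential : ∀ j x → potential j x ≤ 2 + D → T (cl (target x) j)
  small-potential j (U i) le with cl i j
  ... | true  = _
  ... | false = ⊥-elim (1+n≰n le)
  small-potential j (E i j′) le with cl i j
  ... | true  = _
  ... | false = ⊥-elim (1+n≰n le)
  small-potential j (P m j′) le with j Fin.≟ j′
  ... | yes refl = Equivalence.from (T-closedAdj G) (inj₁ refl)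
  ... | no _     = ⊥-elim (1+n≰n le)

  end : Fin n → Fin (length (vertices {D} {n}))
  end j = number (P (fromℕ D) j)

  potential-end : ∀ j → potential j (vertex (end j)) ≡ 0
  potential-end j rewrite vertex-number (P (fromℕ D) j) | dec-true (j Fin.≟ j) refl | toℕ-fromℕ D = n∸n≡0 D

  correct : ∀ {k} → k ≤ n →
    (∃[ S ] ∣ S ∣ ≡ k × Dominating G S) ⇔
    (∃[ S ] ∣ S ∣ ≡ k × DistanceDominating (2 + D) graph S)
  correct {k} k≤n = mk⇔ to from
    where
      to : (∃[ S ] ∣ S ∣ ≡ k × Dominating G S) →
           ∃[ S ] ∣ S ∣ ≡ k × DistanceDominating (2 + D) graph S
      to (S , ∣S∣≡k , dom) =
        let S′ , ∣S′∣≡k , U∈S′ =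
              image-of-size (number ∘ U) S (≤-reflexive ∣S∣≡k) (≤-trans k≤n (n≤vertices {D}))
        in S′ , ∣S′∣≡k , λ v →
          let i , i∈S , adj-i = dom (target (vertex v))
          in number (U i) , U∈S′ i i∈S ,
             subst (DistanceAtMost graph (2 + D) (number (U i))) (number-vertex v)
               (reach i (vertex v) (Equivalence.from (T-closedAdj G) adj-i))
        where
          number-vertex : ∀ v → number (vertex v) ≡ v
          number-vertex v = lookup-injective (vertices-unique {D} {n}) _ _ (vertex-number (vertex v))
      from : (∃[ S ] ∣ S ∣ ≡ k × DistanceDominating (2 + D) graph S) →
             ∃[ S ] ∣ S ∣ ≡ k × Dominating G S
      from (S , ∣S∣≡k , dom) =
        let S′ , ∣S′∣≡k , target∈S′ = image-of-size (target ∘ vertex) S (≤-reflexive ∣S∣≡k) k≤n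
        -- The vertex that reaches the end of the `j`-th path is replaced by the vertex of `G` that
        -- it stands for.
        in S′ , ∣S′∣≡k , λ j →
          let u , u∈S , ℓ , ℓ≤d , p = dom (end j)
          in target (vertex u) , target∈S′ u u∈S ,
             Equivalence.to (T-closedAdj G) (small-potential j (vertex u) (begin
               potential j (vertex u)           ≤⟨ potential-walk j p ⟩
               ℓ + potential j (vertex (end j)) ≡⟨ cong (ℓ +_) (potential-end j) ⟩
               ℓ + 0                            ≡⟨ +-identityʳ ℓ ⟩
               ℓ                                ≤⟨ ℓ≤d ⟩
               2 + D                            ∎))
        where open ≤-Reasoning

-- The program of the reduction

encodeFamily-tabulate : ∀ {A : Set} {B n} {e : A → Tree} {f : Fin n → A} {g : Fin n → El B} →
  (∀ i → e (f i) ≡ enc B (g i)) → encodeFamily e f ≡ enc (list B) (tabulate g)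
encodeFamily-tabulate {n = zero}  eq = refl
encodeFamily-tabulate {n = suc n} eq = cong₂ _∙_ (eq zero) (encodeFamily-tabulate (eq ∘ suc))

encodeFamily-lookup : ∀ {A V : Set} {B} {e : A → Tree} (xs : List V) {f : Fin (length xs) → A}
  (g : V → El B) → (∀ i → e (f i) ≡ enc B (g (List.lookup xs i))) →
  encodeFamily e f ≡ enc (list B) (List.map g xs)
encodeFamily-lookup {B = B} xs g eq = trans (encodeFamily-tabulate eq)
  (cong (enc (list B)) (trans (sym (map-tabulate (List.lookup xs) g)) (cong (List.map g) (tabulate-lookup xs))))

matrix : ∀ {n} → Graph n → List (List Bool)
matrix G = tabulate (λ i → tabulate (λ j → does (adj? G i j)))

length-matrix : ∀ {n} (G : Graph n) → length (matrix G) ≡ n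
length-matrix G = length-tabulate (λ i → tabulate (λ j → does (adj? G i j)))

entry : List (List Bool) → ℕ → ℕ → Bool
entry M i j = (i ≡ᵇ j) ∨ nth false (nth [] M i) j

entry-matrix : ∀ {n} (G : Graph n) i j → entry (matrix G) (toℕ i) (toℕ j) ≡ closedAdj G i j
entry-matrix G i j = cong₂ _∨_ (toℕ-≡ᵇ i j)
  (trans (cong (λ r → nth false r (toℕ j)) (nth-tabulate [] (λ i → tabulate (λ j → does (adj? G i j))) i))
         (nth-tabulate false (λ j → does (adj? G i j)) j))
  where
    toℕ-≡ᵇ : ∀ {n} (i j : Fin n) → (toℕ i ≡ᵇ toℕ j) ≡ does (i Fin.≟ j)
    toℕ-≡ᵇ zero    zero    = refl
    toℕ-≡ᵇ zero    (suc j) = refl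
    toℕ-≡ᵇ (suc i) zero    = refl
    toℕ-≡ᵇ (suc i) (suc j) = toℕ-≡ᵇ i j

module _ {A : Set} where

  map-upTo-allFin : ∀ {n} (f : ℕ → A) (g : Fin n → A) → (∀ i → f (toℕ i) ≡ g i) →
                    List.map f (upTo n) ≡ List.map g (allFin n)
  map-upTo-allFin {n} f g eq = begin
    List.map f (upTo n)   ≡⟨ map-upTo f n ⟩
    applyUpTo f n         ≡⟨ applyUpTo-tabulate f g eq ⟩
    tabulate g            ≡⟨ map-tabulate id g ⟨
    List.map g (allFin n) ∎
    where
      open ≡-Reasoning
      applyUpTo-tabulate : ∀ {n} (f : ℕ → A) (g : Fin n → A) → (∀ i → f (toℕ i) ≡ g i) →
                           applyUpTo f n ≡ tabulate g
      applyUpTo-tabulate {zero}  f g eq = refl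
      applyUpTo-tabulate {suc n} f g eq = cong₂ _∷_ (eq zero) (applyUpTo-tabulate (f ∘ suc) (g ∘ suc) (eq ∘ suc))

  map-cartesianProductWith : ∀ {B C V : Set} (h : V → A) (f : B → C → V) xs ys →
    List.map h (cartesianProductWith f xs ys) ≡
    concat (List.map (λ x → List.map (λ y → h (f x y)) ys) xs)
  map-cartesianProductWith h f []       ys = refl
  map-cartesianProductWith h f (x ∷ xs) ys =
    trans (map-++ h (List.map (f x) ys) _)
      (cong₂ _++_ (sym (map-∘ ys)) (map-cartesianProductWith h f xs ys))

-- A vertex is computed as a description, which determines its adjacencies
-- and its member of the representation.

record Coding (D : ℕ) : Set₁ where
  field
    Desc PathData : Ty
    descU    : ℕ → ℕ → El Desc
    descE    : ℕ → Bool → ℕ → ℕ → El Desc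
    descP    : ℕ → El PathData → ℕ → El Desc
    pathData : Fin (suc D) → El PathData
    adjacent : El Desc → El Desc → Bool
    member   : El Desc → Tree

    descU-poly    : PolyTime (nat ⊠ nat) Desc (λ (n , i) → descU n i)
    descE-poly    : PolyTime (nat ⊠ bool ⊠ nat ⊠ nat) Desc (λ (n , b , i , j) → descE n b i j)
    descP-poly    : PolyTime (nat ⊠ PathData ⊠ nat) Desc (λ (n , c , j) → descP n c j)
    adjacent-poly : PolyTime (Desc ⊠ Desc) bool (λ (x , y) → adjacent x y)
    member-poly   : PolyTime Desc tree member

  module _ {n} (cl : Fin n → Fin n → Bool) where

    desc : Vertex D n → El Desc
    desc (U i)   = descU n (toℕ i)
    desc (E i j) = descE n (cl i j) (toℕ i) (toℕ j)
    desc (P m j) = descP n (pathData m) (toℕ j)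

-- `gadget-adj` and `encode-rep` tie the program to the graph: what it computes from descriptions
-- alone is the adjacency and the encoded representation.
record Construction (D : ℕ) (C : RepresentedClass) : Set₁ where
  open RepresentedClass C
  field
    coding : Coding D
  open Coding coding public
  field
    gadget         : ∀ {n} (cl : Fin n → Fin n → Bool) → Gadget D cl
    gadget-adj     : ∀ {n} (cl : Fin n → Fin n → Bool) x y →
                     Gadget.adj (gadget cl) x y ≡ adjacent (desc cl x) (desc cl y)
    representation : ∀ {n} (cl : Fin n → Fin n → Bool) → Representation (length (vertices {D} {n}))
    encode-rep     : ∀ {n} (cl : Fin n → Fin n → Bool) →
                     encodeRep (representation cl) ≡
                     enc (list tree) (List.map (λ x → member (desc cl x)) vertices)
    represents     : ∀ {n} (cl : Fin n → Fin n → Bool) →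
                     Represents (representation cl) (Gadget.graph (gadget cl))

-- The FPT reduction given by a construction

module Hardness {D C} (K : Construction D C) where
  open Construction K

  private
    Matrix : Ty
    Matrix = list (list bool)

  descs : List (List Bool) → List (El Desc)
  descs M =
    List.map (λ i → descU n i) I ++
    (concat (List.map (λ i → List.map (λ j → descE n (entry M i j) i j) I) I) ++
     concat (List.map (λ c → List.map (λ j → descP n c j) I) (tabulate pathData)))
    where
      n : ℕ
      n = length M
      I : List ℕ
      I = upTo n

  descs-poly : PolyTime Matrix (list Desc) descs
  descs-poly = appendP
    (mapP (descU-poly ∘P pair (lengthP sndP) fstP) (I idP))
    (appendP
      (concatP (mapP
        (mapP
          (descE-poly ∘P pair (lengthP rest₂P) (pair entryP (pair snd₂P fstP)))
          (I sndP))
        (I idP)))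
      (concatP (mapP
        (mapP (descP-poly ∘P pair (lengthP rest₂P) (pair snd₂P fstP)) (I sndP))
        -- As `D` is fixed, the data of the path levels are a constant of the program.
        (constP (tabulate pathData)))))
    where
      I : ∀ {A M} → PolyTime A Matrix M → PolyTime A (list nat) (λ a → upTo (length (M a)))
      I M = upToP (lengthP M)
      entryP : PolyTime (nat ⊠ nat ⊠ Matrix) bool (λ (j , i , M) → entry M i j)
      entryP = orP (≡ᵇP snd₂P fstP) (nthP false (nthP [] rest₂P snd₂P) fstP)

  descs-matrix : ∀ {n} (G : Graph n) → descs (matrix G) ≡ List.map (desc (closedAdj G)) vertices
  descs-matrix {n} G rewrite length-matrix G = begin
    List.map (descU n) (upTo n) ++ (concat (List.map rowE (upTo n)) ++ concat (List.map rowP (tabulate pathData)))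
      ≡⟨ cong₂ _++_ partU (cong₂ _++_ partE partP) ⟩
    List.map h (List.map U (allFin n)) ++
      (List.map h (cartesianProductWith E (allFin n) (allFin n)) ++
       List.map h (cartesianProductWith P (allFin (suc D)) (allFin n)))
      ≡⟨ cong (List.map h (List.map U (allFin n)) ++_)
           (map-++ h (cartesianProductWith E (allFin n) (allFin n)) _) ⟨
    List.map h (List.map U (allFin n)) ++ List.map h
      (cartesianProductWith E (allFin n) (allFin n) ++ cartesianProductWith P (allFin (suc D)) (allFin n))
      ≡⟨ map-++ h (List.map U (allFin n)) _ ⟨
    List.map h vertices ∎
    where
      open ≡-Reasoning
      h : Vertex D n → El Desc
      h = desc (closedAdj G)
      rowE : ℕ → List (El Desc)
      rowE i = List.map (λ j → descE n (entry (matrix G) i j) i j) (upTo n)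
      rowP : El PathData → List (El Desc)
      rowP c = List.map (descP n c) (upTo n)
      partU : List.map (descU n) (upTo n) ≡ List.map h (List.map U (allFin n))
      partU = trans (map-upTo-allFin (descU n) (h ∘ U) (λ _ → refl)) (map-∘ (allFin n))
      partE : concat (List.map rowE (upTo n)) ≡
              List.map h (cartesianProductWith E (allFin n) (allFin n))
      partE = trans
        (cong concat (map-upTo-allFin rowE (λ i → List.map (λ j → h (E i j)) (allFin n)) λ i →
          map-upTo-allFin _ _ λ j → cong (λ b → descE n b (toℕ i) (toℕ j)) (entry-matrix G i j)))
        (sym (map-cartesianProductWith h E (allFin n) (allFin n)))
      partP : concat (List.map rowP (tabulate pathData)) ≡
              List.map h (cartesianProductWith P (allFin (suc D)) (allFin n))
      partP = trans
        (cong concat (trans (cong (List.map rowP) (sym (map-tabulate id pathData)))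
          (trans (sym (map-∘ (allFin (suc D))))
            (map-cong (λ m → map-upTo-allFin (descP n (pathData m)) (λ j → h (P m j)) (λ _ → refl))
                      (allFin (suc D))))))
        (sym (map-cartesianProductWith h P (allFin (suc D)) (allFin n)))

  -- For k > n the gadget may have a dominating set of size k although G has
  -- no set of k vertices; G is replaced by the empty graph then.

  guard : List (List Bool) × ℕᵇ → List (List Bool)
  guard (M , k) = if capped (suc (length M)) (bits k) ≤ᵇ length M then M else []

  guard-poly : PolyTime (Matrix ⊠ bin) Matrix guard
  guard-poly = ifP
    (≤ᵇP (cappedP ∘P pair (sucP (lengthP fstP)) sndP) (lengthP fstP))
    fstP (constP [])

  Output : Ty
  Output = Matrix ⊠ bin ⊠ list tree

  assemble : List (El Desc) × ℕᵇ → El Output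
  assemble (xs , k) = List.map (λ x → List.map (λ y → adjacent x y) xs) xs , k , List.map member xs

  assemble-poly : PolyTime (list Desc ⊠ bin) Output assemble
  assemble-poly = pair
    (mapP (mapP (adjacent-poly ∘P pair snd₂P fstP) (fstP ∘P sndP)) fstP)
    (pair sndP (mapP (member-poly ∘P fstP) fstP))

  output : List (List Bool) × ℕᵇ → El Output
  output (M , k) = assemble (descs (guard (M , k)) , k)

  output-poly : PolyTime (Matrix ⊠ bin) Output output
  output-poly = assemble-poly ∘P pair (descs-poly ∘P guard-poly) sndP

  Source Target : ParameterizedProblem
  Source = k-DominatingSet
  Target = DistanceDominatingSet (2 + D) C

  module Target = ParameterizedProblem Target

  build : ∀ {n} → Graph n → ℕ → Target.Instance
  build {n} G k = record
    { n              = length (vertices {D} {n})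
    ; graph          = Gadget.graph (gadget (closedAdj G))
    ; k              = k
    ; representation = representation (closedAdj G)
    ; represents     = represents (closedAdj G)
    }

  encode-build : ∀ {n} (G : Graph n) k →
    enc Output (assemble (descs (matrix G) , ℕᵇ.fromℕ k)) ≡ Target.encode (build G k)
  encode-build {n} G k = trans
    (cong (λ xs → enc Output (assemble (xs , ℕᵇ.fromℕ k))) (descs-matrix G))
    (sym (cong₂ _∙_ encode-graph (cong (encodeℕ k ∙_)
      (trans (encode-rep (closedAdj G)) (cong (enc (list tree)) (map-∘ vs))))))
    where
      vs : List (Vertex D n)
      vs = vertices
      h : Vertex D n → El Desc
      h = desc (closedAdj G)
      encode-graph : encodeGraph (Gadget.graph (gadget (closedAdj G))) ≡
        enc Matrix (List.map (λ x → List.map (adjacent x) (List.map h vs)) (List.map h vs))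
      encode-graph = trans
        (encodeFamily-lookup vs (λ x → List.map (adjacent (h x)) (List.map h vs)) λ u → trans
          (encodeFamily-lookup vs (λ y → adjacent (h (vertex u)) (h y)) λ v →
            cong encodeBool (gadget-adj (closedAdj G) (vertex u) (vertex v)))
          (cong (enc (list bool)) (map-∘ vs)))
        (cong (enc Matrix) (map-∘ vs))

  emptyGraph : Graph 0
  emptyGraph = record { Adj = λ () ; adj? = λ () ; symm = λ {} ; irrefl = λ {} }

  reduce : GraphInstance → Target.Instance
  reduce x with GraphInstance.k x ≤? GraphInstance.n x
  ... | yes _ = build (GraphInstance.graph x) (GraphInstance.k x)
  ... | no _  = build emptyGraph (GraphInstance.k x)

  open ParameterizedProblem Source using (encode; Yes)

  reduce-k : ∀ x → Target.parameter (reduce x) ≡ GraphInstance.k x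
  reduce-k x with GraphInstance.k x ≤? GraphInstance.n x
  ... | yes _ = refl
  ... | no _  = refl

  no-vertices : (xs : List (Vertex D 0)) → length xs ≡ 0
  no-vertices []            = refl
  no-vertices (U () ∷ _)
  no-vertices (E () _ ∷ _)
  no-vertices (P _ () ∷ _)

  reduce-correct : ∀ x → Yes x ⇔ Target.Yes (reduce x)
  reduce-correct x with GraphInstance.k x ≤? GraphInstance.n x
  ... | yes k≤n = Reduction.correct (GraphInstance.graph x) (gadget _) k≤n
  -- Both sides fail for lack of vertices: `k` exceeds `n`, and the gadget of the empty graph has no
  -- vertices while `k` is positive.
  ... | no k≰n  = mk⇔
    (λ (S , ∣S∣≡k , _) → ⊥-elim (k≰n (subst (_≤ _) ∣S∣≡k (∣p∣≤n S))))
    (λ (S , ∣S∣≡k , _) → ⊥-elim (k≰n (≤-trans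
      (subst (_≤ _) ∣S∣≡k (∣p∣≤n S)) (≤-trans (≤-reflexive (no-vertices (vertices {D} {0}))) z≤n))))

  -- With the cap at `suc n`, a value above `n` is cut off to `suc n` and so is still recognized as
  -- too large.
  capped-fromℕ : ∀ n k → capped (suc n) (bits (ℕᵇ.fromℕ k)) ≡ suc n ⊓ k
  capped-fromℕ n k = trans (capped≡⊓ (suc n) (ℕᵇ.fromℕ k)) (cong (suc n ⊓_) (ℕᵇ.toℕ-fromℕ k))

  guard-yes : ∀ {n} (G : Graph n) {k} → k ≤ n → guard (matrix G , ℕᵇ.fromℕ k) ≡ matrix G
  guard-yes {n} G {k} k≤n = cong (if_then matrix G else []) (begin
    capped (suc (length (matrix G))) (bits (ℕᵇ.fromℕ k)) ≤ᵇ length (matrix G)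
      ≡⟨ cong (λ l → capped (suc l) (bits (ℕᵇ.fromℕ k)) ≤ᵇ l) (length-matrix G) ⟩
    capped (suc n) (bits (ℕᵇ.fromℕ k)) ≤ᵇ n
      ≡⟨ cong (_≤ᵇ n) (trans (capped-fromℕ n k) (m≥n⇒m⊓n≡n (m≤n⇒m≤1+n k≤n))) ⟩
    k ≤ᵇ n
      ≡⟨ dec-true (k ≤? n) k≤n ⟩
    true ∎)
    where open ≡-Reasoning

  guard-no : ∀ {n} (G : Graph n) {k} → ¬ (k ≤ n) → guard (matrix G , ℕᵇ.fromℕ k) ≡ []
  guard-no {n} G {k} k≰n = cong (if_then matrix G else []) (begin
    capped (suc (length (matrix G))) (bits (ℕᵇ.fromℕ k)) ≤ᵇ length (matrix G)
      ≡⟨ cong (λ l → capped (suc l) (bits (ℕᵇ.fromℕ k)) ≤ᵇ l) (length-matrix G) ⟩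
    capped (suc n) (bits (ℕᵇ.fromℕ k)) ≤ᵇ n
      ≡⟨ cong (_≤ᵇ n) (trans (capped-fromℕ n k) (m≤n⇒m⊓n≡m (≰⇒> k≰n))) ⟩
    suc n ≤ᵇ n
      ≡⟨ dec-false (suc n ≤? n) 1+n≰n ⟩
    false ∎)
    where open ≡-Reasoning

  output-correct : ∀ x → let open GraphInstance x in
    enc Output (output (matrix graph , ℕᵇ.fromℕ k)) ≡ Target.encode (reduce x)
  output-correct x with GraphInstance.k x ≤? GraphInstance.n x
  ... | yes k≤n = trans
    (cong (λ M → enc Output (assemble (descs M , ℕᵇ.fromℕ (GraphInstance.k x)))) (guard-yes (GraphInstance.graph x) k≤n))
    (encode-build (GraphInstance.graph x) (GraphInstance.k x))
  ... | no k≰n  = trans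
    (cong (λ M → enc Output (assemble (descs M , ℕᵇ.fromℕ (GraphInstance.k x)))) (guard-no (GraphInstance.graph x) k≰n))
    (encode-build emptyGraph (GraphInstance.k x))

  encode-input : ∀ x → let open GraphInstance x in
    encode x ≡ enc (Matrix ⊠ bin) (matrix graph , ℕᵇ.fromℕ k)
  encode-input x = cong (_∙ encodeℕ (GraphInstance.k x))
    (encodeFamily-tabulate {f = λ i j → does (adj? graph i j)}
      (λ i → encodeFamily-tabulate {f = λ j → does (adj? graph i j)} (λ j → refl)))
    where open GraphInstance x using (graph)

  hard-by : PolyTime (Matrix ⊠ bin) Output output → W[2]-Hard Target
  hard-by F = record
    { reduce       = reduce
    ; correct      = reduce-correct
    ; h            = id
    ; h-computable = var zero , λ n → _ , ⇓var zero
    ; parameter-≤  = λ x → ≤-reflexive (reduce-k x)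
    -- The running time is polynomial in the whole input, so `g` only has to supply the coefficient.
    ; g            = const c
    ; g-computable = quoteTree (encodeℕ c) , λ n →
        let t , d , _ = run-quote (encodeℕ c) in t , d
    ; degree       = e
    ; program      = code F zero
    ; runs         = λ x →
        let t , d , t≤ = run F (matrix (GraphInstance.graph x) , ℕᵇ.fromℕ (GraphInstance.k x)) (encode-input x)
        in t
         , subst (λ v → encode x ∷ [] ⊢ code F zero ⇓ v [ t ]) (output-correct x) d
         , ≤-trans t≤ (subst (λ v → ⟦ bound F ⟧ₚ (size v) ≤ c * size (encode x) ^ e)
             (encode-input x) (bounded (size (encode x)) (1≤size (encode x))))
    }
    where
      c e : ℕ
      c = proj₁ (polynomial-bound (bound F))
      e = proj₁ (proj₂ (polynomial-bound (bound F)))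
      bounded : ∀ s → 1 ≤ s → ⟦ bound F ⟧ₚ s ≤ c * s ^ e
      bounded = proj₂ (proj₂ (polynomial-bound (bound F)))

  hard : W[2]-Hard Target
  hard = hard-by output-poly

-- Unit two-track intervals

integer : ℕᵇ → ℚᵘ
integer x = mkℚᵘ (int (ℕᵇ.toℕ x)) 0

integer-mono : ∀ {x y} → ℕᵇ.toℕ x ≤ ℕᵇ.toℕ y → integer x ℚ.≤ integer y
integer-mono {x} {y} le = *≤* (subst₂ ℤ._≤_ (sym (ℤ.*-identityʳ (int (ℕᵇ.toℕ x))))
  (sym (ℤ.*-identityʳ (int (ℕᵇ.toℕ y)))) (ℤ.+≤+ le))

integer-cancel : ∀ {x y} → integer x ℚ.≤ integer y → ℕᵇ.toℕ x ≤ ℕᵇ.toℕ y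
integer-cancel {x} {y} (*≤* le) = ℤ.drop‿+≤+ (subst₂ ℤ._≤_ (ℤ.*-identityʳ (int (ℕᵇ.toℕ x)))
  (ℤ.*-identityʳ (int (ℕᵇ.toℕ y))) le)

-- The encoding of a natural number as a rational: positive sign, numerator `t`, denominator 1.
integerTree : Tree → Tree
integerTree t = (nil ∙ t) ∙ encodeℕ 1

encode-integer : ∀ x → encodeℚ (integer x) ≡ integerTree (encodeℕᵇ x)
encode-integer x = cong (λ y → integerTree (encodeℕᵇ y)) (ℕᵇ.fromℕ-toℕ x)

nodeP : ∀ {A f g} → PolyTime A tree f → PolyTime A tree g → PolyTime A tree (λ a → f a ∙ g a)
nodeP F G = cast (uncurry _∙_) (λ _ → refl) ∘P pair F G

treeP : ∀ {A} → PolyTime A tree (enc A)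
treeP {A} = cast (enc A) (λ _ → refl)

integerTreeP : ∀ {A f} → PolyTime A tree f → PolyTime A tree (λ a → integerTree (f a))
integerTreeP F = nodeP (nodeP (constP nil) F) (constP (encodeℕ 1))

falsesP : ∀ {A f} → PolyTime A nat f → PolyTime A (list bool) (λ a → replicate (f a) false)
falsesP F = cast (λ n → replicate n false) lemma ∘P F
  where
    lemma : ∀ n → enc nat n ≡ enc (list bool) (replicate n false)
    lemma zero    = refl
    lemma (suc n) = cong (nil ∙_) (lemma n)

T-xor : ∀ {a b} → T (a xor b) → (T a × ¬ T b) ⊎ (¬ T a × T b)
T-xor {false} {true}  _ = inj₂ (id , _)
T-xor {true}  {false} _ = inj₁ (_ , id)

xor-T : ∀ {a b} → (T a × ¬ T b) ⊎ (¬ T a × T b) → T (a xor b)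
xor-T {false} {false} (inj₁ (() , _))
xor-T {false} {false} (inj₂ (_ , ()))
xor-T {false} {true}  _ = _
xor-T {true}  {false} _ = _
xor-T {true}  {true}  (inj₁ (_ , ¬b)) = ¬b _
xor-T {true}  {true}  (inj₂ (¬a , _)) = ¬a _

⌊/2⌋-close : ∀ m n → ⌊ m /2⌋ ≡ ⌊ n /2⌋ → m ≤ suc n
⌊/2⌋-close zero          n             eq = z≤n
⌊/2⌋-close (suc zero)    n             eq = s≤s z≤n
⌊/2⌋-close (suc (suc m)) (suc (suc n)) eq = s≤s (s≤s (⌊/2⌋-close m n (suc-injective eq)))

halves-injective : ∀ {m n} → ⌊ m /2⌋ ≡ ⌊ n /2⌋ → ⌈ m /2⌉ ≡ ⌈ n /2⌉ → m ≡ n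
halves-injective {m} {n} p q = trans (sym (⌊n/2⌋+⌈n/2⌉≡n m)) (trans (cong₂ _+_ p q) (⌊n/2⌋+⌈n/2⌉≡n n))

-- The two-track graph is the line graph of a bipartite graph: a vertex
-- has a label on each track and equal labels mean equal unit intervals.
-- A label is a pair of a tag and an index.

Label : Set
Label = ℕ × ℕ

_≡ˡ_ : Label → Label → Bool
(s , i) ≡ˡ (t , j) = (s ≡ᵇ t) ∧ (i ≡ᵇ j)

T-≡ˡ : ∀ {x y} → T (x ≡ˡ y) ⇔ x ≡ y
T-≡ˡ {s , i} {t , j} = mk⇔
  (λ e → let p , q = Equivalence.to T-∧ e in cong₂ _,_ (≡ᵇ⇒≡ s t p) (≡ᵇ⇒≡ i j q))
  (λ { refl → Equivalence.from T-∧ (≡⇒≡ᵇ s s refl , ≡⇒≡ᵇ i i refl) })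

-- Tag and index in unary, separated by the only `true`. Read as digits they make a number
-- exponential in tag and index, whose encoding has linear length.
labelBits : Label → List Bool
labelBits (t , i) = replicate t false ++ true ∷ replicate i false

fromBits-injective : ∀ xs ys → fromBits xs ≡ fromBits ys → xs ≡ ys
fromBits-injective []           []           _  = refl
fromBits-injective []           (false ∷ _)  ()
fromBits-injective []           (true ∷ _)   ()
fromBits-injective (false ∷ _)  []           ()
fromBits-injective (true ∷ _)   []           ()
fromBits-injective (false ∷ xs) (true ∷ ys)  ()
fromBits-injective (true ∷ xs)  (false ∷ ys) ()
fromBits-injective (false ∷ xs) (false ∷ ys) eq =
  cong (false ∷_) (fromBits-injective xs ys (ℕᵇ.2[1+_]-injective eq))
fromBits-injective (true ∷ xs)  (true ∷ ys)  eq =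
  cong (true ∷_) (fromBits-injective xs ys (ℕᵇ.1+[2_]-injective eq))

labelBits-injective : ∀ x y → labelBits x ≡ labelBits y → x ≡ y
labelBits-injective (zero , i)  (zero , j)  eq = cong (0 ,_)
  (trans (sym (length-replicate i)) (trans (cong length (∷-injectiveʳ eq)) (length-replicate j)))
labelBits-injective (zero , i)  (suc t , j) ()
labelBits-injective (suc s , i) (zero , j)  ()
labelBits-injective (suc s , i) (suc t , j) eq
  with refl ← labelBits-injective (s , i) (t , j) (∷-injectiveʳ eq) = refl

labelNumber : Label → ℕᵇ
labelNumber x = fromBits (labelBits x)

-- For the number m of the label this is the interval from 2m + 1 to 2m + 2. Different labels are
-- thus kept apart by gaps, and each endpoint is m with one more digit in front of its lowest one.
labelInterval : Label → Interval
labelInterval x = record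
  { left       = integer 1+[2 labelNumber x ]
  ; right      = integer 2[1+ labelNumber x ]
  ; left≤right = integer-mono {1+[2 labelNumber x ]} {2[1+ labelNumber x ]}
      (*-monoʳ-< 2 (n<1+n (ℕᵇ.toℕ (labelNumber x))))
  }

label-unit : ∀ x → UnitLength (labelInterval x)
label-unit x = *≡* (trans (ℤ.*-identityʳ _) (begin
  int (2 * suc m) ℤ.* int 1 ℤ.+ (ℤ.- int (suc (2 * m))) ℤ.* int 1
    ≡⟨ cong₂ ℤ._+_ (ℤ.*-identityʳ (int (2 * suc m))) (ℤ.*-identityʳ (ℤ.- int (suc (2 * m)))) ⟩
  int (2 * suc m) ℤ.+ ℤ.- int (suc (2 * m))
    ≡⟨ cong (λ z → int z ℤ.+ ℤ.- int (suc (2 * m))) (*-suc 2 m) ⟩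
  int 1 ℤ.+ int (suc (2 * m)) ℤ.+ ℤ.- int (suc (2 * m))
    ≡⟨ ℤ.+-assoc (int 1) (int (suc (2 * m))) (ℤ.- int (suc (2 * m))) ⟩
  int 1 ℤ.+ (int (suc (2 * m)) ℤ.+ ℤ.- int (suc (2 * m)))
    ≡⟨ cong (ℤ._+_ ℤ.1ℤ) (ℤ.+-inverseʳ (int (suc (2 * m)))) ⟩
  int 1 ∎))
  where
    open ≡-Reasoning
    m : ℕ
    m = ℕᵇ.toℕ (labelNumber x)

-- A common point of the intervals of m and m′ gives 2m + 1 ≤ 2m′ + 2, hence m ≤ m′ by parity; the
-- converse is symmetric.
label-meet : ∀ x y → ⟦ labelInterval x ⟧ ≬ ⟦ labelInterval y ⟧ → x ≡ y
label-meet x y (_ , (l₁ , r₁) , (l₂ , r₂)) = labelBits-injective x y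
  (fromBits-injective _ _ (ℕᵇ.toℕ-injective
    (≤-antisym (half x y (ℚ.≤-trans l₁ r₂)) (half y x (ℚ.≤-trans l₂ r₁)))))
  where
    half : ∀ x y → left (labelInterval x) ℚ.≤ right (labelInterval y) →
           ℕᵇ.toℕ (labelNumber x) ≤ ℕᵇ.toℕ (labelNumber y)
    half x y le = ≤-pred (*-cancelˡ-< 2 _ _
      (integer-cancel {1+[2 labelNumber x ]} {2[1+ labelNumber y ]} le))

labelTree : Label → Tree
labelTree x = integerTree (encodeBool true ∙ enc (list bool) (labelBits x)) ∙
              integerTree (encodeBool false ∙ enc (list bool) (labelBits x))

encode-label : ∀ x → encodeInterval (labelInterval x) ≡ labelTree x
encode-label x = cong₂ _∙_
  (trans (encode-integer 1+[2 labelNumber x ])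
    (cong (λ t → integerTree (encodeBool true ∙ t)) (sym (enc-fromBits (labelBits x)))))
  (trans (encode-integer 2[1+ labelNumber x ])
    (cong (λ t → integerTree (encodeBool false ∙ t)) (sym (enc-fromBits (labelBits x)))))

-- The gadget on two tracks

module TwoTrack (D : ℕ) where

  Labels : Ty
  Labels = (nat ⊠ nat) ⊠ (nat ⊠ nat)

  labelTreeP : PolyTime (nat ⊠ nat) tree labelTree
  labelTreeP = nodeP (integerTreeP (nodeP (constP (encodeBool true)) bitsTree))
                     (integerTreeP (nodeP (constP (encodeBool false)) bitsTree))
    where
      bitsTree : PolyTime (nat ⊠ nat) tree (λ x → enc (list bool) (labelBits x))
      bitsTree = treeP ∘P appendP (falsesP fstP) (consP (constP true) (falsesP sndP))

  -- On track 1 the tag 0 joins `U i` to all `E i j`. On track 2 the tag 0 with index 0 makes the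
  -- `U i` a clique, the tag 2 joins `P zero j` to those `E i j` with `i` in the closed
  -- neighbourhood of `j`, and the tag 1 sets the other `E i j` aside. The paths use the tags
  -- `suc ⌊ m /2⌋` and `2 + ⌈ m /2⌉`.
  coding : Coding D
  coding = record
    { Desc     = Labels
    ; PathData = nat ⊠ nat
    ; descU    = λ _ i → (0 , i) , (0 , 0)
    ; descE    = λ _ b i j → (0 , i) , ((if b then 2 else 1) , j)
    ; descP    = λ _ (s , t) j → (suc s , j) , (2 + t , j)
    ; pathData = λ m → ⌊ toℕ m /2⌋ , ⌈ toℕ m /2⌉
    ; adjacent = λ (x₁ , x₂) (y₁ , y₂) → (x₁ ≡ˡ y₁) xor (x₂ ≡ˡ y₂)
    ; member   = λ (x₁ , x₂) → labelTree x₁ ∙ labelTree x₂ ∙ nil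
    ; descU-poly = pair (pair (constP 0) sndP) (constP (0 , 0))
    ; descE-poly = pair (pair (constP 0) (fstP ∘P sndP ∘P sndP))
        (pair (ifP snd₂P (constP 2) (constP 1)) (sndP ∘P sndP ∘P sndP))
    ; descP-poly = pair (pair (sucP (fstP ∘P snd₂P)) rest₂P)
        (pair (sucP (sucP (sndP ∘P snd₂P))) rest₂P)
    ; adjacent-poly = xorP (≡ˡP (fstP ∘P fstP) (fstP ∘P sndP)) (≡ˡP (sndP ∘P fstP) (sndP ∘P sndP))
    ; member-poly = nodeP (labelTreeP ∘P fstP) (nodeP (labelTreeP ∘P sndP) (constP nil))
    }
    where
      ≡ˡP : ∀ {A f g} → PolyTime A (nat ⊠ nat) f → PolyTime A (nat ⊠ nat) g →
            PolyTime A bool (λ a → f a ≡ˡ g a)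
      ≡ˡP F G = andP (≡ᵇP (fstP ∘P F) (fstP ∘P G)) (≡ᵇP (sndP ∘P F) (sndP ∘P G))

  module _ {n : ℕ} (cl : Fin n → Fin n → Bool) where

    labels : Vertex D n → Label × Label
    labels = Coding.desc coding cl

    label₁ label₂ : Vertex D n → Label
    label₁ = proj₁ ∘ labels
    label₂ = proj₂ ∘ labels

    equal₁-close : ∀ x y → label₁ x ≡ label₁ y → Close cl x y
    equal₁-close (U i)   (U i′)    eq = UU
    equal₁-close (U i)   (E i′ j)  eq with refl ← toℕ-injective (cong proj₂ eq) = UE
    equal₁-close (E i j) (U i′)    eq with refl ← toℕ-injective (cong proj₂ eq) = EU
    equal₁-close (E i j) (E i′ j′) eq with refl ← toℕ-injective (cong proj₂ eq) = row
    equal₁-close (P m j) (P m′ j′) eq with refl ← toℕ-injective (cong proj₂ eq) =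
      PP (⌊/2⌋-close _ _ (suc-injective (cong proj₁ eq)))
         (⌊/2⌋-close _ _ (sym (suc-injective (cong proj₁ eq))))

    tag≢0 : ∀ b → (if b then 2 else 1) ≢ 0
    tag≢0 false ()
    tag≢0 true  ()

    tag-injective : ∀ b b′ → (if b then 2 else 1) ≡ (if b′ then 2 else 1) → b ≡ b′
    tag-injective false false _ = refl
    tag-injective true  true  _ = refl

    tag≡2+ : ∀ b m → (if b then 2 else 1) ≡ 2 + ⌈ m /2⌉ → b ≡ true × m ≡ 0
    tag≡2+ true zero    _ = refl , refl
    tag≡2+ true (suc m) ()

    E-P-close : ∀ {i j j′} m → label₂ (E i j) ≡ label₂ (P m j′) → Close cl (E i j) (P m j′)
    E-P-close m eq with toℕ-injective (cong proj₂ eq) | tag≡2+ _ _ (cong proj₁ eq)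
    E-P-close zero eq | refl | t , _ = EP t

    equal₂-close : ∀ x y → label₂ x ≡ label₂ y → Close cl x y
    equal₂-close (U i)   (U i′)    eq = UU
    equal₂-close (U i)   (E i′ j)  eq = ⊥-elim (tag≢0 _ (sym (cong proj₁ eq)))
    equal₂-close (E i j) (U i′)    eq = ⊥-elim (tag≢0 _ (cong proj₁ eq))
    equal₂-close (E i j) (E i′ j′) eq with toℕ-injective (cong proj₂ eq)
    ... | refl = col (tag-injective _ _ (cong proj₁ eq))
    equal₂-close (E i j) (P m j′)  eq = E-P-close m eq
    equal₂-close (P m j′) (E i j)  eq = Close-sym (E-P-close m (sym eq))
    equal₂-close (P m j) (P m′ j′) eq with refl ← toℕ-injective (cong proj₂ eq) =
      PP (≤-pred (⌊/2⌋-close _ _ (suc-injective (suc-injective (cong proj₁ eq)))))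
         (≤-pred (⌊/2⌋-close _ _ (sym (suc-injective (suc-injective (cong proj₁ eq))))))

    -- Hence different vertices agree on at most one track, and the `xor` in the adjacency removes
    -- nothing but loops. For path vertices, the two rounded halves of `m` sum to `m`.
    labels-injective : ∀ x y → label₁ x ≡ label₁ y → label₂ x ≡ label₂ y → x ≡ y
    labels-injective (U i)   (U i′)    p q = cong U (toℕ-injective (cong proj₂ p))
    labels-injective (U i)   (E i′ j)  p q = ⊥-elim (tag≢0 _ (sym (cong proj₁ q)))
    labels-injective (E i j) (U i′)    p q = ⊥-elim (tag≢0 _ (cong proj₁ q))
    labels-injective (E i j) (E i′ j′) p q =
      cong₂ E (toℕ-injective (cong proj₂ p)) (toℕ-injective (cong proj₂ q))
    labels-injective (P m j) (P m′ j′) p q = cong₂ P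
      (toℕ-injective (halves-injective (suc-injective (cong proj₁ p))
        (suc-injective (suc-injective (cong proj₁ q)))))
      (toℕ-injective (cong proj₂ p))

    adjLabels : Vertex D n → Vertex D n → Bool
    adjLabels x y = (label₁ x ≡ˡ label₁ y) xor (label₂ x ≡ˡ label₂ y)

    OneEqual : Vertex D n → Vertex D n → Set
    OneEqual x y = (label₁ x ≡ label₁ y × label₂ x ≢ label₂ y) ⊎
                   (label₁ x ≢ label₁ y × label₂ x ≡ label₂ y)

    T-adjLabels : ∀ x y → T (adjLabels x y) ⇔ OneEqual x y
    T-adjLabels x y = mk⇔ (to ∘ T-xor) (xor-T ∘ from)
      where
        open Equivalence using () renaming (to to ⇒; from to ⇐)
        to : _ → OneEqual x y
        to (inj₁ (p , q)) = inj₁ (⇒ T-≡ˡ p , q ∘ ⇐ T-≡ˡ)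
        to (inj₂ (p , q)) = inj₂ (p ∘ ⇐ T-≡ˡ , ⇒ T-≡ˡ q)
        from : OneEqual x y → _
        from (inj₁ (p , q)) = inj₁ (⇐ T-≡ˡ p , q ∘ ⇒ T-≡ˡ)
        from (inj₂ (p , q)) = inj₂ (p ∘ ⇒ T-≡ˡ , ⇐ T-≡ˡ q)

    OneEqual-sym : ∀ {x y} → OneEqual x y → OneEqual y x
    OneEqual-sym (inj₁ (p , q)) = inj₁ (sym p , q ∘ sym)
    OneEqual-sym (inj₂ (p , q)) = inj₂ (p ∘ sym , sym q)

    OneEqual-irrefl : ∀ x → ¬ OneEqual x x
    OneEqual-irrefl x (inj₁ (_ , q)) = q refl
    OneEqual-irrefl x (inj₂ (p , _)) = p refl

    OneEqual-close : ∀ {x y} → OneEqual x y → Close cl x y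
    OneEqual-close (inj₁ (p , _)) = equal₁-close _ _ p
    OneEqual-close (inj₂ (_ , q)) = equal₂-close _ _ q

    -- From `m` to `suc m` exactly one of the two rounded halves grows, so consecutive path vertices
    -- share a label, on alternating tracks.
    path-OneEqual : ∀ m → (⌊ m /2⌋ ≡ ⌊ suc m /2⌋ × ⌈ m /2⌉ ≢ ⌈ suc m /2⌉) ⊎
                          (⌊ m /2⌋ ≢ ⌊ suc m /2⌋ × ⌈ m /2⌉ ≡ ⌈ suc m /2⌉)
    path-OneEqual zero          = inj₁ (refl , λ ())
    path-OneEqual (suc zero)    = inj₂ ((λ ()) , refl)
    path-OneEqual (suc (suc m)) with path-OneEqual m
    ... | inj₁ (p , q) = inj₁ (cong suc p , q ∘ suc-injective)
    ... | inj₂ (p , q) = inj₂ (p ∘ suc-injective , cong suc q)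

    gadget : Gadget D cl
    gadget = record
      { adj    = adjLabels
      ; symm   = λ x y → from y x ∘ OneEqual-sym {x} {y} ∘ to x y
      ; irrefl = λ x → OneEqual-irrefl x ∘ to x x
      ; close  = λ x y → OneEqual-close {x} {y} ∘ to x y
      ; adj-UU = λ {i} {i′} i≢i′ → from (U i) (U i′)
          (inj₂ (i≢i′ ∘ toℕ-injective ∘ cong proj₂ , refl))
      ; adj-UE = λ i j → from (U i) (E i j) (inj₁ (refl , tag≢0 _ ∘ sym ∘ cong proj₁))
      ; adj-EP = λ {i} {j} c → from (E i j) (P zero j)
          (inj₂ ((λ ()) , cong (λ b → (if b then 2 else 1) , toℕ j) (Equivalence.to T-≡ c)))
      ; adj-PP = λ {m} {m′} {j} eq → from (P m j) (P m′ j) (path m m′ j eq)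
      }
      where
        to : ∀ x y → T (adjLabels x y) → OneEqual x y
        to x y = Equivalence.to (T-adjLabels x y)
        from : ∀ x y → OneEqual x y → T (adjLabels x y)
        from x y = Equivalence.from (T-adjLabels x y)
        path : ∀ m m′ j → toℕ m′ ≡ suc (toℕ m) → OneEqual (P m j) (P m′ j)
        path m m′ j eq rewrite eq with path-OneEqual (toℕ m)
        ... | inj₁ (p , q) = inj₁ (cong (λ s → suc s , toℕ j) p , q ∘ suc-injective ∘ suc-injective ∘ cong proj₁)
        ... | inj₂ (p , q) = inj₂ (p ∘ suc-injective ∘ cong proj₁ , cong (λ s → 2 + s , toℕ j) q)

    labelAt : Fin 2 → Vertex D n → Label
    labelAt zero       = label₁
    labelAt (suc zero) = label₂

    twoTrack : Vertex D n → UnitTwoTrackInterval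
    twoTrack x = record
      { track = λ τ → labelInterval (labelAt τ x)
      ; unit  = λ τ → label-unit (labelAt τ x)
      }

    meet⇔ : ∀ x y → (UnitTwoTrackInterval.points (twoTrack x) ≬ UnitTwoTrackInterval.points (twoTrack y)) ⇔
                    (∃[ τ ] labelAt τ x ≡ labelAt τ y)
    meet⇔ x y = mk⇔
      (λ ((τ , q) , p₁ , p₂) → τ , label-meet (labelAt τ x) (labelAt τ y) (q , p₁ , p₂))
      (λ (τ , eq) → (τ , left (labelInterval (labelAt τ x))) ,
        (ℚ.≤-refl , left≤right (labelInterval (labelAt τ x))) ,
        subst (λ l → left (labelInterval l) ℚ.≤ left (labelInterval (labelAt τ x)) ×
                     left (labelInterval (labelAt τ x)) ℚ.≤ right (labelInterval l))
          eq (ℚ.≤-refl , left≤right (labelInterval (labelAt τ x))))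

    represents : IsIntersectionGraph (UnitTwoTrackInterval.points ∘ twoTrack ∘ vertex) (Gadget.graph gadget)
    represents u v = mk⇔ to from
      where
        x y : Vertex D n
        x = vertex u
        y = vertex v
        to : T (adjLabels x y) → _
        to t = (λ { refl → Gadget.irrefl gadget x t }) , Equivalence.from (meet⇔ x y) (which (Equivalence.to (T-adjLabels x y) t))
          where
            which : OneEqual x y → ∃[ τ ] labelAt τ x ≡ labelAt τ y
            which (inj₁ (p , _)) = zero , p
            which (inj₂ (_ , q)) = suc zero , q
        from : _ → T (adjLabels x y)
        from (u≢v , meet) = Equivalence.from (T-adjLabels x y) (one (Equivalence.to (meet⇔ x y) meet))
          where
            x≢y : x ≢ y
            x≢y = u≢v ∘ lookup-injective (vertices-unique {D} {n}) u v
            one : (∃[ τ ] labelAt τ x ≡ labelAt τ y) → OneEqual x y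
            one (zero , p)     = inj₁ (p , x≢y ∘ labels-injective x y p)
            one (suc zero , q) = inj₂ ((λ p → x≢y (labels-injective x y p q)) , q)

  construction : Construction D unitTwoTrackIntervalGraphs
  construction = record
    { coding         = coding
    ; gadget         = gadget
    ; gadget-adj     = λ cl x y → refl
    ; representation = λ cl → twoTrack cl ∘ vertex
    ; encode-rep     = λ cl → encodeFamily-lookup {B = tree} vertices (Coding.member coding ∘ labels cl)
        (λ u → cong₂ (λ s t → s ∙ t ∙ nil) (encode-label (label₁ cl (vertex u))) (encode-label (label₂ cl (vertex u))))
    ; represents     = represents
    }

-- Complements of multiple intervals

-- The position p is realized by the number 2 ^ (p + 1) − 2, whose binary
-- encoding is the unary encoding of p.

evens : ℕ → ℕᵇ
evens zero    = ℕᵇ.zero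
evens (suc p) = 2[1+ evens p ]

encode-evens : ∀ p → encodeℕᵇ (evens p) ≡ unary p
encode-evens zero    = refl
encode-evens (suc p) = cong (nil ∙_) (encode-evens p)

evens-mono : ∀ {p q} → p ≤ q → ℕᵇ.toℕ (evens p) ≤ ℕᵇ.toℕ (evens q)
evens-mono z≤n       = z≤n
evens-mono (s≤s p≤q) = *-monoʳ-≤ 2 (s≤s (evens-mono p≤q))

evens-cancel : ∀ p q → ℕᵇ.toℕ (evens p) ≤ ℕᵇ.toℕ (evens q) → p ≤ q
evens-cancel zero    q       le = z≤n
evens-cancel (suc p) (suc q) le = s≤s (evens-cancel p q (≤-pred (*-cancelˡ-≤ 2 le)))

realize : ℕ → ℚᵘ
realize p = integer (evens p)

realize-mono : ∀ {p q} → p ≤ q → realize p ℚ.≤ realize q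
realize-mono {p} {q} p≤q = integer-mono {evens p} {evens q} (evens-mono p≤q)

realize-cancel : ∀ {p q} → realize p ℚ.≤ realize q → p ≤ q
realize-cancel {p} {q} le = evens-cancel p q (integer-cancel {evens p} {evens q} le)

encode-realize : ∀ p → encodeℚ (realize p) ≡ integerTree (unary p)
encode-realize p = trans (encode-integer (evens p)) (cong integerTree (encode-evens p))

-- Finite unions of intervals between natural positions

Piece : Set
Piece = ℕ × ℕ

pt : ℕ → Piece
pt p = p , p

Overlap Separated : Piece → Piece → Set
Overlap (a , b) (c , d)   = a ≤ d × c ≤ b
Separated (a , b) (c , d) = b < c ⊎ d < a

separated : ∀ {I J} → Separated I J → ¬ Overlap I J
separated (inj₁ b<c) (_ , c≤b) = <⇒≱ b<c c≤b
separated (inj₂ d<a) (a≤d , _) = <⇒≱ d<a a≤d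

record Meet {s t} (v : Vec Piece s) (w : Vec Piece t) : Set where
  constructor overlapping
  field
    i       : Fin s
    j       : Fin t
    common  : Overlap (lookup v i) (lookup w j)

Meet-sym : ∀ {s t} {v : Vec Piece s} {w : Vec Piece t} → Meet v w → Meet w v
Meet-sym (overlapping i j (p , q)) = overlapping j i (q , p)

infix 4 _∈ₚ_

record _∈ₚ_ {t} (p : ℕ) (v : Vec Piece t) : Set where
  constructor in-piece
  field
    i     : Fin t
    lower : proj₁ (lookup v i) ≤ p
    upper : p ≤ proj₂ (lookup v i)

meet-at : ∀ {s t} {v : Vec Piece s} {w : Vec Piece t} p → p ∈ₚ v → p ∈ₚ w → Meet v w
meet-at p (in-piece i a≤p p≤b) (in-piece j c≤p p≤d) =
  overlapping i j (≤-trans a≤p p≤d , ≤-trans c≤p p≤b)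

overlapᵇ : Piece → Piece → Bool
overlapᵇ (a , b) (c , d) = (a ≤ᵇ d) ∧ (c ≤ᵇ b)

meetᵇ : List Piece → List Piece → Bool
meetᵇ xs ys = any (λ I → any (λ J → overlapᵇ I J) ys) xs

T-any : ∀ {A : Set} {t} (f : A → Bool) (v : Vec A t) → T (any f (toList v)) ⇔ (∃[ i ] T (f (lookup v i)))
T-any f v = mk⇔ (to v) (λ (i , t) → from v i t)
  where
    to : ∀ {t} (v : Vec _ t) → T (any f (toList v)) → ∃[ i ] T (f (lookup v i))
    to (x ∷ v) t with Equivalence.to (T-∨ {f x}) t
    ... | inj₁ t = zero , t
    ... | inj₂ t = let i , t = to v t in suc i , t
    from : ∀ {t} (v : Vec _ t) i → T (f (lookup v i)) → T (any f (toList v))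
    from (x ∷ v) zero    t = Equivalence.from (T-∨ {f x}) (inj₁ t)
    from (x ∷ v) (suc i) t = Equivalence.from (T-∨ {f x}) (inj₂ (from v i t))

T-overlapᵇ : ∀ I J → T (overlapᵇ I J) ⇔ Overlap I J
T-overlapᵇ (a , b) (c , d) = mk⇔
  (λ t → let p , q = Equivalence.to T-∧ t in ≤ᵇ⇒≤ a d p , ≤ᵇ⇒≤ c b q)
  (λ (p , q) → Equivalence.from T-∧ (≤⇒≤ᵇ p , ≤⇒≤ᵇ q))

T-meetᵇ : ∀ {s t} (v : Vec Piece s) (w : Vec Piece t) → T (meetᵇ (toList v) (toList w)) ⇔ Meet v w
T-meetᵇ v w = mk⇔
  (λ t → let i , t = ⇒ (T-any _ v) t
             j , t = ⇒ (T-any _ w) t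
         in overlapping i j (⇒ (T-overlapᵇ _ _) t))
  (λ (overlapping i j o) → ⇐ (T-any _ v) (i , ⇐ (T-any _ w) (j , ⇐ (T-overlapᵇ _ _) o)))
  where open Equivalence using () renaming (to to ⇒; from to ⇐)

T-not : ∀ {b} → T (not b) ⇔ (¬ T b)
T-not {false} = mk⇔ (λ _ ()) _
T-not {true}  = mk⇔ (λ ()) (λ ¬t → ¬t _)

Proper Apart : ∀ {t} → Vec Piece t → Set
Proper v = ∀ i → proj₁ (lookup v i) ≤ proj₂ (lookup v i)
Apart v  = ∀ i j → i ≢ j → ¬ Overlap (lookup v i) (lookup v j)

apart₃ : ∀ {I J K} → Separated I J → Separated I K → Separated J K → Apart (I ∷ J ∷ K ∷ [])
apart₃ p q r zero             zero             i≢j = contradiction refl i≢j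
apart₃ p q r zero             (suc zero)       i≢j = separated p
apart₃ p q r zero             (suc (suc zero)) i≢j = separated q
apart₃ p q r (suc zero)       zero             i≢j (x , y) = separated p (y , x)
apart₃ p q r (suc zero)       (suc zero)       i≢j = contradiction refl i≢j
apart₃ p q r (suc zero)       (suc (suc zero)) i≢j = separated r
apart₃ p q r (suc (suc zero)) zero             i≢j (x , y) = separated q (y , x)
apart₃ p q r (suc (suc zero)) (suc zero)       i≢j (x , y) = separated r (y , x)
apart₃ p q r (suc (suc zero)) (suc (suc zero)) i≢j = contradiction refl i≢j

-- The line is divided into regions of width 2n + 2: the j-th mark of a
-- region has offset 2j + 1, and even offsets separate the marks.  The
-- definitions are opaque to make their arguments inferable.

opaque

  even : ℕ → ℕ
  even i = i + i

odd : ℕ → ℕ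
odd i = suc (even i)

opaque
  unfolding even

  2+even≤ : ∀ {i n} → i < n → 2 + even i ≤ even n
  2+even≤ {i} i<n = ≤-trans (≤-reflexive (cong suc (sym (+-suc i i)))) (+-mono-≤ i<n i<n)

  even≢odd : ∀ i j → even i ≢ odd j
  even≢odd (suc i) zero    eq rewrite +-suc i i with () ← eq
  even≢odd (suc i) (suc j) eq rewrite +-suc i i | +-suc j j =
    even≢odd i j (suc-injective (suc-injective eq))

  even-injective : ∀ {i j} → even i ≡ even j → i ≡ j
  even-injective {i} {j} eq with <-cmp i j
  ... | tri< i<j _ _ = contradiction eq (<⇒≢ (≤-trans (n≤1+n _) (2+even≤ i<j)))
  ... | tri≈ _ i≡j _ = i≡j
  ... | tri> _ _ j<i = contradiction (sym eq) (<⇒≢ (≤-trans (n≤1+n _) (2+even≤ j<i)))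

  n≤even : ∀ n → n ≤ even n
  n≤even n = m≤m+n n n

  evenP : ∀ {A f} → PolyTime A nat f → PolyTime A nat (λ a → even (f a))
  evenP F = addP F F

width : ℕ → ℕ
width n = 2 + even n

opaque

  pos : ℕ → ℕ → ℕ → ℕ
  pos n r x = r * width n + x

opaque
  unfolding pos

  posP : ∀ {A n r x} → PolyTime A nat n → PolyTime A nat r → PolyTime A nat x →
         PolyTime A nat (λ a → pos (n a) (r a) (x a))
  posP N R Y = addP (mulP R (sucP (sucP (evenP N)))) Y

  pos-< : ∀ {n r r′ x y} → r < r′ → x < width n → pos n r x < pos n r′ y
  pos-< {n} {r} {r′} {x} {y} r<r′ x<w = begin-strict
    r * width n + x       <⟨ +-monoʳ-< (r * width n) x<w ⟩
    r * width n + width n ≡⟨ +-comm (r * width n) (width n) ⟩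
    suc r * width n       ≤⟨ *-monoˡ-≤ (width n) r<r′ ⟩
    r′ * width n          ≤⟨ m≤m+n _ y ⟩
    r′ * width n + y      ∎
    where open ≤-Reasoning

  pos-mono-≤ : ∀ {n r r′ x y} → r ≤ r′ → x ≤ y → pos n r x ≤ pos n r′ y
  pos-mono-≤ {n} r≤r′ x≤y = +-mono-≤ (*-monoˡ-≤ (width n) r≤r′) x≤y

  pos-mono-< : ∀ {n r x y} → x < y → pos n r x < pos n r y
  pos-mono-< {n} {r} = +-monoʳ-< (r * width n)

  pos-injective-offset : ∀ {n r x y} → pos n r x ≡ pos n r y → x ≡ y
  pos-injective-offset {n} {r} = +-cancelˡ-≡ (r * width n) _ _

pos-≤ : ∀ {n r x y} → x ≤ y → pos n r x ≤ pos n r y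
pos-≤ {r = r} = pos-mono-≤ (≤-refl {r})

pos-injective : ∀ {n r r′ x y} → x < width n → y < width n → pos n r x ≡ pos n r′ y → r ≡ r′ × x ≡ y
pos-injective {r = r} {r′} x<w y<w eq with <-cmp r r′
... | tri< r<r′ _ _ = contradiction eq (<⇒≢ (pos-< r<r′ x<w))
... | tri≈ _ refl _ = refl , pos-injective-offset eq
... | tri> _ _ r′<r = contradiction (sym eq) (<⇒≢ (pos-< r′<r y<w))

module _ {n : ℕ} where

  odd<width : ∀ {i} → i < n → odd i < width n
  odd<width i<n = m≤n⇒m≤1+n (≤-trans (2+even≤ i<n) (n≤1+n _))

  even<width : ∀ {i} → i < n → even i < width n
  even<width i<n = ≤-trans (n≤1+n _) (odd<width i<n)

  last<width : suc (even n) < width n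
  last<width = ≤-refl

  2+even≤last : ∀ {i} → i < n → 2 + even i ≤ suc (even n)
  2+even≤last i<n = m≤n⇒m≤1+n (2+even≤ i<n)

split-at-mark : ∀ j x → x ≤ even j ⊎ x ≡ odd j ⊎ 2 + even j ≤ x
split-at-mark j x with <-cmp x (odd j)
... | tri< (s≤s x≤) _ _ = inj₁ x≤
... | tri≈ _ eq _       = inj₂ (inj₁ eq)
... | tri> _ _ x>       = inj₂ (inj₂ x>)

-- Levels of the paths

Level : Set
Level = Bool × ℕ

next : Level → Level
next (false , s) = true , s
next (true , s)  = false , suc s

-- The parity of `m` (`true` for odd) and its half rounded down, by iteration, so that the step from
-- `m` to `suc m` is a case distinction on `next`.
level : ℕ → Level
level zero    = false , 0
level (suc m) = next (level m)

index-of : Level → ℕ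
index-of (b , s) = (if b then 1 else 0) + (s + s)

index-level : ∀ m → index-of (level m) ≡ m
index-level zero    = refl
index-level (suc m) = trans (index-next (level m)) (cong suc (index-level m))
  where
    index-next : ∀ l → index-of (next l) ≡ suc (index-of l)
    index-next (false , s) = refl
    index-next (true , s)  = cong suc (+-suc s s)

-- Even levels have their marks in the regions 1, 2, … and cover an initial
-- part of the regions c, c + 1, … except for a gap; odd levels vice versa.
-- Region 0 holds the marks of the vertices U i, which also occupy points of
-- region c.  The k-th extra piece lies in region Z + k.

module CoInterval (D extra : ℕ) where

  -- Even levels have their marks in regions up to `1 + D`, left of region `c`; covers and marks to
  -- the right of it stay below region `c + c`.
  c Z : ℕ
  c = 2 + D
  Z = c + c

  -- The first region covered, the last one, which contains the gap, and the region of the own mark.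
  -- The gap of every level but the lowest lies in the region of the marks of the level before.
  regions : Level → ℕ × ℕ × ℕ
  regions (false , s) = c , c + s , 1 + s
  regions (true , s)  = 0 , 1 + s , c + suc s

  -- Extra pieces must differ along the prescribed edges. The offsets alternate along a path and
  -- start with 1, since `E i j` has the offset 0; the `U i` use offsets from 2 on.
  levelOffset : Level → ℕ
  levelOffset (false , s) = 1
  levelOffset (true , s)  = 0

  mainU : ℕ → ℕ → Vec Piece 3
  mainU n i = pt (pos n 0 (odd i)) ∷ pt (pos n c (even i)) ∷ pt (pos n c (odd i)) ∷ []

  -- The gap in region 0 is the mark of `U i`. If `b` holds, the mark of `P zero j` in region 1 is a
  -- gap too; otherwise the third piece starts at that mark, right after the second, so that there
  -- are three disjoint pieces in both cases. They reach up to region `1 + D` to cover the marks of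
  -- all even levels.
  mainE : ℕ → Bool → ℕ → ℕ → Vec Piece 3
  mainE n b i j =
    (pos n 0 0 , pos n 0 (even i)) ∷
    (pos n 0 (2 + even i) , pos n 1 (even j)) ∷
    (pos n 1 ((if b then 2 else 1) + even j) , pos n (1 + D) (suc (even n))) ∷ []

  mainP : ℕ → ℕ × ℕ × ℕ → ℕ → Vec Piece 3
  mainP n (a , r , q) j =
    (pos n a 0 , pos n r (even j)) ∷
    (pos n r (2 + even j) , pos n r (suc (even n))) ∷
    pt (pos n q (odd j)) ∷ []

  -- A multiple interval has an exact number of disjoint pieces, so a larger number is reached by
  -- adding points. New intersections only remove edges, which respects the upper bound `Close`.
  withExtras : ∀ e → ℕ → ℕ → Vec Piece 3 → Vec Piece (e + 3)
  withExtras zero    n w v = v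
  withExtras (suc e) n w v = pt (pos n (Z + e) w) ∷ withExtras e n w v

  pieceTree : Piece → Tree
  pieceTree (a , b) = integerTree (unary a) ∙ integerTree (unary b)

  coding : Coding D
  coding = record
    { Desc     = list (nat ⊠ nat)
    ; PathData = nat ⊠ nat ⊠ nat ⊠ nat
    ; descU    = λ n i → toList (withExtras extra n (2 + i) (mainU n i))
    ; descE    = λ n b i j → toList (withExtras extra n 0 (mainE n b i j))
    ; descP    = λ n (w , l) j → toList (withExtras extra n w (mainP n l j))
    ; pathData = λ m → levelOffset (level (toℕ m)) , regions (level (toℕ m))
    ; adjacent = λ xs ys → not (meetᵇ xs ys)
    ; member   = λ xs → enc (list tree) (List.map pieceTree xs)
    ; descU-poly = withExtrasP extra (λ (n , i) → mainU n i) fstP (addP (constP 2) sndP)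
        (consP (ptP (posP fstP (constP 0) (oddP sndP)))
          (consP (ptP (posP fstP (constP c) (evenP sndP)))
            (consP (ptP (posP fstP (constP c) (oddP sndP))) (constP []))))
    ; descE-poly = withExtrasP extra (λ (n , b , i , j) → mainE n b i j) fstP (constP 0) mainEP
    ; descP-poly = withExtrasP extra (λ (n , (_ , l) , j) → mainP n l j) fstP (fstP ∘P snd₂P)
        (consP (pair (posP fstP (fstP ∘P lP) (constP 0)) (posP fstP (fstP ∘P sndP ∘P lP) (evenP rest₂P)))
          (consP (pair (posP fstP (fstP ∘P sndP ∘P lP) (addP (constP 2) (evenP rest₂P)))
                       (posP fstP (fstP ∘P sndP ∘P lP) (oddP fstP)))
            (consP (ptP (posP fstP (sndP ∘P sndP ∘P lP) (oddP rest₂P))) (constP []))))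
    ; adjacent-poly = notP (anyP (anyP overlapP (sndP ∘P sndP)) fstP)
    ; member-poly   = treeP ∘P mapP (nodeP (integerTreeP (treeP ∘P fstP ∘P fstP))
                                           (integerTreeP (treeP ∘P sndP ∘P fstP))) idP
    }
    where
      oddP : ∀ {A f} → PolyTime A nat f → PolyTime A nat (λ a → odd (f a))
      oddP F = sucP (evenP F)
      ptP : ∀ {A f} → PolyTime A nat f → PolyTime A (nat ⊠ nat) (λ a → pt (f a))
      ptP F = pair F F
      withExtrasP : ∀ {A n w} e (v : El A → Vec Piece 3) → PolyTime A nat n → PolyTime A nat w →
        PolyTime A (list (nat ⊠ nat)) (λ a → toList (v a)) →
        PolyTime A (list (nat ⊠ nat)) (λ a → toList (withExtras e (n a) (w a) (v a)))
      withExtrasP zero    v N W V = V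
      withExtrasP (suc e) v N W V = consP (ptP (posP N (constP (Z + e)) W)) (withExtrasP e v N W V)
      lP : PolyTime (nat ⊠ (nat ⊠ nat ⊠ nat ⊠ nat) ⊠ nat) (nat ⊠ nat ⊠ nat) (λ (_ , (_ , l) , _) → l)
      lP = sndP ∘P snd₂P
      overlapP : PolyTime ((nat ⊠ nat) ⊠ (nat ⊠ nat) ⊠ (list (nat ⊠ nat) ⊠ list (nat ⊠ nat))) bool
        (λ (J , I , _) → overlapᵇ I J)
      overlapP = andP (≤ᵇP (fstP ∘P snd₂P) (sndP ∘P fstP)) (≤ᵇP (fstP ∘P fstP) (sndP ∘P snd₂P))
      mainEP : PolyTime (nat ⊠ bool ⊠ nat ⊠ nat) (list (nat ⊠ nat))
        (λ (n , b , i , j) → toList (mainE n b i j))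
      mainEP =
        consP (pair (posP fstP (constP 0) (constP 0)) (posP fstP (constP 0) (evenP i)))
          (consP (pair (posP fstP (constP 0) (addP (constP 2) (evenP i))) (posP fstP (constP 1) (evenP j)))
            (consP (pair (posP fstP (constP 1) (addP (ifP snd₂P (constP 2) (constP 1)) (evenP j)))
                         (posP fstP (constP (1 + D)) (oddP fstP)))
              (constP [])))
        where
          i : PolyTime (nat ⊠ bool ⊠ nat ⊠ nat) nat (λ (_ , _ , i , _) → i)
          i = fstP ∘P rest₂P
          j : PolyTime (nat ⊠ bool ⊠ nat ⊠ nat) nat (λ (_ , _ , _ , j) → j)
          j = sndP ∘P rest₂P

  -- Extra pieces, and vertices that must meet

  module _ {n : ℕ} where

    Below : ℕ → ∀ {t} → Vec Piece t → Set
    Below r v = ∀ i → proj₂ (lookup v i) < pos n r 0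

    Below-mono : ∀ {r r′ t} {v : Vec Piece t} → r ≤ r′ → Below r v → Below r′ v
    Below-mono r≤r′ below i = ≤-trans (below i) (pos-mono-≤ r≤r′ ≤-refl)

    withExtras-below : ∀ e {w v} → w < width n → Below Z v → Below (Z + e) (withExtras e n w v)
    withExtras-below zero {v = v} w< below i = Below-mono {v = v} (m≤m+n Z 0) below i
    withExtras-below (suc e) w<  below zero    = pos-< (≤-reflexive (sym (+-suc Z e))) w<
    withExtras-below (suc e) {w} {v} w<  below (suc i) =
      Below-mono {v = withExtras e n w v} (+-monoʳ-≤ Z (n≤1+n e)) (withExtras-below e w< below) i

    withExtras-proper : ∀ e {w v} → Proper v → Proper (withExtras e n w v)
    withExtras-proper zero    proper i       = proper i
    withExtras-proper (suc e) proper zero    = ≤-refl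
    withExtras-proper (suc e) proper (suc i) = withExtras-proper e proper i

    withExtras-apart : ∀ e {w v} → w < width n → Below Z v → Apart v → Apart (withExtras e n w v)
    withExtras-apart zero    w< below apart i       j       i≢j = apart i j i≢j
    withExtras-apart (suc e) w< below apart zero    zero    i≢j = contradiction refl i≢j
    withExtras-apart (suc e) w< below apart zero    (suc j) i≢j (p , _) =
      <⇒≱ (withExtras-below e w< below j) (≤-trans (pos-≤ {r = Z + e} z≤n) p)
    withExtras-apart (suc e) w< below apart (suc i) zero    i≢j (_ , p) =
      <⇒≱ (withExtras-below e w< below i) (≤-trans (pos-≤ {r = Z + e} z≤n) p)
    withExtras-apart (suc e) w< below apart (suc i) (suc j) i≢j =
      withExtras-apart e w< below apart i j (i≢j ∘ cong suc)

    lookup-main : ∀ e {w v} i → lookup (withExtras e n w v) (e ↑ʳ i) ≡ lookup v i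
    lookup-main zero    i = refl
    lookup-main (suc e) i = lookup-main e i

    Meet-withExtras : ∀ e {w w′ v v′} → Meet v v′ → Meet (withExtras e n w v) (withExtras e n w′ v′)
    Meet-withExtras e {w} {w′} {v} {v′} (overlapping i j o) = overlapping (e ↑ʳ i) (e ↑ʳ j)
      (subst₂ Overlap (sym (lookup-main e {w} {v} i)) (sym (lookup-main e {w′} {v′} j)) o)

    -- Equal offsets would make two vertices meet in an extra piece, whatever their main pieces are.
    ¬Meet-withExtras : ∀ e {w w′ v v′} → w < width n → w′ < width n → w ≢ w′ → Below Z v → Below Z v′ →
      ¬ Meet v v′ → ¬ Meet (withExtras e n w v) (withExtras e n w′ v′)
    ¬Meet-withExtras zero w< w′< w≢w′ below below′ ¬meet = ¬meet
    ¬Meet-withExtras (suc e) w< w′< w≢w′ below below′ ¬meet (overlapping zero zero (p , q)) =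
      w≢w′ (proj₂ (pos-injective {r = Z + e} w< w′< (≤-antisym p q)))
    ¬Meet-withExtras (suc e) w< w′< w≢w′ below below′ ¬meet (overlapping zero (suc j) (p , q)) =
      <⇒≱ (withExtras-below e w′< below′ j) (≤-trans (pos-≤ {r = Z + e} z≤n) p)
    ¬Meet-withExtras (suc e) w< w′< w≢w′ below below′ ¬meet (overlapping (suc i) zero (p , q)) =
      <⇒≱ (withExtras-below e w< below i) (≤-trans (pos-≤ {r = Z + e} z≤n) q)
    ¬Meet-withExtras (suc e) w< w′< w≢w′ below below′ ¬meet (overlapping (suc i) (suc j) o) =
      ¬Meet-withExtras e w< w′< w≢w′ below below′ ¬meet (overlapping i j o)

    ¬Meet₃ : ∀ {v w : Vec Piece 3} → (∀ i j → Separated (lookup v i) (lookup w j)) → ¬ Meet v w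
    ¬Meet₃ sep (overlapping i j o) = separated (sep i j) o

    ∈P-cover : ∀ {a r q j ρ x} → a ≤ ρ → ρ ≤ r → x < width n → (ρ ≡ r → x ≢ odd j) →
               pos n ρ x ∈ₚ mainP n (a , r , q) j
    ∈P-cover {a} {r} {j = j} {ρ} {x} a≤ρ ρ≤r x< avoid = cover (m≤n⇒m<n∨m≡n ρ≤r)
      where
        a0≤ : pos n a 0 ≤ pos n ρ x
        a0≤ = pos-mono-≤ a≤ρ z≤n
        cover : ρ < r ⊎ ρ ≡ r → pos n ρ x ∈ₚ mainP n (a , r , _) j
        cover (inj₁ ρ<r)  = in-piece zero a0≤ (<⇒≤ (pos-< ρ<r x<))
        cover (inj₂ refl) with split-at-mark j x
        ... | inj₁ x≤         = in-piece zero a0≤ (pos-≤ x≤)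
        ... | inj₂ (inj₁ eq)  = contradiction eq (avoid refl)
        ... | inj₂ (inj₂ 2+≤) = in-piece (suc zero) (pos-≤ 2+≤) (pos-≤ (≤-pred x<))

    ∈P-mark : ∀ {a r q j} → pos n q (odd j) ∈ₚ mainP n (a , r , q) j
    ∈P-mark = in-piece (suc (suc zero)) ≤-refl ≤-refl

    mark≤last : ∀ b {j} → j < n → (if b then 2 else 1) + even j ≤ suc (even n)
    mark≤last false j<n = ≤-trans (n≤1+n _) (2+even≤last j<n)
    mark≤last true  j<n = 2+even≤last j<n

    even<mark : ∀ b j → even j < (if b then 2 else 1) + even j
    even<mark false j = ≤-refl
    even<mark true  j = n≤1+n _

    ∈E-cover : ∀ {b i j ρ x} → i < n → j < n → ρ ≤ 1 + D → x < width n → (ρ ≡ 0 → x ≢ odd i) →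
               (ρ ≡ 1 → b ≡ true → x ≢ odd j) → pos n ρ x ∈ₚ mainE n b i j
    ∈E-cover {i = i} {ρ = zero} {x} i<n j<n ρ≤ x< avoid _ with split-at-mark i x
    ... | inj₁ x≤         = in-piece zero (pos-≤ z≤n) (pos-≤ x≤)
    ... | inj₂ (inj₁ eq)  = contradiction eq (avoid refl)
    ... | inj₂ (inj₂ 2+≤) = in-piece (suc zero) (pos-≤ 2+≤) (<⇒≤ (pos-< (s≤s z≤n) x<))
    ∈E-cover {b} {i} {j} {suc zero} {x} i<n j<n ρ≤ x< _ avoid = cover b avoid (split-at-mark j x)
      where
        1x≤ : pos n 1 x ≤ pos n (1 + D) (suc (even n))
        1x≤ = pos-mono-≤ (s≤s z≤n) (≤-pred x<)
        cover : ∀ b → (1 ≡ 1 → b ≡ true → x ≢ odd j) → x ≤ even j ⊎ x ≡ odd j ⊎ 2 + even j ≤ x →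
                pos n 1 x ∈ₚ mainE n b i j
        cover b     avoid (inj₁ x≤)         =
          in-piece (suc zero) (<⇒≤ (pos-< (s≤s z≤n) (s≤s (2+even≤last i<n)))) (pos-≤ x≤)
        cover false avoid (inj₂ (inj₁ eq))  = in-piece (suc (suc zero)) (pos-≤ (≤-reflexive (sym eq))) 1x≤
        cover true  avoid (inj₂ (inj₁ eq))  = contradiction eq (avoid refl refl)
        cover false avoid (inj₂ (inj₂ 2+≤)) = in-piece (suc (suc zero)) (pos-≤ (<⇒≤ 2+≤)) 1x≤
        cover true  avoid (inj₂ (inj₂ 2+≤)) = in-piece (suc (suc zero)) (pos-≤ 2+≤) 1x≤
    ∈E-cover {b} {ρ = suc (suc ρ)} i<n j<n ρ≤ x< _ _ = in-piece (suc (suc zero))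
      (<⇒≤ (pos-< (s≤s (s≤s z≤n)) (s≤s (mark≤last b j<n))))
      (pos-mono-≤ ρ≤ (≤-pred x<))

    odd-injective : ∀ {i j} → odd i ≡ odd j → i ≡ j
    odd-injective = even-injective ∘ suc-injective

    half≤ : ∀ b {s} → index-of (b , s) ≤ D → s ≤ D
    half≤ b {s} le = ≤-trans (≤-trans (m≤m+n s s) (m≤n+m (s + s) (if b then 1 else 0))) le

    meet-U-E : ∀ {b i i′ j} → i < n → i′ < n → j < n → i ≢ i′ → Meet (mainU n i) (mainE n b i′ j)
    meet-U-E {i = i} i<n i′<n j<n i≢i′ = meet-at (pos n 0 (odd i)) (in-piece zero ≤-refl ≤-refl)
      (∈E-cover {ρ = 0} i′<n j<n z≤n (odd<width i<n) (λ _ → i≢i′ ∘ odd-injective) (λ ()))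

    -- The gaps of even levels have odd offsets, so they never contain the point of `U i` with
    -- offset `even i` in region `c`; odd levels cover region 0 entirely.
    meet-U-P : ∀ l {i j} → i < n → Meet (mainU n i) (mainP n (regions l) j)
    meet-U-P (false , s) {i} {j} i<n = meet-at (pos n c (even i)) (in-piece (suc zero) ≤-refl ≤-refl)
      (∈P-cover ≤-refl (m≤m+n c s) (even<width i<n) (λ _ → even≢odd i j))
    meet-U-P (true , s) {i} i<n = meet-at (pos n 0 (odd i)) (in-piece zero ≤-refl ≤-refl)
      (∈P-cover {ρ = 0} z≤n z≤n (odd<width i<n) (λ ()))

    0∈E : ∀ {b i j} → i < n → j < n → pos n 0 0 ∈ₚ mainE n b i j
    0∈E {b} {i} {j} i<n j<n = ∈E-cover {b} {i} {j} {0} {0} i<n j<n z≤n (s≤s z≤n) (λ _ ()) (λ ())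

    meet-E-E : ∀ {b i j b′ i′ j′} → i < n → j < n → i′ < n → j′ < n →
               Meet (mainE n b i j) (mainE n b′ i′ j′)
    meet-E-E {b} {i} {j} {b′} {i′} {j′} i<n j<n i′<n j′<n =
      meet-at (pos n 0 0) (0∈E {b} {i} {j} i<n j<n) (0∈E {b′} {i′} {j′} i′<n j′<n)

    -- An odd level starts at position 0 like `E i j`. An even level has its mark in a region
    -- covered by `E i j`, and only for level 0 can this mark be the gap.
    meet-E-P : ∀ l {b i j j′} → i < n → j < n → j′ < n → index-of l ≤ D →
               (l ≡ (false , 0) → b ≡ true → j ≢ j′) →
               Meet (mainE n b i j) (mainP n (regions l) j′)
    meet-E-P (true , s) {b} {i} {j} i<n j<n j′<n l≤D _ = meet-at (pos n 0 0) (0∈E {b} {i} {j} i<n j<n)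
      (∈P-cover {ρ = 0} z≤n z≤n (s≤s z≤n) (λ ()))
    meet-E-P (false , s) {b} {i} {j} {j′} i<n j<n j′<n l≤D avoid = meet-at (pos n (1 + s) (odd j′))
      (∈E-cover {b} {i} {j} i<n j<n (s≤s (half≤ false l≤D)) (odd<width j′<n) (λ ())
        (λ { refl b≡ eq → avoid refl b≡ (sym (odd-injective eq)) }))
      ∈P-mark

    -- The even mark in region `1 + s` is within reach of the odd cover if `s` is at most `s′`; the
    -- odd mark in region `c + suc s′` is within reach of the even cover if `s` is greater. One of
    -- the two always applies, and only a gap, which needs equal `j` and neighbouring levels, can
    -- prevent the meeting.
    meet-or-near : ∀ s s′ {j j′} → j < n → j′ < n →
      Meet (mainP n (regions (false , s)) j) (mainP n (regions (true , s′)) j′) ⊎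
      (j ≡ j′ × (s ≡ s′ ⊎ s ≡ suc s′))
    meet-or-near s s′ {j} {j′} j<n j′<n with <-cmp s s′
    ... | tri< s<s′ _ _ = inj₁ (meet-at (pos n (1 + s) (odd j)) ∈P-mark
          (∈P-cover z≤n (s≤s (<⇒≤ s<s′)) (odd<width j<n) (λ eq → contradiction (suc-injective eq) (<⇒≢ s<s′))))
    ... | tri≈ _ s≡s′ _ with j ≟ j′
    ...   | yes j≡j′ = inj₂ (j≡j′ , inj₁ s≡s′)
    ...   | no j≢j′  = inj₁ (meet-at (pos n (1 + s) (odd j)) ∈P-mark
          (∈P-cover z≤n (s≤s (≤-reflexive s≡s′)) (odd<width j<n) (λ _ → j≢j′ ∘ odd-injective)))
    meet-or-near s s′ {j} {j′} j<n j′<n | tri> _ _ s′<s with s ≟ suc s′ | j ≟ j′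
    ... | yes s≡ | yes j≡j′ = inj₂ (j≡j′ , inj₂ s≡)
    ... | no s≢  | _        = inj₁ (meet-at (pos n (c + suc s′) (odd j′))
          (∈P-cover (m≤m+n c _) (+-monoʳ-≤ c s′<s) (odd<width j′<n)
            (λ eq → contradiction (sym (+-cancelˡ-≡ c _ _ eq)) s≢))
          ∈P-mark)
    ... | yes _  | no j≢j′  = inj₁ (meet-at (pos n (c + suc s′) (odd j′))
          (∈P-cover (m≤m+n c _) (+-monoʳ-≤ c s′<s) (odd<width j′<n) (λ _ → j≢j′ ∘ sym ∘ odd-injective))
          ∈P-mark)

    near-index : ∀ s s′ → s ≡ s′ ⊎ s ≡ suc s′ →
      index-of (false , s) ≤ suc (index-of (true , s′)) × index-of (true , s′) ≤ suc (index-of (false , s))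
    near-index s _  (inj₁ refl) = ≤-trans (n≤1+n _) (n≤1+n _) , ≤-refl
    near-index _ s′ (inj₂ refl) rewrite +-suc s′ s′ = ≤-refl , ≤-trans (n≤1+n _) (n≤1+n _)

    -- Levels of equal parity begin at the same position, which is never in a gap.
    meet-P-P : ∀ l l′ {j j′} → j < n → j′ < n →
      Meet (mainP n (regions l) j) (mainP n (regions l′) j′) ⊎
      (j ≡ j′ × index-of l ≤ suc (index-of l′) × index-of l′ ≤ suc (index-of l))
    meet-P-P (false , s) (false , s′) {j} {j′} j<n j′<n = inj₁ (meet-at (pos n c 0)
      (∈P-cover {j = j} ≤-refl (m≤m+n c s) (s≤s z≤n) (λ _ ()))
      (∈P-cover {j = j′} ≤-refl (m≤m+n c s′) (s≤s z≤n) (λ _ ())))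
    meet-P-P (true , s) (true , s′) {j} {j′} j<n j′<n = inj₁ (meet-at (pos n 0 0)
      (∈P-cover {r = 1 + s} {j = j} {ρ = 0} z≤n z≤n (s≤s z≤n) (λ ()))
      (∈P-cover {r = 1 + s′} {j = j′} {ρ = 0} z≤n z≤n (s≤s z≤n) (λ ())))
    meet-P-P (false , s) (true , s′) j<n j′<n with meet-or-near s s′ j<n j′<n
    ... | inj₁ meet          = inj₁ meet
    ... | inj₂ (j≡j′ , near) = inj₂ (j≡j′ , near-index s s′ near)
    meet-P-P (true , s) (false , s′) j<n j′<n with meet-or-near s′ s j′<n j<n
    ... | inj₁ meet          = inj₁ (Meet-sym meet)
    ... | inj₂ (j≡j′ , near)    =
      let p , q = near-index s′ s near in inj₂ (sym j≡j′ , q , p)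

    -- Disjointness along the prescribed edges

    E-right : ∀ {b i j r y} → i < n → j < n → c ≤ r → ∀ k → proj₂ (lookup (mainE n b i j) k) < pos n r y
    E-right i<n j<n c≤r zero             = pos-< {r = 0} (≤-trans (s≤s z≤n) c≤r) (even<width i<n)
    E-right i<n j<n c≤r (suc zero)       = pos-< {r = 1} (≤-trans (s≤s (s≤s z≤n)) c≤r) (even<width j<n)
    E-right i<n j<n c≤r (suc (suc zero)) = pos-< {r = 1 + D} c≤r last<width

    ¬meet-U-U : ∀ {i i′} → i < n → i′ < n → i ≢ i′ → ¬ Meet (mainU n i) (mainU n i′)
    ¬meet-U-U {i} {i′} i<n i′<n i≢i′ (overlapping k k′ (p , q)) = distinct k k′ p q
      where
        same : ∀ {r r′ x y} → x < width n → y < width n → pos n r x ≤ pos n r′ y → pos n r′ y ≤ pos n r x →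
               r ≡ r′ × x ≡ y
        same x< y< p q = pos-injective x< y< (≤-antisym p q)
        distinct : ∀ k k′ → proj₁ (lookup (mainU n i) k) ≤ proj₂ (lookup (mainU n i′) k′) →
                   ¬ (proj₁ (lookup (mainU n i′) k′) ≤ proj₂ (lookup (mainU n i) k))
        distinct zero             zero             p q =
          i≢i′ (odd-injective (proj₂ (same {0} {0} (odd<width i<n) (odd<width i′<n) p q)))
        distinct zero             (suc zero)       p q with () ← proj₁ (same {0} {c} (odd<width i<n) (even<width i′<n) p q)
        distinct zero             (suc (suc zero)) p q with () ← proj₁ (same {0} {c} (odd<width i<n) (odd<width i′<n) p q)
        distinct (suc zero)       zero             p q with () ← proj₁ (same {c} {0} (even<width i<n) (odd<width i′<n) p q)
        distinct (suc zero)       (suc zero)       p q =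
          i≢i′ (even-injective (proj₂ (same {c} {c} (even<width i<n) (even<width i′<n) p q)))
        distinct (suc zero)       (suc (suc zero)) p q =
          even≢odd i i′ (proj₂ (same {c} {c} (even<width i<n) (odd<width i′<n) p q))
        distinct (suc (suc zero)) zero             p q with () ← proj₁ (same {c} {0} (odd<width i<n) (odd<width i′<n) p q)
        distinct (suc (suc zero)) (suc zero)       p q =
          even≢odd i′ i (sym (proj₂ (same {c} {c} (odd<width i<n) (even<width i′<n) p q)))
        distinct (suc (suc zero)) (suc (suc zero)) p q =
          i≢i′ (odd-injective (proj₂ (same {c} {c} (odd<width i<n) (odd<width i′<n) p q)))

    ¬meet-U-E : ∀ {b i j} → i < n → j < n → ¬ Meet (mainU n i) (mainE n b i j)
    ¬meet-U-E {b} {i} {j} i<n j<n = ¬Meet₃ sep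
      where
        sep : ∀ k k′ → Separated (lookup (mainU n i) k) (lookup (mainE n b i j) k′)
        sep zero             zero             = inj₂ (pos-mono-< ≤-refl)
        sep zero             (suc zero)       = inj₁ (pos-mono-< ≤-refl)
        sep zero             (suc (suc zero)) = inj₁ (pos-< {r = 0} {r′ = 1} (s≤s z≤n) (odd<width i<n))
        sep (suc zero)       k                = inj₂ (E-right {b} {i} {j} i<n j<n ≤-refl k)
        sep (suc (suc zero)) k                = inj₂ (E-right {b} {i} {j} i<n j<n ≤-refl k)

    ¬meet-E-P : ∀ {i j} → i < n → j < n → ¬ Meet (mainE n true i j) (mainP n (regions (false , 0)) j)
    ¬meet-E-P {i} {j} i<n j<n = ¬Meet₃ sep
      where
        sep : ∀ k k′ → Separated (lookup (mainE n true i j) k) (lookup (mainP n (regions (false , 0)) j) k′)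
        sep k                zero             = inj₁ (E-right {true} {i} {j} i<n j<n ≤-refl k)
        sep k                (suc zero)       = inj₁ (E-right {true} {i} {j} i<n j<n (m≤m+n c 0) k)
        sep zero             (suc (suc zero)) = inj₁ (pos-< {r = 0} {r′ = 1} (s≤s z≤n) (even<width i<n))
        sep (suc zero)       (suc (suc zero)) = inj₁ (pos-mono-< ≤-refl)
        sep (suc (suc zero)) (suc (suc zero)) = inj₂ (pos-mono-< ≤-refl)

    -- The even mark is the gap of the odd cover; the even cover lies between the odd cover and the
    -- odd mark, which is one region further right.
    ¬meet-even-odd : ∀ {s j} → s ≤ D → j < n →
      ¬ Meet (mainP n (regions (false , s)) j) (mainP n (regions (true , s)) j)
    ¬meet-even-odd {s} {j} s≤D j<n = ¬Meet₃ sep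
      where
        1+s<c+ : ∀ t → 1 + s < c + t
        1+s<c+ t = ≤-trans (s≤s (s≤s s≤D)) (m≤m+n c t)
        1+s<c : 1 + s < c
        1+s<c = s≤s (s≤s s≤D)
        c+s< : c + s < c + suc s
        c+s< = +-monoʳ-< c ≤-refl
        sep : ∀ k k′ → Separated (lookup (mainP n (regions (false , s)) j) k)
                                 (lookup (mainP n (regions (true , s)) j) k′)
        sep zero             zero             = inj₂ (pos-< 1+s<c (even<width j<n))
        sep zero             (suc zero)       = inj₂ (pos-< 1+s<c last<width)
        sep zero             (suc (suc zero)) = inj₁ (pos-< c+s< (even<width j<n))
        sep (suc zero)       zero             = inj₂ (pos-< (1+s<c+ s) (even<width j<n))
        sep (suc zero)       (suc zero)       = inj₂ (pos-< (1+s<c+ s) last<width)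
        sep (suc zero)       (suc (suc zero)) = inj₁ (pos-< c+s< last<width)
        sep (suc (suc zero)) zero             = inj₂ (pos-mono-< ≤-refl)
        sep (suc (suc zero)) (suc zero)       = inj₁ (pos-mono-< ≤-refl)
        sep (suc (suc zero)) (suc (suc zero)) = inj₁ (pos-< (1+s<c+ (suc s)) (odd<width j<n))

    -- The odd mark is the gap of the even cover; the odd cover ends in region `1 + s`, one before
    -- the even mark.
    ¬meet-odd-even : ∀ {s j} → s ≤ D → j < n →
      ¬ Meet (mainP n (regions (true , s)) j) (mainP n (regions (false , suc s)) j)
    ¬meet-odd-even {s} {j} s≤D j<n = ¬Meet₃ sep
      where
        1+s<c+ : ∀ t → 1 + s < c + t
        1+s<c+ t = ≤-trans (s≤s (s≤s s≤D)) (m≤m+n c t)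
        1+s<c : 1 + s < c
        1+s<c = s≤s (s≤s s≤D)
        2+s< : 2 + s < c + suc s
        2+s< = s≤s (s≤s (m≤n+m (suc s) D))
        sep : ∀ k k′ → Separated (lookup (mainP n (regions (true , s)) j) k)
                                 (lookup (mainP n (regions (false , suc s)) j) k′)
        sep zero             zero             = inj₁ (pos-< 1+s<c (even<width j<n))
        sep zero             (suc zero)       = inj₁ (pos-< (1+s<c+ (suc s)) (even<width j<n))
        sep zero             (suc (suc zero)) = inj₁ (pos-< ≤-refl (even<width j<n))
        sep (suc zero)       zero             = inj₁ (pos-< 1+s<c last<width)
        sep (suc zero)       (suc zero)       = inj₁ (pos-< (1+s<c+ (suc s)) last<width)
        sep (suc zero)       (suc (suc zero)) = inj₁ (pos-< ≤-refl last<width)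
        sep (suc (suc zero)) zero             = inj₂ (pos-mono-< ≤-refl)
        sep (suc (suc zero)) (suc zero)       = inj₁ (pos-mono-< ≤-refl)
        sep (suc (suc zero)) (suc (suc zero)) = inj₂ (pos-< 2+s< (odd<width j<n))

    -- The pieces are nonempty, disjoint and left of the extra ones

    U-proper : ∀ {i} → Proper (mainU n i)
    U-proper zero             = ≤-refl
    U-proper (suc zero)       = ≤-refl
    U-proper (suc (suc zero)) = ≤-refl

    U-apart : ∀ {i} → i < n → Apart (mainU n i)
    U-apart i<n = apart₃ (inj₁ (pos-< {r = 0} (s≤s z≤n) (odd<width i<n)))
      (inj₁ (pos-< {r = 0} (s≤s z≤n) (odd<width i<n))) (inj₁ (pos-mono-< ≤-refl))

    c<Z : c < Z
    c<Z = m<m+n c (s≤s z≤n)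

    U-below : ∀ {i} → i < n → Below Z (mainU n i)
    U-below i<n zero             = pos-< {r = 0} (s≤s z≤n) (odd<width i<n)
    U-below i<n (suc zero)       = pos-< {r = c} c<Z (even<width i<n)
    U-below i<n (suc (suc zero)) = pos-< {r = c} c<Z (odd<width i<n)

    E-proper : ∀ {b i j} → i < n → j < n → Proper (mainE n b i j)
    E-proper         i<n j<n zero             = pos-≤ z≤n
    E-proper         i<n j<n (suc zero)       = <⇒≤ (pos-< {r = 0} {r′ = 1} (s≤s z≤n) (s≤s (2+even≤last i<n)))
    E-proper {b = b} i<n j<n (suc (suc zero)) = pos-mono-≤ (s≤s z≤n) (mark≤last b j<n)

    E-apart : ∀ {b i j} → i < n → j < n → Apart (mainE n b i j)
    E-apart {b} {i} {j} i<n j<n = apart₃ (inj₁ (pos-mono-< (n≤1+n _))) (inj₁ (pos-< {r = 0} {r′ = 1} (s≤s z≤n) (even<width i<n)))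
      (inj₁ (pos-mono-< (even<mark b j)))

    P-proper : ∀ l {j} → j < n → Proper (mainP n (regions l) j)
    P-proper (false , s) j<n zero             = pos-mono-≤ (m≤m+n c s) z≤n
    P-proper (true , s)  j<n zero             = pos-mono-≤ z≤n z≤n
    P-proper (false , s) j<n (suc zero)       = pos-≤ {r = c + s} (2+even≤last j<n)
    P-proper (true , s)  j<n (suc zero)       = pos-≤ {r = 1 + s} (2+even≤last j<n)
    P-proper l           j<n (suc (suc zero)) = ≤-refl

    P-apart : ∀ l {j} → j < n → index-of l ≤ D → Apart (mainP n (regions l) j)
    P-apart (false , s) {j} j<n l≤D = apart₃ (inj₁ (pos-mono-< (n≤1+n _)))
      (inj₂ (pos-< 1+s<c (odd<width j<n)))
      (inj₂ (pos-< (≤-trans 1+s<c (m≤m+n c s)) (odd<width j<n)))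
      where
        1+s<c : 1 + s < c
        1+s<c = s≤s (s≤s (half≤ false l≤D))
    P-apart (true , s) {j} j<n l≤D = apart₃ (inj₁ (pos-mono-< (n≤1+n _)))
      (inj₁ (pos-< 1+s<c+ (even<width j<n)))
      (inj₁ (pos-< 1+s<c+ last<width))
      where
        1+s<c+ : 1 + s < c + suc s
        1+s<c+ = m<n+m (suc s) {c} (s≤s z≤n)

    P-below : ∀ l {j} → j < n → index-of l ≤ D → Below Z (mainP n (regions l) j)
    P-below (false , s) j<n l≤D = below
      where
        c+s<Z : c + s < Z
        c+s<Z = +-monoʳ-< c (s≤s (m≤n⇒m≤1+n (half≤ false l≤D)))
        below : Below Z (mainP n (regions (false , s)) _)
        below zero             = pos-< c+s<Z (even<width j<n)
        below (suc zero)       = pos-< c+s<Z last<width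
        below (suc (suc zero)) = pos-< (≤-trans (s≤s (s≤s (half≤ false l≤D))) (m≤m+n c c)) (odd<width j<n)
    P-below (true , s) j<n l≤D = below
      where
        1+s<c : 1 + s < c
        1+s<c = s≤s (s≤s (half≤ true l≤D))
        below : Below Z (mainP n (regions (true , s)) _)
        below zero             = pos-< (≤-trans 1+s<c (m≤m+n c c)) (even<width j<n)
        below (suc zero)       = pos-< (≤-trans 1+s<c (m≤m+n c c)) last<width
        below (suc (suc zero)) = pos-< (+-monoʳ-< c 1+s<c) (odd<width j<n)

  -- The gadget as the complement of an intersection graph

  module _ {n : ℕ} (cl : Fin n → Fin n → Bool) where

    main : Vertex D n → Vec Piece 3
    main (U i)   = mainU n (toℕ i)
    main (E i j) = mainE n (cl i j) (toℕ i) (toℕ j)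
    main (P m j) = mainP n (regions (level (toℕ m))) (toℕ j)

    offset : Vertex D n → ℕ
    offset (U i)   = 2 + toℕ i
    offset (E i j) = 0
    offset (P m j) = levelOffset (level (toℕ m))

    pieces : Vertex D n → Vec Piece (extra + 3)
    pieces x = withExtras extra n (offset x) (main x)

    desc≡pieces : ∀ x → Coding.desc coding cl x ≡ toList (pieces x)
    desc≡pieces (U i)   = refl
    desc≡pieces (E i j) = refl
    desc≡pieces (P m j) = refl

    level≤D : ∀ (m : Fin (suc D)) → index-of (level (toℕ m)) ≤ D
    level≤D m = ≤-trans (≤-reflexive (index-level (toℕ m))) (≤-pred (toℕ<n m))

    offset<width : ∀ x → offset x < width n
    offset<width (U i)   = s≤s (s≤s (≤-trans (toℕ<n i) (n≤even n)))
    offset<width (E i j) = s≤s z≤n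
    offset<width (P m j) with level (toℕ m)
    ... | false , _ = s≤s (s≤s z≤n)
    ... | true , _  = s≤s z≤n

    main-proper : ∀ x → Proper (main x)
    main-proper (U i)   = U-proper
    main-proper (E i j) = E-proper {b = cl i j} (toℕ<n i) (toℕ<n j)
    main-proper (P m j) = P-proper (level (toℕ m)) (toℕ<n j)

    main-apart : ∀ x → Apart (main x)
    main-apart (U i)   = U-apart (toℕ<n i)
    main-apart (E i j) = E-apart {b = cl i j} (toℕ<n i) (toℕ<n j)
    main-apart (P m j) = P-apart (level (toℕ m)) (toℕ<n j) (level≤D m)

    main-below : ∀ x → Below {n} Z (main x)
    main-below (U i)   = U-below (toℕ<n i)
    main-below (E i j) = E-right {b = cl i j} (toℕ<n i) (toℕ<n j) (m≤m+n c c)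
    main-below (P m j) = P-below (level (toℕ m)) (toℕ<n j) (level≤D m)

    E-P-close : ∀ i j m j′ → Meet (main (E i j)) (main (P m j′)) ⊎ Close cl (E i j) (P m j′)
    E-P-close i j zero j′ with cl i j in cl≡ | j Fin.≟ j′
    ... | true  | yes refl = inj₂ (EP cl≡)
    ... | true  | no j≢j′  = inj₁ (meet-E-P (false , 0) {b = true} (toℕ<n i) (toℕ<n j) (toℕ<n j′) z≤n
                               (λ _ _ → j≢j′ ∘ toℕ-injective))
    ... | false | _        = inj₁ (meet-E-P (false , 0) {b = false} (toℕ<n i) (toℕ<n j) (toℕ<n j′) z≤n (λ _ ()))
    -- Only level 0 has its mark in region 1, where `E i j` may have a gap.
    E-P-close i j (suc m) j′ = inj₁ (meet-E-P (level (suc (toℕ m))) {b = cl i j}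
      (toℕ<n i) (toℕ<n j) (toℕ<n j′) (level≤D (suc m)) (λ eq → contradiction eq (next≢0 (level (toℕ m)))))
      where
        next≢0 : ∀ l → next l ≢ (false , 0)
        next≢0 (false , s) ()
        next≢0 (true , s)  ()

    U-E-close : ∀ i i′ j → Meet (main (U i)) (main (E i′ j)) ⊎ Close {D} cl (U i) (E i′ j)
    U-E-close i i′ j with i Fin.≟ i′
    ... | yes refl = inj₂ UE
    ... | no i≢i′  = inj₁ (meet-U-E {b = cl i′ j} (toℕ<n i) (toℕ<n i′) (toℕ<n j) (i≢i′ ∘ toℕ-injective))

    flip-close : ∀ x y → Meet (main x) (main y) ⊎ Close cl x y → Meet (main y) (main x) ⊎ Close cl y x
    flip-close x y (inj₁ m) = inj₁ (Meet-sym m)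
    flip-close x y (inj₂ c) = inj₂ (Close-sym c)

    meet-or-close : ∀ x y → Meet (main x) (main y) ⊎ Close cl x y
    meet-or-close (U i)   (U i′)    = inj₂ UU
    meet-or-close (U i)   (E i′ j)  = U-E-close i i′ j
    meet-or-close (U i)   (P m j)   = inj₁ (meet-U-P (level (toℕ m)) (toℕ<n i))
    meet-or-close (E i j) (U i′)    = flip-close (U i′) (E i j) (U-E-close i′ i j)
    meet-or-close (E i j) (E i′ j′) =
      inj₁ (meet-E-E {b = cl i j} {b′ = cl i′ j′} (toℕ<n i) (toℕ<n j) (toℕ<n i′) (toℕ<n j′))
    meet-or-close (E i j) (P m j′)  = E-P-close i j m j′
    meet-or-close (P m j) (U i)     = flip-close (U i) (P m j) (inj₁ (meet-U-P (level (toℕ m)) (toℕ<n i)))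
    meet-or-close (P m j′) (E i j)  = flip-close (E i j) (P m j′) (E-P-close i j m j′)
    meet-or-close (P m j) (P m′ j′) with meet-P-P (level (toℕ m)) (level (toℕ m′)) (toℕ<n j) (toℕ<n j′)
    ... | inj₁ meet         = inj₁ meet
    ... | inj₂ (eq , p , q) with refl ← toℕ-injective eq
                            rewrite index-level (toℕ m) | index-level (toℕ m′) = inj₂ (PP p q)

    adjᵇ : Vertex D n → Vertex D n → Bool
    adjᵇ x y = not (meetᵇ (toList (pieces x)) (toList (pieces y)))

    T-adjᵇ : ∀ x y → T (adjᵇ x y) ⇔ (¬ Meet (pieces x) (pieces y))
    T-adjᵇ x y = mk⇔
      (λ t → Equivalence.to T-not t ∘ Equivalence.from (T-meetᵇ (pieces x) (pieces y)))
      (λ ¬m → Equivalence.from T-not (¬m ∘ Equivalence.to (T-meetᵇ (pieces x) (pieces y))))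

    pieces-proper : ∀ x → Proper (pieces x)
    pieces-proper x = withExtras-proper extra (main-proper x)

    disjoint-adj : ∀ x y → offset x ≢ offset y → ¬ Meet (main x) (main y) → T (adjᵇ x y)
    disjoint-adj x y w≢w′ ¬meet = Equivalence.from (T-adjᵇ x y)
      (¬Meet-withExtras extra (offset<width x) (offset<width y) w≢w′ (main-below x) (main-below y) ¬meet)

    gadget : Gadget D cl
    gadget = record
      { adj    = adjᵇ
      ; symm   = λ x y → from y x ∘ (λ ¬m → ¬m ∘ Meet-sym) ∘ to x y
      ; irrefl = λ x t → to x x t (self x (extra ↑ʳ zero))
      ; close  = λ x y t → close x y (to x y t) (meet-or-close x y)
      ; adj-UU = λ {i} {i′} i≢i′ → disjoint-adj (U i) (U i′)
          (i≢i′ ∘ toℕ-injective ∘ suc-injective ∘ suc-injective)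
          (¬meet-U-U (toℕ<n i) (toℕ<n i′) (i≢i′ ∘ toℕ-injective))
      ; adj-UE = λ i j → disjoint-adj (U i) (E i j) (λ ()) (¬meet-U-E {b = cl i j} (toℕ<n i) (toℕ<n j))
      ; adj-EP = λ {i} {j} t → disjoint-adj (E i j) (P zero j) (λ ())
          (subst (λ b → ¬ Meet (mainE n b (toℕ i) (toℕ j)) (main (P zero j)))
            (sym (Equivalence.to T-≡ t)) (¬meet-E-P (toℕ<n i) (toℕ<n j)))
      ; adj-PP = λ {m} {m′} {j} eq → disjoint-adj (P m j) (P m′ j) (offsets m m′ eq) (path m m′ j eq)
      }
      where
        to : ∀ x y → T (adjᵇ x y) → ¬ Meet (pieces x) (pieces y)
        to x y = Equivalence.to (T-adjᵇ x y)
        from : ∀ x y → ¬ Meet (pieces x) (pieces y) → T (adjᵇ x y)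
        from x y = Equivalence.from (T-adjᵇ x y)
        self : ∀ x → Fin (extra + 3) → Meet (pieces x) (pieces x)
        self x i = overlapping i i (pieces-proper x i , pieces-proper x i)
        close : ∀ x y → ¬ Meet (pieces x) (pieces y) → Meet (main x) (main y) ⊎ Close cl x y → Close cl x y
        close x y ¬m (inj₁ m) = contradiction (Meet-withExtras extra m) ¬m
        close x y ¬m (inj₂ c) = c
        offsets : ∀ m m′ → toℕ m′ ≡ suc (toℕ m) →
                  levelOffset (level (toℕ m)) ≢ levelOffset (level (toℕ m′))
        offsets m m′ eq rewrite eq with level (toℕ m)
        ... | false , _ = λ ()
        ... | true , _  = λ ()
        path : ∀ m m′ j → toℕ m′ ≡ suc (toℕ m) → ¬ Meet (main (P m j)) (main (P m′ j))
        path m m′ j eq rewrite eq with level (toℕ m) | level≤D m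
        ... | false , _ | l≤D = ¬meet-even-odd (half≤ {n} false l≤D) (toℕ<n j)
        ... | true , _  | l≤D = ¬meet-odd-even (half≤ {n} true l≤D) (toℕ<n j)

    toInterval : ∀ {I : Piece} → proj₁ I ≤ proj₂ I → Interval
    toInterval {a , b} a≤b = record
      { left = realize a ; right = realize b ; left≤right = realize-mono a≤b }

    overlap⇔ : ∀ {I J} (p : proj₁ I ≤ proj₂ I) (q : proj₁ J ≤ proj₂ J) →
               (⟦ toInterval p ⟧ ≬ ⟦ toInterval q ⟧) ⇔ Overlap I J
    overlap⇔ {a , b} {c , d} a≤b c≤d = mk⇔
      (λ (_ , (a≤x , x≤b) , (c≤x , x≤d)) →
        realize-cancel (ℚ.≤-trans a≤x x≤d) , realize-cancel (ℚ.≤-trans c≤x x≤b))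
      (λ (a≤d , c≤b) → realize (a ⊔ c) ,
        (realize-mono (m≤m⊔n a c) , realize-mono (⊔-lub a≤b c≤b)) ,
        (realize-mono (m≤n⊔m a c) , realize-mono (⊔-lub a≤d c≤d)))

    interval : Vertex D n → Fin (extra + 3) → Interval
    interval x i = toInterval (pieces-proper x i)

    multiInterval : Vertex D n → MultiInterval (extra + 3)
    multiInterval x = record
      { piece    = interval x
      ; disjoint = λ i j i≢j → withExtras-apart extra (offset<width x) (main-below x) (main-apart x) i j i≢j ∘
          Equivalence.to (overlap⇔ (pieces-proper x i) (pieces-proper x j))
      }

    meet⇔ : ∀ x y → (MultiInterval.points (multiInterval x) ≬ MultiInterval.points (multiInterval y)) ⇔
                    Meet (pieces x) (pieces y)
    meet⇔ x y = mk⇔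
      (λ (p , (i , p∈i) , (j , p∈j)) → overlapping i j
        (Equivalence.to (overlap⇔ (pieces-proper x i) (pieces-proper y j)) (p , p∈i , p∈j)))
      (λ (overlapping i j o) →
        let p , p∈i , p∈j = Equivalence.from (overlap⇔ (pieces-proper x i) (pieces-proper y j)) o
        in p , (i , p∈i) , (j , p∈j))

    represents : IsIntersectionGraph (MultiInterval.points ∘ multiInterval ∘ vertex)
                                     (complement (Gadget.graph gadget))
    represents u v = mk⇔
      (λ (u≢v , ¬adj) → u≢v , Equivalence.from (meet⇔ x y) (meets ¬adj))
      (λ (u≢v , meet) → u≢v , λ t → Equivalence.to (T-adjᵇ x y) t (Equivalence.to (meet⇔ x y) meet))
      where
        x y : Vertex D n
        x = vertex u
        y = vertex v
        meets : ¬ T (adjᵇ x y) → Meet (pieces x) (pieces y)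
        meets ¬adj = Equivalence.to (T-meetᵇ (pieces x) (pieces y))
          (decidable-stable (T? _) (¬adj ∘ Equivalence.from T-not))

  encode-pieces : ∀ {t} (v : Vec Piece t) (f : Fin t → Interval) →
    (∀ i → encodeInterval (f i) ≡ pieceTree (lookup v i)) →
    encodeFamily encodeInterval f ≡ enc (list tree) (List.map pieceTree (toList v))
  encode-pieces []      f eq = refl
  encode-pieces (I ∷ v) f eq = cong₂ _∙_ (eq zero) (encode-pieces v (f ∘ suc) (eq ∘ suc))

  construction : Construction D (co (multiIntervalGraphs (extra + 3)))
  construction = record
    { coding         = coding
    ; gadget         = gadget
    ; gadget-adj     = λ cl x y → cong₂ (λ xs ys → not (meetᵇ xs ys)) (sym (desc≡pieces cl x)) (sym (desc≡pieces cl y))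
    ; representation = λ cl → multiInterval cl ∘ vertex
    ; encode-rep     = λ cl → encodeFamily-lookup {B = tree} vertices (Coding.member coding ∘ Coding.desc coding cl)
        (λ u → trans
          (encode-pieces (pieces cl (vertex u)) (interval cl (vertex u))
            (λ i → cong₂ _∙_ (encode-realize (proj₁ (lookup (pieces cl (vertex u)) i)))
                             (encode-realize (proj₂ (lookup (pieces cl (vertex u)) i)))))
          (cong (Coding.member coding) (sym (desc≡pieces cl (vertex u)))))
    ; represents     = represents
    }

-- The three cases

hard-from-2 : ∀ C → (∀ D → Construction D C) → ∀ d → 2 ≤ d → W[2]-Hard (DistanceDominatingSet d C)
hard-from-2 C construct (suc (suc D)) _        = Hardness.hard (construct D)
hard-from-2 C construct (suc zero)    (s≤s ())

theorem7 : (∀ (d : ℕ) → 2 ≤ d →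
    W[2]-Hard (DistanceDominatingSet d unitTwoTrackIntervalGraphs))
    × W[2]-Hard (DistanceDominatingSet 2 (co (multiIntervalGraphs 3)))
    × (∀ (d : ℕ) → 3 ≤ d →
    W[2]-Hard (DistanceDominatingSet d (co (multiIntervalGraphs 4))))
theorem7 =
    hard-from-2 _ TwoTrack.construction
  , Hardness.hard (CoInterval.construction 0 0)
  -- Three pieces suffice for every `D`; the single extra piece makes them exactly four.
  , λ d 3≤d → hard-from-2 _ (λ D → CoInterval.construction D 1) d (≤-trans (n≤1+n 2) 3≤d)
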